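{- For $n \ge 0$ let $g_n$ be the number of strongly graded $(\mathbf{3+1})$-avoiding posets on the vertex set $[n]=\{1,\dots,n\}$ (so $g_0=1$). Let $$\Psi(x)=\sum_{m,n\ge 0}\frac{2^{mn}x^{m+n}}{m!\,n!}.$$ Then $$\sum_{n\ge 0} g_n\frac{x^n}{n!} \;=\; 1+\frac{e^{2x}(2e^x-3)+e^x(e^x-2)^2\Psi(x)}{e^x(2e^x+1)+(e^{2x}-2e^x-1)\Psi(x)}$$ as formal power series.
   Context: All posets are finite; a poset on $[n]$ is a partial order on the labeled set $[n]$, and two such posets are different if their order relations differ. A poset $P$ is weakly graded if there is a function $\operatorname{rk}:P\to\mathbb{N}$ such that $\operatorname{rk}(b)=\operatorname{rk}(a)+1$ whenever $b$ covers $a$, and such that the minimum value of $\operatorname{rk}$ on each connected component of $P$ is $0$. A weakly graded poset is strongly graded if all its minimal elements have the same rank and all its maximal elements have the same rank. A poset is $(\mathbf{3+1})$-avoiding if there are no four elements $x,y,z,w$ with $x<y<z$ and $w$ incomparable to each of $x,y,z$. -}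

module Defs where

open import Data.Nat as ℕ using (ℕ; zero; suc; _∸_; _^_; _!)
open import Data.Nat.Properties using (_!≢0; _!*_!≢0)
open import Data.Integer using (+_)
open import Data.Rational using (ℚ; _/_; _+_; _*_; _-_; 0ℚ; 1ℚ)
open import Data.Fin using (Fin)
open import Data.Vec using (Vec; lookup)
open import Data.Bool using (Bool; true)
open import Data.List using (List; length)
open import Data.List.Relation.Unary.Unique.Propositional using (Unique)
open import Data.List.Membership.Propositional using (_∈_)
open import Data.Product using (Σ; ∃; ∃-syntax; _×_)
open import Data.Sum using (_⊎_)
open import Relation.Nullary using (¬_)
open import Relation.Binary.PropositionalEquality using (_≡_; _≢_)
open import Relation.Binary.Construct.Closure.ReflexiveTransitive using (Star)
open import Function.Bundles using (_⇔_)

-- Relations on [n] = Fin n, encoded as Boolean n×n matrices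
-- (so that two relations are equal iff their order relations agree).

Rel : ℕ → Set
Rel n = Vec (Vec Bool n) n

module _ {n : ℕ} (M : Rel n) where

  _≼_ : Fin n → Fin n → Set
  i ≼ j = lookup (lookup M i) j ≡ true

  _≺_ : Fin n → Fin n → Set
  i ≺ j = i ≼ j × i ≢ j

  IsPartialOrder : Set
  IsPartialOrder =
    (∀ i → i ≼ i) ×
    (∀ i j → i ≼ j → j ≼ i → i ≡ j) ×
    (∀ i j k → i ≼ j → j ≼ k → i ≼ k)

  Covers : Fin n → Fin n → Set
  Covers b a = a ≺ b × ¬ (∃[ c ] (a ≺ c × c ≺ b))

  Comparable : Fin n → Fin n → Set
  Comparable a b = a ≼ b ⊎ b ≼ a

  Incomparable : Fin n → Fin n → Set
  Incomparable a b = ¬ (a ≼ b) × ¬ (b ≼ a)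

  Connected : Fin n → Fin n → Set
  Connected = Star Comparable

  Minimal : Fin n → Set
  Minimal a = ∀ b → b ≼ a → b ≡ a

  Maximal : Fin n → Set
  Maximal a = ∀ b → a ≼ b → b ≡ a

  -- rk is a rank function witnessing weak gradedness:
  -- covers raise rank by exactly one, and the minimum of rk on each
  -- connected component is 0 (every element is connected to an element of rank 0).
  IsWeakRank : (Fin n → ℕ) → Set
  IsWeakRank rk =
    (∀ a b → Covers b a → rk b ≡ suc (rk a)) ×
    (∀ a → ∃[ b ] (Connected a b × rk b ≡ 0))

  WeaklyGraded : Set
  WeaklyGraded = Σ (Fin n → ℕ) IsWeakRank

  StronglyGraded : Set
  StronglyGraded = Σ (Fin n → ℕ) λ rk →
    IsWeakRank rk ×
    (∀ a b → Minimal a → Minimal b → rk a ≡ rk b) ×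
    (∀ a b → Maximal a → Maximal b → rk a ≡ rk b)

  Avoids3+1 : Set
  Avoids3+1 = ¬ (∃[ x ] ∃[ y ] ∃[ z ] ∃[ w ]
    (x ≺ y × y ≺ z × Incomparable w x × Incomparable w y × Incomparable w z))

  IsSG31Poset : Set
  IsSG31Poset = IsPartialOrder × StronglyGraded × Avoids3+1

CountSG31 : ℕ → ℕ → Set
CountSG31 n k = Σ (List (Rel n)) λ L →
  length L ≡ k × Unique L × (∀ M → (M ∈ L) ⇔ IsSG31Poset M)

Series : Set
Series = ℕ → ℚ

sumTo : ℕ → (ℕ → ℚ) → ℚ
sumTo zero    f = f 0
sumTo (suc n) f = sumTo n f + f (suc n)

_⊕_ : Series → Series → Series
(f ⊕ g) n = f n + g n

_⊖_ : Series → Series → Series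
(f ⊖ g) n = f n - g n

_⊗_ : Series → Series → Series
(f ⊗ g) n = sumTo n (λ k → f k * g (n ∸ k))

infixl 6 _⊕_ _⊖_
infixl 7 _⊗_

const : ℚ → Series
const c zero    = c
const c (suc _) = 0ℚ

ℚ[_] : ℕ → ℚ
ℚ[ k ] = (+ k) / 1

expS : ℕ → Series
expS k n = (+ (k ^ n)) / (n !) where instance _ = n !≢0

-- Ψ(x) = Σ_{m,n≥0} 2^{mn} x^{m+n} / (m! n!); coefficient of x^N collects m + n = N.
ψterm : ℕ → ℕ → ℚ
ψterm N m = (+ (2 ^ (m ℕ.* (N ∸ m)))) / (m ! ℕ.* (N ∸ m) !)
  where instance _ = m !* (N ∸ m) !≢0

Ψ : Series
Ψ N = sumTo N (ψterm N)

egf : (ℕ → ℕ) → Series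
egf g n = (+ g n) / (n !) where instance _ = n !≢0

{-# OPTIONS --safe #-}
module Submission where

-- In a strongly graded poset two elements at least two levels apart are comparable as soon as
-- 3+1 is avoided: otherwise a maximal chain through one of them contains three elements
-- incomparable to the other.  So the order is encoded by the bipartite graphs H of the
-- *non*-comparabilities between consecutive levels, and (3+1)-avoidance says that no element
-- has H-neighbours both below and above.  Grouping the elements of level k + 1 with an H-neighbour
-- below together with the other elements of level k cuts the poset into a sequence of blocks
-- (matrices z × x) which interact only through one bit: a level is bad (it creates a cover of
-- rank difference two, or an element without cover) iff a virtual or actual x just below it and a
-- virtual or actual z just above it have no common neighbour on it, which is a condition on the
-- block below (colCond) and on the block above (rowCond).  Hence a 2 × 2 transfer matrix; the
-- generating functions of the four kinds of blocks are polynomials in e^x, e^-x and Ψ, and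
-- Cramer's rule gives the formula.

open import Algebra.Properties.CommutativeSemigroup using (interchange)
open import Algebra.Solver.Ring.AlmostCommutativeRing using (AlmostCommutativeRing; _-Raw-AlmostCommutative⟶_)
import Algebra.Solver.Ring as RingSolver
open import Algebra.Structures.Biased using (IsCommutativeSemiringˡ)
open import Data.Bool using (Bool; true; false; not; _∧_; _∨_; if_then_else_)
import Data.Bool.Properties as Boolₚ
open import Data.Empty using (⊥; ⊥-elim)
open import Data.Fin as Fin using (Fin; zero; suc; toℕ)
open import Data.Fin.Induction using (spo-wellFounded; spo-noetherian)
import Data.Fin.Properties as Finₚ
open import Data.Integer as ℤ using (ℤ; +_; 0ℤ; 1ℤ; -1ℤ)
import Data.Integer.Properties as ℤₚ
open import Data.Integer.Tactic.RingSolver using (solve-∀)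
open import Data.List as List using (List; []; _∷_; _++_; concatMap; length)
open import Data.List.Membership.Propositional using (_∈_)
open import Data.List.Relation.Unary.All as All using (All; []; _∷_)
open import Data.List.Relation.Unary.AllPairs using ([]; _∷_)
open import Data.List.Relation.Unary.Any using (here; there)
open import Data.List.Relation.Unary.Unique.Propositional using (Unique)
open import Data.Maybe using (Maybe; just; nothing)
open import Data.Nat as ℕ using (ℕ; zero; suc; z≤n; s≤s; _≡ᵇ_; _≤_; _<_; _∸_; _!)
import Data.Nat.Properties as ℕₚ
open import Data.Nat.Properties using (_!≢0; _!*_!≢0)
open import Data.Product using (∃; ∃-syntax; _×_; _,_; proj₁; proj₂)
open import Data.Rational as ℚ using (ℚ; 0ℚ; 1ℚ; _/_; toℚᵘ)
import Data.Rational.Properties as ℚₚ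
open import Data.Rational.Unnormalised as ℚᵘ using (mkℚᵘ; *≡*; _≃_)
import Data.Rational.Unnormalised.Properties as ℚᵘₚ
open import Data.Sum using (_⊎_; inj₁; inj₂)
open import Data.Unit using (⊤; tt)
open import Data.Vec as Vec using (Vec; []; _∷_; lookup; replicate; tabulate; zipWith)
open import Data.Vec.Properties
  using (≡-dec; lookup-map; lookup-replicate; lookup-zipWith; lookup∘tabulate; tabulate-cong; tabulate∘lookup)
open import Function using (Equivalence; _∘_; flip; id; mk⇔)
open import Induction.WellFounded using (Acc; WellFounded; acc)
open import Relation.Binary.Construct.Closure.ReflexiveTransitive using (ε; _◅_)
open import Relation.Binary.PropositionalEquality
open import Relation.Binary.Structures using (IsEquivalence; IsStrictPartialOrder)
open import Relation.Nullary using (Dec; does; no; yes; ¬_)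
open import Relation.Nullary.Decidable using (_×-dec_; dec-false; dec-true; ¬?)
open import Defs

-- Recording non-comparabilities instead of comparabilities is what leaves the blocks independent
-- apart from the bad levels. The number of levels is unbounded, yet no infinite sum is formed:
-- finite partial sums solve the transfer equations up to degree k, and each coefficient stabilises
-- because every additional level costs at least one vertex. The counting takes place on integer
-- coefficient sequences under the binomial product; rationals enter only at the end, through `ι`.
-- Cleared of negative powers of e^x, the determinant of the 2 × 2 system is e^x times the
-- denominator of the theorem, the terms in Ψ² cancelling. This denominator has constant term 3 - 2
-- = 1, so the multiplied-out identity determines the quotient. The summand 1 in the theorem is the
-- empty poset: a structure counted with initial bit `true` has all its levels inhabited, hence is
-- nonempty.

private variable
  A B C : Set
  n m : ℕ

-- Exponential generating functions

Seq : Set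
Seq = ℕ → ℤ

-- Σ_{a+b=n} n!/(a! b!) φ a b
bi : (ℕ → ℕ → ℤ) → Seq
bi φ zero    = φ 0 0
bi φ (suc n) = bi (λ a b → φ (suc a) b) n ℤ.+ bi (λ a b → φ a (suc b)) n

-- Product of exponential generating functions, on coefficient sequences.
infixl 7 _✶_
_✶_ : Seq → Seq → Seq
f ✶ g = bi (λ a b → f a ℤ.* g b)

bi-cong-≡ : ∀ {φ ψ} n → (∀ a b → a ℕ.+ b ≡ n → φ a b ≡ ψ a b) → bi φ n ≡ bi ψ n
bi-cong-≡ zero    e = e 0 0 refl
bi-cong-≡ (suc n) e = cong₂ ℤ._+_
  (bi-cong-≡ n (λ a b p → e (suc a) b (cong suc p)))
  (bi-cong-≡ n (λ a b p → e a (suc b) (trans (ℕₚ.+-suc a b) (cong suc p))))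

bi-cong : ∀ {φ ψ} → (∀ a b → φ a b ≡ ψ a b) → ∀ n → bi φ n ≡ bi ψ n
bi-cong e n = bi-cong-≡ n (λ a b _ → e a b)

private
  +-interchange : ∀ a b c d → (a ℤ.+ b) ℤ.+ (c ℤ.+ d) ≡ (a ℤ.+ c) ℤ.+ (b ℤ.+ d)
  +-interchange = interchange ℤₚ.+-commutativeSemigroup

+-congˡ : ∀ x {y z} → y ≡ z → x ℤ.+ y ≡ x ℤ.+ z
+-congˡ x = cong (λ t → x ℤ.+ t)

bi-+ : ∀ φ ψ n → bi (λ a b → φ a b ℤ.+ ψ a b) n ≡ bi φ n ℤ.+ bi ψ n
bi-+ φ ψ zero    = refl
bi-+ φ ψ (suc n) = trans (cong₂ ℤ._+_ (bi-+ _ _ n) (bi-+ _ _ n)) (+-interchange (bi _ n) (bi _ n) (bi _ n) (bi _ n))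

bi-*ˡ : ∀ c φ n → bi (λ a b → c ℤ.* φ a b) n ≡ c ℤ.* bi φ n
bi-*ˡ c φ zero    = refl
bi-*ˡ c φ (suc n) = trans (cong₂ ℤ._+_ (bi-*ˡ c _ n) (bi-*ˡ c _ n)) (sym (ℤₚ.*-distribˡ-+ c _ _))

bi-*ʳ : ∀ φ c n → bi (λ a b → φ a b ℤ.* c) n ≡ bi φ n ℤ.* c
bi-*ʳ φ c n = trans (bi-cong (λ a b → ℤₚ.*-comm (φ a b) c) n) (trans (bi-*ˡ c φ n) (ℤₚ.*-comm c _))

bi-neg : ∀ φ n → bi (λ a b → ℤ.- φ a b) n ≡ ℤ.- bi φ n
bi-neg φ zero    = refl
bi-neg φ (suc n) = trans (cong₂ ℤ._+_ (bi-neg _ n) (bi-neg _ n)) (sym (ℤₚ.neg-distrib-+ (bi _ n) (bi _ n)))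

bi-0 : ∀ n → bi (λ _ _ → 0ℤ) n ≡ 0ℤ
bi-0 zero    = refl
bi-0 (suc n) = cong₂ ℤ._+_ (bi-0 n) (bi-0 n)

bi-swap : ∀ φ n → bi φ n ≡ bi (flip φ) n
bi-swap φ zero    = refl
bi-swap φ (suc n) = trans (cong₂ ℤ._+_ (bi-swap _ n) (bi-swap _ n)) (ℤₚ.+-comm (bi _ n) (bi _ n))

-- Both sides obey the Leibniz rule for three factors: passing from `n` to `suc n` splits the sum
-- according to which of the three indices is raised, and only the bracketing differs.
bi-assoc : ∀ (τ : ℕ → ℕ → ℕ → ℤ) n →
  bi (λ a m → bi (τ a) m) n ≡ bi (λ m c → bi (λ a b → τ a b c) m) n
bi-assoc τ zero    = refl
bi-assoc τ (suc n) = begin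
  bi (λ a m → bi (τ (suc a)) m) n ℤ.+ bi (λ a m → bi (τ a) (suc m)) n
    ≡⟨ cong₂ ℤ._+_ (bi-assoc (λ a → τ (suc a)) n)
         (trans (bi-+ (λ a m → bi (λ b → τ a (suc b)) m) (λ a m → bi (λ b c → τ a b (suc c)) m) n)
           (cong₂ ℤ._+_ (bi-assoc (λ a b → τ a (suc b)) n) (bi-assoc (λ a b c → τ a b (suc c)) n))) ⟩
  X ℤ.+ (Y ℤ.+ Z)
    ≡⟨ sym (ℤₚ.+-assoc X Y Z) ⟩
  (X ℤ.+ Y) ℤ.+ Z
    ≡⟨ cong (ℤ._+ Z) (sym (bi-+ _ _ n)) ⟩
  bi (λ m c → bi (λ a b → τ a b c) m) (suc n) ∎
  where
  open ≡-Reasoning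
  X = bi (λ m c → bi (λ a b → τ (suc a) b c) m) n
  Y = bi (λ m c → bi (λ a b → τ a (suc b) c) m) n
  Z = bi (λ m c → bi (λ a b → τ a b (suc c)) m) n

𝟎 : Seq
𝟎 _ = 0ℤ

cst : ℤ → Seq
cst c zero    = c
cst c (suc _) = 0ℤ

infixl 6 _⊞_
infix 8 ⊟_
_⊞_ : Seq → Seq → Seq
(f ⊞ g) n = f n ℤ.+ g n

⊟_ : Seq → Seq
(⊟ f) n = ℤ.- f n

✶-comm : ∀ f g n → (f ✶ g) n ≡ (g ✶ f) n
✶-comm f g n = trans (bi-swap _ n) (bi-cong (λ a b → ℤₚ.*-comm (f b) (g a)) n)

✶-assoc : ∀ f g h n → ((f ✶ g) ✶ h) n ≡ (f ✶ (g ✶ h)) n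
✶-assoc f g h n = begin
  ((f ✶ g) ✶ h) n
    ≡⟨ bi-cong (λ m c → sym (bi-*ʳ (λ a b → f a ℤ.* g b) (h c) m)) n ⟩
  bi (λ m c → bi (λ a b → f a ℤ.* g b ℤ.* h c) m) n
    ≡⟨ sym (bi-assoc (λ a b c → f a ℤ.* g b ℤ.* h c) n) ⟩
  bi (λ a m → bi (λ b c → f a ℤ.* g b ℤ.* h c) m) n
    ≡⟨ bi-cong (λ a m → trans (bi-cong (λ b c → ℤₚ.*-assoc (f a) (g b) (h c)) m) (bi-*ˡ (f a) _ m)) n ⟩
  (f ✶ (g ✶ h)) n ∎
  where open ≡-Reasoning

✶-distribʳ : ∀ f g h n → ((g ⊞ h) ✶ f) n ≡ (g ✶ f ⊞ h ✶ f) n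
✶-distribʳ f g h n = trans (bi-cong (λ a b → ℤₚ.*-distribʳ-+ (f b) (g a) (h a)) n) (bi-+ _ _ n)

✶-zeroˡ : ∀ f n → (𝟎 ✶ f) n ≡ 0ℤ
✶-zeroˡ f n = bi-0 n

cst-✶ : ∀ c f n → (cst c ✶ f) n ≡ c ℤ.* f n
cst-✶ c f zero    = refl
cst-✶ c f (suc n) = trans (cong₂ ℤ._+_ (bi-0 n) (cst-✶ c (λ m → f (suc m)) n)) (ℤₚ.+-identityˡ _)

✶-identityˡ : ∀ f n → (cst 1ℤ ✶ f) n ≡ f n
✶-identityˡ f n = trans (cst-✶ 1ℤ f n) (ℤₚ.*-identityˡ (f n))

✶-cong : ∀ {f f′ g g′} n → (∀ m → m ℕ.≤ n → f m ≡ f′ m) → (∀ m → m ℕ.≤ n → g m ≡ g′ m) →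
  (f ✶ g) n ≡ (f′ ✶ g′) n
✶-cong n e e′ = bi-cong-≡ n (λ a b p → cong₂ ℤ._*_
  (e a (subst (a ℕ.≤_) p (ℕₚ.m≤m+n a b))) (e′ b (subst (b ℕ.≤_) p (ℕₚ.m≤n+m b a))))

infix 4 _≈[_]_
_≈[_]_ : Seq → ℕ → Seq → Set
f ≈[ k ] g = ∀ n → n ℕ.≤ k → f n ≡ g n

-- Power series modulo degree above `k`. The transfer equations hold for a finite partial sum over
-- the number of levels only to this precision, and the ring solver has to work there.
truncatedRing : ℕ → AlmostCommutativeRing _ _
truncatedRing k = record
  { Carrier = Seq
  ; _≈_     = _≈[ k ]_
  ; _+_     = _⊞_
  ; _*_     = _✶_
  ; -_      = ⊟_
  ; 0#      = 𝟎
  ; 1#      = cst 1ℤ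
  ; isAlmostCommutativeRing = record
    { isCommutativeSemiring = IsCommutativeSemiringˡ.isCommutativeSemiring record
      { +-isCommutativeMonoid = record
        { isMonoid = record
          { isSemigroup = record
            { isMagma = record
              { isEquivalence = equiv
              ; ∙-cong        = λ e e′ n p → cong₂ ℤ._+_ (e n p) (e′ n p) }
            ; assoc = λ f g h n _ → ℤₚ.+-assoc (f n) (g n) (h n) }
          ; identity = (λ f n _ → ℤₚ.+-identityˡ (f n)) , (λ f n _ → ℤₚ.+-identityʳ (f n)) }
        ; comm = λ f g n _ → ℤₚ.+-comm (f n) (g n) }
      ; *-isCommutativeMonoid = record
        { isMonoid = record
          { isSemigroup = record
            { isMagma = record
              { isEquivalence = equiv
              ; ∙-cong        = λ e e′ n p → ✶-cong n (λ m q → e m (ℕₚ.≤-trans q p)) (λ m q → e′ m (ℕₚ.≤-trans q p)) }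
            ; assoc = λ f g h n _ → ✶-assoc f g h n }
          ; identity = (λ f n _ → ✶-identityˡ f n) , (λ f n _ → trans (✶-comm f _ n) (✶-identityˡ f n)) }
        ; comm = λ f g n _ → ✶-comm f g n }
      ; distribʳ = λ f g h n _ → ✶-distribʳ f g h n
      ; zeroˡ    = λ f n _ → ✶-zeroˡ f n }
    ; -‿cong       = λ e n p → cong ℤ.-_ (e n p)
    ; -‿*-distribˡ = λ f g n _ → trans (bi-cong (λ a b → sym (ℤₚ.neg-distribˡ-* (f a) (g b))) n) (bi-neg _ n)
    ; -‿+-comm     = λ f g n _ → sym (ℤₚ.neg-distrib-+ (f n) (g n)) } }
  where
  equiv : IsEquivalence (_≈[ k ]_)
  equiv = record { refl = λ _ _ → refl ; sym = λ e n p → sym (e n p) ; trans = λ e e′ n p → trans (e n p) (e′ n p) }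

cst-hom : ∀ k → ℤ.+-*-rawRing -Raw-AlmostCommutative⟶ truncatedRing k
cst-hom k = record
  { ⟦_⟧    = cst
  ; +-homo = λ { a b zero _ → refl ; a b (suc n) _ → refl }
  ; *-homo = λ { a b zero _ → refl ; a b (suc n) _ → sym (trans (cst-✶ a (cst b) (suc n)) (ℤₚ.*-zeroʳ a)) }
  ; -‿homo = λ { a zero _ → refl ; a (suc n) _ → refl }
  ; 0-homo = λ { zero _ → refl ; (suc n) _ → refl }
  ; 1-homo = λ _ _ → refl }

cst-≟ : ∀ k (a b : ℤ) → Maybe (cst a ≈[ k ] cst b)
cst-≟ k a b with a ℤ.≟ b
... | yes e = just (λ n _ → cong (λ c → cst c n) e)
... | no _  = nothing

-- Counting Boolean matrices

∑ : ∀ {A : Set} → List A → (A → ℤ) → ℤ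
∑ []       f = 0ℤ
∑ (x ∷ xs) f = f x ℤ.+ ∑ xs f

∑-cong : ∀ xs {f g : A → ℤ} → (∀ x → f x ≡ g x) → ∑ xs f ≡ ∑ xs g
∑-cong []       e = refl
∑-cong (x ∷ xs) e = cong₂ ℤ._+_ (e x) (∑-cong xs e)

∑-0 : ∀ (xs : List A) → ∑ xs (λ _ → 0ℤ) ≡ 0ℤ
∑-0 []       = refl
∑-0 (x ∷ xs) = trans (ℤₚ.+-identityˡ _) (∑-0 xs)

∑-+ : ∀ xs (f g : A → ℤ) → ∑ xs (λ x → f x ℤ.+ g x) ≡ ∑ xs f ℤ.+ ∑ xs g
∑-+ []       f g = refl
∑-+ (x ∷ xs) f g = trans (+-congˡ (f x ℤ.+ g x) (∑-+ xs f g)) (+-interchange (f x) (g x) _ _)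

∑-*ˡ : ∀ xs c (f : A → ℤ) → ∑ xs (λ x → c ℤ.* f x) ≡ c ℤ.* ∑ xs f
∑-*ˡ []       c f = sym (ℤₚ.*-zeroʳ c)
∑-*ˡ (x ∷ xs) c f = trans (+-congˡ (c ℤ.* f x) (∑-*ˡ xs c f)) (sym (ℤₚ.*-distribˡ-+ c (f x) (∑ xs f)))

∑-*ʳ : ∀ xs (f : A → ℤ) c → ∑ xs (λ x → f x ℤ.* c) ≡ ∑ xs f ℤ.* c
∑-*ʳ xs f c = trans (∑-cong xs (λ x → ℤₚ.*-comm (f x) c)) (trans (∑-*ˡ xs c f) (ℤₚ.*-comm c _))

∑-neg : ∀ xs (f : A → ℤ) → ∑ xs (λ x → ℤ.- f x) ≡ ℤ.- ∑ xs f
∑-neg []       f = refl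
∑-neg (x ∷ xs) f = trans (+-congˡ (ℤ.- f x) (∑-neg xs f)) (sym (ℤₚ.neg-distrib-+ (f x) _))

∑-swap : ∀ xs (ys : List B) (f : A → B → ℤ) →
  ∑ xs (λ x → ∑ ys (f x)) ≡ ∑ ys (λ y → ∑ xs (λ x → f x y))
∑-swap []       ys f = sym (∑-0 ys)
∑-swap (x ∷ xs) ys f = trans (+-congˡ (∑ ys (f x)) (∑-swap xs ys f)) (sym (∑-+ ys (f x) _))

∑-++ : ∀ xs ys (f : A → ℤ) → ∑ (xs ++ ys) f ≡ ∑ xs f ℤ.+ ∑ ys f
∑-++ []       ys f = sym (ℤₚ.+-identityˡ _)
∑-++ (x ∷ xs) ys f = trans (+-congˡ (f x) (∑-++ xs ys f)) (sym (ℤₚ.+-assoc (f x) _ _))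

∑-map : ∀ (g : A → B) xs (f : B → ℤ) → ∑ (List.map g xs) f ≡ ∑ xs (f ∘ g)
∑-map g []       f = refl
∑-map g (x ∷ xs) f = +-congˡ (f (g x)) (∑-map g xs f)

∑-concatMap : ∀ (g : A → List B) xs (f : B → ℤ) → ∑ (concatMap g xs) f ≡ ∑ xs (λ x → ∑ (g x) f)
∑-concatMap g []       f = refl
∑-concatMap g (x ∷ xs) f = trans (∑-++ (g x) _ f) (+-congˡ (∑ (g x) f) (∑-concatMap g xs f))

pow2 : ℕ → ℤ
pow2 n = (+ 2) ℤ.^ n

vecs : List A → ∀ n → List (Vec A n)
vecs xs zero    = [] ∷ []
vecs xs (suc n) = concatMap (λ x → List.map (x ∷_) (vecs xs n)) xs

∑-vecs : ∀ xs n (f : Vec A (suc n) → ℤ) →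
  ∑ (vecs xs (suc n)) f ≡ ∑ xs (λ x → ∑ (vecs xs n) (λ v → f (x ∷ v)))
∑-vecs xs n f = trans (∑-concatMap _ xs f) (∑-cong xs (λ x → ∑-map (x ∷_) (vecs xs n) f))

bits : List Bool
bits = false ∷ true ∷ []

Mat : ℕ → ℕ → Set
Mat b a = Vec (Vec Bool a) b

rows : ∀ n → List (Vec Bool n)
rows = vecs bits

mats : ∀ b a → List (Mat b a)
mats b a = vecs (rows a) b

∑-bits : ∀ f → ∑ bits f ≡ f false ℤ.+ f true
∑-bits f = +-congˡ (f false) (ℤₚ.+-identityʳ (f true))

-- Matrices are enumerated by rows, whereas conditions on full columns factor over columns. The
-- first entry of each row is split off, and its sum is moved past the rest of that row and past the
-- rows that follow.
∑-mats-col : ∀ b a (f : Mat b (suc a) → ℤ) →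
  ∑ (mats b (suc a)) f ≡ ∑ (rows b) (λ c → ∑ (mats b a) (λ M → f (zipWith _∷_ c M)))
∑-mats-col zero    a f = cong (ℤ._+ 0ℤ) (sym (ℤₚ.+-identityʳ (f [])))
∑-mats-col (suc b) a f = begin
  ∑ (mats (suc b) (suc a)) f
    ≡⟨ ∑-vecs (rows (suc a)) b f ⟩
  ∑ (rows (suc a)) (λ r → ∑ (mats b (suc a)) (λ M → f (r ∷ M)))
    ≡⟨ ∑-vecs bits a _ ⟩
  ∑ bits (λ x → ∑ (rows a) (λ r → ∑ (mats b (suc a)) (λ M → f ((x ∷ r) ∷ M))))
    ≡⟨ ∑-cong bits (λ x → ∑-cong (rows a) (λ r → ∑-mats-col b a (λ M → f ((x ∷ r) ∷ M)))) ⟩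
  ∑ bits (λ x → ∑ (rows a) (λ r → ∑ (rows b) (λ c → ∑ (mats b a) (λ M → f ((x ∷ r) ∷ zipWith _∷_ c M)))))
    ≡⟨ ∑-cong bits (λ x → ∑-swap (rows a) (rows b) (λ r c → ∑ (mats b a) (λ M → f ((x ∷ r) ∷ zipWith _∷_ c M)))) ⟩
  ∑ bits (λ x → ∑ (rows b) (λ c → ∑ (rows a) (λ r → ∑ (mats b a) (λ M → f ((x ∷ r) ∷ zipWith _∷_ c M)))))
    ≡⟨ ∑-cong bits (λ x → ∑-cong (rows b) (λ c → sym (∑-vecs (rows a) b (λ M → f (zipWith _∷_ (x ∷ c) M))))) ⟩
  ∑ bits (λ x → ∑ (rows b) (λ c → ∑ (mats (suc b) a) (λ M → f (zipWith _∷_ (x ∷ c) M))))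
    ≡⟨ sym (∑-vecs bits b (λ c → ∑ (mats (suc b) a) (λ M → f (zipWith _∷_ c M)))) ⟩
  ∑ (rows (suc b)) (λ c → ∑ (mats (suc b) a) (λ M → f (zipWith _∷_ c M))) ∎
  where open ≡-Reasoning

every some : (A → Bool) → Vec A n → Bool
every φ []      = true
every φ (x ∷ v) = φ x ∧ every φ v
some φ []      = false
some φ (x ∷ v) = φ x ∨ some φ v

⟦_⟧ : Bool → ℤ
⟦ b ⟧ = if b then 1ℤ else 0ℤ

⟦∧⟧ : ∀ b c → ⟦ b ∧ c ⟧ ≡ ⟦ b ⟧ ℤ.* ⟦ c ⟧
⟦∧⟧ true  c = sym (ℤₚ.*-identityˡ ⟦ c ⟧)
⟦∧⟧ false c = refl

⟦not⟧ : ∀ b → ⟦ not b ⟧ ≡ 1ℤ ℤ.- ⟦ b ⟧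
⟦not⟧ true  = refl
⟦not⟧ false = refl

∑-every : ∀ xs (φ : A → Bool) n → ∑ (vecs xs n) (λ v → ⟦ every φ v ⟧) ≡ ∑ xs (λ x → ⟦ φ x ⟧) ℤ.^ n
∑-every xs φ zero    = refl
∑-every xs φ (suc n) = begin
  ∑ (vecs xs (suc n)) (λ v → ⟦ every φ v ⟧)
    ≡⟨ ∑-vecs xs n _ ⟩
  ∑ xs (λ x → ∑ (vecs xs n) (λ v → ⟦ φ x ∧ every φ v ⟧))
    ≡⟨ ∑-cong xs (λ x → trans (∑-cong (vecs xs n) (λ v → ⟦∧⟧ (φ x) (every φ v))) (∑-*ˡ (vecs xs n) ⟦ φ x ⟧ _)) ⟩
  ∑ xs (λ x → ⟦ φ x ⟧ ℤ.* ∑ (vecs xs n) (λ v → ⟦ every φ v ⟧))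
    ≡⟨ ∑-*ʳ xs _ _ ⟩
  ∑ xs (λ x → ⟦ φ x ⟧) ℤ.* ∑ (vecs xs n) (λ v → ⟦ every φ v ⟧)
    ≡⟨ cong (∑ xs (λ x → ⟦ φ x ⟧) ℤ.*_) (∑-every xs φ n) ⟩
  ∑ xs (λ x → ⟦ φ x ⟧) ℤ.^ suc n ∎
  where open ≡-Reasoning

∑-rows-1 : ∀ n → ∑ (rows n) (λ _ → 1ℤ) ≡ pow2 n
∑-rows-1 n = trans (∑-cong (rows n) (λ v → sym (cong ⟦_⟧ (every-true v)))) (∑-every bits (λ _ → true) n)
  where
  every-true : ∀ {n} (v : Vec Bool n) → every (λ _ → true) v ≡ true
  every-true []      = refl
  every-true (x ∷ v) = every-true v

∑-full : ∀ n → ∑ (rows n) (λ v → ⟦ every id v ⟧) ≡ 1ℤ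
∑-full n = trans (∑-every bits id n) (ℤₚ.^-zeroˡ n)

∑-empty : ∀ n → ∑ (rows n) (λ v → ⟦ every not v ⟧) ≡ 1ℤ
∑-empty n = trans (∑-every bits not n) (ℤₚ.^-zeroˡ n)

not-some : ∀ (φ : A → Bool) (v : Vec A n) → not (some φ v) ≡ every (not ∘ φ) v
not-some φ []      = refl
not-some φ (x ∷ v) with φ x
... | true  = refl
... | false = not-some φ v

⟦some⟧ : ∀ (v : Vec Bool n) → ⟦ some id v ⟧ ≡ 1ℤ ℤ.- ⟦ every not v ⟧
⟦some⟧ []          = refl
⟦some⟧ (true ∷ v)  = refl
⟦some⟧ (false ∷ v) = ⟦some⟧ v

∑-complement : ∀ n (φ : Vec Bool n → Bool) →
  ∑ (rows n) (λ v → 1ℤ ℤ.- ⟦ φ v ⟧) ≡ pow2 n ℤ.- ∑ (rows n) (λ v → ⟦ φ v ⟧)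
∑-complement n φ = trans (∑-+ (rows n) _ _) (cong₂ ℤ._+_ (∑-rows-1 n) (∑-neg (rows n) _))

∑-nonzero : ∀ n → ∑ (rows n) (λ v → ⟦ some id v ⟧) ≡ pow2 n ℤ.- 1ℤ
∑-nonzero n = trans (∑-cong (rows n) ⟦some⟧)
  (trans (∑-complement n (every not)) (cong (λ t → pow2 n ℤ.- t) (∑-empty n)))

∑-nonfull : ∀ n → ∑ (rows n) (λ v → ⟦ not (every id v) ⟧) ≡ pow2 n ℤ.- 1ℤ
∑-nonfull n = trans (∑-cong (rows n) (λ v → ⟦not⟧ (every id v)))
  (trans (∑-complement n (every id)) (cong (λ t → pow2 n ℤ.- t) (∑-full n)))

proper : Vec Bool n → Bool
proper v = some id v ∧ not (every id v)

-- The empty row is zero and full at once, so for length 0 the two exclusions overlap and 2^n - 2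
-- would give -1.
properCount : ℕ → ℤ
properCount zero    = 0ℤ
properCount (suc n) = pow2 (suc n) ℤ.- + 2

∑-proper : ∀ n → ∑ (rows n) (λ v → ⟦ proper v ⟧) ≡ properCount n
∑-proper zero    = refl
∑-proper (suc n) = begin
  ∑ (rows (suc n)) (λ v → ⟦ proper v ⟧)
    ≡⟨ ∑-cong (rows (suc n)) expand ⟩
  ∑ (rows (suc n)) (λ v → (1ℤ ℤ.- ⟦ every id v ⟧) ℤ.- ⟦ every not v ⟧)
    ≡⟨ trans (∑-+ (rows (suc n)) _ _) (cong₂ ℤ._+_ (∑-complement (suc n) (every id)) (∑-neg (rows (suc n)) _)) ⟩
  (pow2 (suc n) ℤ.- ∑ (rows (suc n)) (λ v → ⟦ every id v ⟧)) ℤ.- ∑ (rows (suc n)) (λ v → ⟦ every not v ⟧)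
    ≡⟨ cong₂ (λ x y → (pow2 (suc n) ℤ.- x) ℤ.- y) (∑-full (suc n)) (∑-empty (suc n)) ⟩
  (pow2 (suc n) ℤ.- 1ℤ) ℤ.- 1ℤ
    ≡⟨ ℤₚ.+-assoc (pow2 (suc n)) -1ℤ -1ℤ ⟩
  pow2 (suc n) ℤ.- + 2 ∎
  where
  open ≡-Reasoning
  expand : ∀ {n} (v : Vec Bool (suc n)) → ⟦ proper v ⟧ ≡ (1ℤ ℤ.- ⟦ every id v ⟧) ℤ.- ⟦ every not v ⟧
  expand (true ∷ v)  = trans (⟦not⟧ (every id v)) (sym (ℤₚ.+-identityʳ _))
  expand (false ∷ v) = trans (cong ⟦_⟧ (Boolₚ.∧-identityʳ (some id v))) (⟦some⟧ v)

-- Full rows and full columns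

fullCols : Mat m n → Vec Bool n
fullCols []      = replicate _ true
fullCols (r ∷ M) = zipWith _∧_ r (fullCols M)

fullRow : Vec Bool n → Bool
fullRow = every id

nonIso noFullRow noFullCol : Mat m n → Bool
nonIso = every (some id)
noFullRow = every (not ∘ fullRow)
noFullCol M = not (some id (fullCols M))

fullCols-zipWith : ∀ (c : Vec Bool m) (M : Mat m n) →
  fullCols (zipWith _∷_ c M) ≡ every id c ∷ fullCols M
fullCols-zipWith []      []      = refl
fullCols-zipWith (x ∷ c) (r ∷ M) = cong (zipWith _∧_ (x ∷ r)) (fullCols-zipWith c M)

∑-noFullCol : ∀ b a → ∑ (mats b a) (λ M → ⟦ noFullCol M ⟧) ≡ (pow2 b ℤ.- 1ℤ) ℤ.^ a
∑-noFullCol b zero = trans (∑-cong (mats b 0) (λ M → cong (λ v → ⟦ not (some id v) ⟧) (noCols (fullCols M))))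
  (trans (∑-cong (mats b 0) (λ M → cong ⟦_⟧ (sym (every-true M)))) (trans (∑-every (rows 0) (λ _ → true) b) (ℤₚ.^-zeroˡ b)))
  where
  noCols : ∀ (v : Vec Bool 0) → v ≡ []
  noCols [] = refl
  every-true : ∀ {b} (M : Mat b 0) → every (λ _ → true) M ≡ true
  every-true []      = refl
  every-true (r ∷ M) = every-true M
∑-noFullCol b (suc a) = begin
  ∑ (mats b (suc a)) (λ M → ⟦ noFullCol M ⟧)
    ≡⟨ ∑-mats-col b a _ ⟩
  ∑ (rows b) (λ c → ∑ (mats b a) (λ M → ⟦ noFullCol (zipWith _∷_ c M) ⟧))
    ≡⟨ ∑-cong (rows b) (λ c → trans (∑-cong (mats b a) (step c)) (∑-*ˡ (mats b a) ⟦ not (every id c) ⟧ _)) ⟩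
  ∑ (rows b) (λ c → ⟦ not (every id c) ⟧ ℤ.* ∑ (mats b a) (λ M → ⟦ noFullCol M ⟧))
    ≡⟨ ∑-*ʳ (rows b) _ _ ⟩
  ∑ (rows b) (λ c → ⟦ not (every id c) ⟧) ℤ.* ∑ (mats b a) (λ M → ⟦ noFullCol M ⟧)
    ≡⟨ cong₂ ℤ._*_ (∑-nonfull b) (∑-noFullCol b a) ⟩
  (pow2 b ℤ.- 1ℤ) ℤ.^ suc a ∎
  where
  open ≡-Reasoning
  step : ∀ c M → ⟦ noFullCol (zipWith _∷_ c M) ⟧ ≡ ⟦ not (every id c) ⟧ ℤ.* ⟦ noFullCol M ⟧
  step c M rewrite fullCols-zipWith c M with every id c
  ... | true  = refl
  ... | false = sym (ℤₚ.*-identityˡ _)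

bi-∑ : ∀ {A : Set} (xs : List A) (φ : A → ℕ → ℕ → ℤ) n →
  bi (λ i j → ∑ xs (λ x → φ x i j)) n ≡ ∑ xs (λ x → bi (φ x) n)
bi-∑ []       φ n = bi-0 n
bi-∑ (x ∷ xs) φ n = trans (bi-+ (φ x) _ n) (+-congˡ (bi (φ x) n) (bi-∑ xs φ n))

∑-fullRow : ∀ a (f : Vec Bool a → ℤ) →
  ∑ (rows a) (λ r → if fullRow r then f r else 0ℤ) ≡ f (replicate a true)
∑-fullRow zero    f = ℤₚ.+-identityʳ (f [])
∑-fullRow (suc a) f = begin
  ∑ (rows (suc a)) (λ r → if fullRow r then f r else 0ℤ)
    ≡⟨ trans (∑-vecs bits a _) (∑-bits (λ x → ∑ (rows a) (λ r → if fullRow (x ∷ r) then f (x ∷ r) else 0ℤ))) ⟩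
  ∑ (rows a) (λ _ → 0ℤ) ℤ.+ ∑ (rows a) (λ r → if fullRow r then f (true ∷ r) else 0ℤ)
    ≡⟨ cong₂ ℤ._+_ (∑-0 (rows a)) (∑-fullRow a (λ r → f (true ∷ r))) ⟩
  0ℤ ℤ.+ f (replicate (suc a) true)
    ≡⟨ ℤₚ.+-identityˡ _ ⟩
  f (replicate (suc a) true) ∎
  where open ≡-Reasoning

all-∧ : ∀ {a} (μ : Vec Bool a) → zipWith _∧_ μ (replicate a true) ≡ μ
all-∧ []      = refl
all-∧ (x ∷ μ) = cong₂ _∷_ (Boolₚ.∧-identityʳ x) (all-∧ μ)

if-split : ∀ b (c : ℤ) → c ≡ (if b then c else 0ℤ) ℤ.+ ⟦ not b ⟧ ℤ.* c
if-split true  c = sym (ℤₚ.+-identityʳ c)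
if-split false c = sym (trans (ℤₚ.+-identityˡ _) (ℤₚ.*-identityˡ c))

-- Deleting the full rows of a matrix without full columns leaves such a matrix
-- again; the mask μ records the columns still under consideration.
module _ (a : ℕ) where

  noFullIn : Vec Bool a → Mat m a → Bool
  noFullIn μ []      = not (some id μ)
  noFullIn μ (r ∷ M) = noFullIn (zipWith _∧_ μ r) M

  reduced : Vec Bool a → ℕ → ℤ
  reduced μ b = ∑ (mats b a) (λ M → ⟦ noFullRow M ∧ noFullIn μ M ⟧)

  reduced-suc : ∀ μ b → reduced μ (suc b) ≡
    ∑ (rows a) (λ r → ⟦ not (fullRow r) ⟧ ℤ.* reduced (zipWith _∧_ μ r) b)
  reduced-suc μ b = trans (∑-vecs (rows a) b _) (∑-cong (rows a) (λ r → trans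
    (∑-cong (mats b a) (λ M → trans
      (cong ⟦_⟧ (Boolₚ.∧-assoc (not (fullRow r)) (noFullRow M) (noFullIn (zipWith _∧_ μ r) M)))
      (⟦∧⟧ (not (fullRow r)) _)))
    (∑-*ˡ (mats b a) ⟦ not (fullRow r) ⟧ _)))

  -- The two summands of `bi` at `suc b` are the two fates of the first row: a row that is not full
  -- is kept and cuts down the mask, a full row is deleted and leaves the mask as it was.
  ∑-noFullIn : ∀ b μ → ∑ (mats b a) (λ M → ⟦ noFullIn μ M ⟧) ≡ bi (λ j _ → reduced μ j) b
  ∑-noFullIn zero    μ = refl
  ∑-noFullIn (suc b) μ = begin
    ∑ (mats (suc b) a) (λ M → ⟦ noFullIn μ M ⟧)
      ≡⟨ ∑-vecs (rows a) b _ ⟩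
    ∑ (rows a) (λ r → ∑ (mats b a) (λ M → ⟦ noFullIn (zipWith _∧_ μ r) M ⟧))
      ≡⟨ ∑-cong (rows a) (λ r → trans (∑-noFullIn b (zipWith _∧_ μ r)) (if-split (fullRow r) _)) ⟩
    ∑ (rows a) (λ r → (if fullRow r then S r else 0ℤ) ℤ.+ ⟦ not (fullRow r) ⟧ ℤ.* S r)
      ≡⟨ ∑-+ (rows a) _ _ ⟩
    ∑ (rows a) (λ r → if fullRow r then S r else 0ℤ) ℤ.+ ∑ (rows a) (λ r → ⟦ not (fullRow r) ⟧ ℤ.* S r)
      ≡⟨ ℤₚ.+-comm (∑ (rows a) (λ r → if fullRow r then S r else 0ℤ)) _ ⟩
    ∑ (rows a) (λ r → ⟦ not (fullRow r) ⟧ ℤ.* S r) ℤ.+ ∑ (rows a) (λ r → if fullRow r then S r else 0ℤ)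
      ≡⟨ cong₂ ℤ._+_
           (trans (∑-cong (rows a) (λ r → sym (bi-*ˡ ⟦ not (fullRow r) ⟧ _ b)))
             (trans (sym (bi-∑ (rows a) _ b)) (bi-cong (λ j _ → sym (reduced-suc μ j)) b)))
           (trans (∑-fullRow a S) (cong (λ ν → bi (λ j _ → reduced ν j) b) (all-∧ μ))) ⟩
    bi (λ j _ → reduced μ j) (suc b) ∎
    where
    open ≡-Reasoning
    S : Vec Bool a → ℤ
    S r = bi (λ j _ → reduced (zipWith _∧_ μ r) j) b

  noFullIn-cols : ∀ μ (M : Mat m a) → noFullIn μ M ≡ not (some id (zipWith _∧_ μ (fullCols M)))
  noFullIn-cols μ []      = cong (not ∘ some id) (sym (all-∧ μ))
  noFullIn-cols μ (r ∷ M) = trans (noFullIn-cols _ M) (cong (not ∘ some id) (assoc μ r (fullCols M)))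
    where
    assoc : ∀ {a} (x y z : Vec Bool a) → zipWith _∧_ (zipWith _∧_ x y) z ≡ zipWith _∧_ x (zipWith _∧_ y z)
    assoc []      []      []      = refl
    assoc (p ∷ x) (q ∷ y) (r ∷ z) = cong₂ _∷_ (Boolₚ.∧-assoc p q r) (assoc x y z)

  noFullIn-all : ∀ (M : Mat m a) → noFullIn (replicate a true) M ≡ noFullCol M
  noFullIn-all M = trans (noFullIn-cols _ M) (cong (not ∘ some id) (true-∧ (fullCols M)))
    where
    true-∧ : ∀ {a} (v : Vec Bool a) → zipWith _∧_ (replicate a true) v ≡ v
    true-∧ []      = refl
    true-∧ (x ∷ v) = cong (x ∷_) (true-∧ v)

  -- The matrices without full column are sorted by their set of full rows. Since `fullCols []` is
  -- all true, the case in which every row is full and deleted needs no exception.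
  ∑-noFull : ∀ b → bi (λ j _ → ∑ (mats j a) (λ M → ⟦ noFullRow M ∧ noFullCol M ⟧)) b ≡ (pow2 b ℤ.- 1ℤ) ℤ.^ a
  ∑-noFull b = trans (bi-cong (λ j _ → ∑-cong (mats j a) (λ M → cong (λ t → ⟦ noFullRow M ∧ t ⟧) (sym (noFullIn-all M)))) b)
    (trans (sym (∑-noFullIn b (replicate a true)))
      (trans (∑-cong (mats b a) (λ M → cong ⟦_⟧ (noFullIn-all M))) (∑-noFullCol b a)))

-- Rows are the upper vertices z, columns the lower vertices x.  The empty cases let a virtual
-- vertex (or, for want of neighbours, any vertex) play the role of the full row or column.
rowCond colCond : Mat m n → Bool
rowCond {m} {n} M = (n ≡ᵇ 0) ∨ some fullRow M
colCond {m} {n} M = (m ≡ᵇ 0) ∨ some id (fullCols M)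

some-∧ : ∀ (v w : Vec Bool n) → some id (zipWith _∧_ v w) ≡ true → some id v ≡ true
some-∧ []          []      ()
some-∧ (true ∷ v)  (y ∷ w) e = refl
some-∧ (false ∷ v) (y ∷ w) e = some-∧ v w e

some-∧ʳ : ∀ (v w : Vec Bool n) → some id (zipWith _∧_ v w) ≡ true → some id w ≡ true
some-∧ʳ []          []          ()
some-∧ʳ (x ∷ v)     (true ∷ w)  e = refl
some-∧ʳ (true ∷ v)  (false ∷ w) e = some-∧ʳ v w e
some-∧ʳ (false ∷ v) (false ∷ w) e = some-∧ʳ v w e

fullCol⇒nonIso : ∀ (M : Mat m n) → some id (fullCols M) ≡ true → nonIso M ≡ true
fullCol⇒nonIso []      e = refl
fullCol⇒nonIso (r ∷ M) e rewrite some-∧ r (fullCols M) e = fullCol⇒nonIso M (some-∧ʳ r (fullCols M) e)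

-- Correction for the 0 × 0 block, where `rowCond` and `colCond` hold although there is neither a
-- full row nor a full column. In the other degenerate shapes the emptiness clause agrees with
-- vacuous truth: rows of length 0 and columns of height 0 are full.
δ₀₀ : ℕ → ℕ → ℤ
δ₀₀ a b = cst 1ℤ a ℤ.* cst 1ℤ b

nonIso-empty : ∀ b → (M : Mat b 0) → nonIso M ≡ (b ≡ᵇ 0)
nonIso-empty zero    []       = refl
nonIso-empty (suc b) ([] ∷ M) = refl

noFullRow-empty : ∀ b → (M : Mat b 0) → noFullRow M ≡ (b ≡ᵇ 0)
noFullRow-empty zero    []       = refl
noFullRow-empty (suc b) ([] ∷ M) = refl

noFullCol-empty : ∀ b → (M : Mat b 0) → noFullCol M ≡ true
noFullCol-empty b M with fullCols M
... | [] = refl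

-- A full column puts a true entry into every row, so `nonIso` drops out.
indicator-p : ∀ {b a} (M : Mat b a) → ⟦ nonIso M ∧ colCond M ⟧ ≡ 1ℤ ℤ.- ⟦ noFullCol M ⟧ ℤ.+ δ₀₀ a b
indicator-p {zero} {zero}  []  = refl
indicator-p {zero} {suc a} []  = refl
indicator-p {suc b} {a} M@(_ ∷ _) rewrite ℤₚ.*-zeroʳ (cst 1ℤ a) with some id (fullCols M) in e
... | true  rewrite fullCol⇒nonIso M e = refl
... | false rewrite Boolₚ.∧-zeroʳ (nonIso M) = refl

-- Here `nonIso` stays, because a full row says nothing about the others; this is the origin of the
-- rows that are neither zero nor full.
indicator-u : ∀ {b a} (M : Mat b a) → ⟦ nonIso M ∧ rowCond M ⟧ ≡ ⟦ nonIso M ⟧ ℤ.- ⟦ nonIso M ∧ noFullRow M ⟧ ℤ.+ δ₀₀ a b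
indicator-u {b} {zero} M rewrite nonIso-empty b M | noFullRow-empty b M with b
... | zero  = refl
... | suc _ = refl
indicator-u {b} {suc a} M rewrite sym (not-some fullRow M) with nonIso M | some fullRow M
... | true  | true  = refl
... | true  | false = refl
... | false | _     = refl

-- Inclusion-exclusion over the absence of a full row and of a full column; once a full column is
-- present, `nonIso` is automatic.
indicator-pu : ∀ {b a} (M : Mat b a) → ⟦ (nonIso M ∧ rowCond M) ∧ colCond M ⟧ ≡
  1ℤ ℤ.- ⟦ noFullCol M ⟧ ℤ.- ⟦ noFullRow M ⟧ ℤ.+ ⟦ noFullRow M ∧ noFullCol M ⟧ ℤ.+ δ₀₀ a b
indicator-pu {zero}  {zero}  []       = refl
indicator-pu {suc b} {zero}  ([] ∷ M) rewrite noFullCol-empty (suc b) ([] ∷ M) = refl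
indicator-pu {zero}  {suc a} []       = refl
indicator-pu {suc b} {suc a} M@(_ ∷ _) rewrite sym (not-some fullRow M) with some id (fullCols M) in e
... | true rewrite fullCol⇒nonIso M e with some fullRow M
...   | true  = refl
...   | false = refl
indicator-pu {suc b} {suc a} M@(_ ∷ _) | false rewrite Boolₚ.∧-zeroʳ (nonIso M ∧ some fullRow M) with some fullRow M
...   | true  = refl
...   | false = refl

-- Generating functions of the kinds of blocks

blocks : (∀ {b a} → Mat b a → Bool) → Seq
blocks φ = bi (λ a b → ∑ (mats b a) (λ M → ⟦ φ M ⟧))

NonIso NonIso-col NonIso-row NonIso-both NonIso-noFullRow NoFullRow NoFullCol NoFull : Seq
NonIso           = blocks nonIso
NonIso-col       = blocks (λ M → nonIso M ∧ colCond M)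
NonIso-row       = blocks (λ M → nonIso M ∧ rowCond M)
NonIso-both      = blocks (λ M → (nonIso M ∧ rowCond M) ∧ colCond M)
NonIso-noFullRow = blocks (λ M → nonIso M ∧ noFullRow M)
NoFullRow        = blocks noFullRow
NoFullCol        = blocks noFullCol
NoFull           = blocks (λ M → noFullRow M ∧ noFullCol M)

exp exp⁻¹ ψ : Seq
exp _   = 1ℤ
exp⁻¹ n = -1ℤ ℤ.^ n
ψ       = bi (λ a b → pow2 a ℤ.^ b)

binomial : ∀ x m → bi (λ b _ → x ℤ.^ b) m ≡ (x ℤ.+ 1ℤ) ℤ.^ m
binomial x zero    = refl
binomial x (suc m) = begin
  bi (λ b _ → x ℤ.* x ℤ.^ b) m ℤ.+ bi (λ b _ → x ℤ.^ b) m
    ≡⟨ cong₂ ℤ._+_ (trans (bi-*ˡ x _ m) (cong (x ℤ.*_) (binomial x m))) (binomial x m) ⟩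
  x ℤ.* (x ℤ.+ 1ℤ) ℤ.^ m ℤ.+ (x ℤ.+ 1ℤ) ℤ.^ m
    ≡⟨ distr x ((x ℤ.+ 1ℤ) ℤ.^ m) ⟩
  (x ℤ.+ 1ℤ) ℤ.^ suc m ∎
  where
  open ≡-Reasoning
  distr : ∀ x y → x ℤ.* y ℤ.+ y ≡ (x ℤ.+ 1ℤ) ℤ.* y
  distr = solve-∀

exp✶bi : ∀ φ n → (exp ✶ bi φ) n ≡ bi (λ a m → bi (λ b _ → φ a b) m) n
exp✶bi φ n = begin
  (exp ✶ bi φ) n                              ≡⟨ ✶-comm exp (bi φ) n ⟩
  (bi φ ✶ exp) n                              ≡⟨ bi-cong (λ m _ → ℤₚ.*-identityʳ (bi φ m)) n ⟩
  bi (λ m _ → bi φ m) n                     ≡⟨ sym (bi-assoc (λ a b _ → φ a b) n) ⟩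
  bi (λ a m → bi (λ b _ → φ a b) m) n       ∎
  where open ≡-Reasoning

-- A factor e^x adjoins a set of rows of one further type, so each row has one more choice;
-- algebraically this is the binomial theorem in the index `b`. It carries the bases 2^a - 1 and 2^a
-- - 2 back to the base 2^a of `ψ`.
exp✶power : ∀ (t : Seq) n → (exp ✶ bi (λ a b → t a ℤ.^ b)) n ≡ bi (λ a b → (t a ℤ.+ 1ℤ) ℤ.^ b) n
exp✶power t n = trans (exp✶bi _ n) (bi-cong (λ a → binomial (t a)) n)

exp-inverse : ∀ n → (exp ✶ exp⁻¹) n ≡ cst 1ℤ n
exp-inverse n = begin
  (exp ✶ exp⁻¹) n                   ≡⟨ ✶-comm exp exp⁻¹ n ⟩
  (exp⁻¹ ✶ exp) n                   ≡⟨ bi-cong (λ a _ → ℤₚ.*-identityʳ (exp⁻¹ a)) n ⟩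
  bi (λ b _ → -1ℤ ℤ.^ b) n      ≡⟨ binomial -1ℤ n ⟩
  0ℤ ℤ.^ n                      ≡⟨ zeroPow n ⟩
  cst 1ℤ n                      ∎
  where
  open ≡-Reasoning
  zeroPow : ∀ n → 0ℤ ℤ.^ n ≡ cst 1ℤ n
  zeroPow zero    = refl
  zeroPow (suc n) = refl

minus-plus : ∀ x → x ℤ.- 1ℤ ℤ.+ 1ℤ ≡ x
minus-plus = solve-∀

exp✶exp : ∀ n → (exp ✶ exp) n ≡ pow2 n
exp✶exp n = trans (bi-cong (λ a _ → sym (ℤₚ.^-zeroˡ a)) n) (binomial 1ℤ n)

NonIso-power : ∀ n → NonIso n ≡ bi (λ a b → (pow2 a ℤ.- 1ℤ) ℤ.^ b) n
NonIso-power = bi-cong (λ a b → trans (∑-every (rows a) (some id) b) (cong (ℤ._^ b) (∑-nonzero a)))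

NoFullRow-power : ∀ n → NoFullRow n ≡ bi (λ a b → (pow2 a ℤ.- 1ℤ) ℤ.^ b) n
NoFullRow-power = bi-cong (λ a b → trans (∑-every (rows a) (not ∘ fullRow) b) (cong (ℤ._^ b) (∑-nonfull a)))

NoFullCol-power : ∀ n → NoFullCol n ≡ bi (λ a b → (pow2 a ℤ.- 1ℤ) ℤ.^ b) n
NoFullCol-power n = trans (bi-cong (λ a b → ∑-noFullCol b a) n) (bi-swap _ n)

exp✶nearPower : ∀ n → (exp ✶ bi (λ a b → (pow2 a ℤ.- 1ℤ) ℤ.^ b)) n ≡ ψ n
exp✶nearPower n = trans (exp✶power (λ a → pow2 a ℤ.- 1ℤ) n) (bi-cong (λ a b → cong (ℤ._^ b) (minus-plus (pow2 a))) n)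

exp✶-cong : ∀ {f g : Seq} → (∀ n → f n ≡ g n) → ∀ n → (exp ✶ f) n ≡ (exp ✶ g) n
exp✶-cong e n = bi-cong (λ a b → cong (1ℤ ℤ.*_) (e b)) n

exp✶NonIso : ∀ n → (exp ✶ NonIso) n ≡ ψ n
exp✶NonIso n = trans (exp✶-cong NonIso-power n) (exp✶nearPower n)

exp✶NoFullCol : ∀ n → (exp ✶ NoFullCol) n ≡ ψ n
exp✶NoFullCol n = trans (exp✶-cong NoFullCol-power n) (exp✶nearPower n)

exp✶NoFullRow : ∀ n → (exp ✶ NoFullRow) n ≡ ψ n
exp✶NoFullRow n = trans (exp✶-cong NoFullRow-power n) (exp✶nearPower n)

-- The factor e^x puts the deleted full rows back.
exp✶NoFull : ∀ n → (exp ✶ NoFull) n ≡ NoFullCol n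
exp✶NoFull n = trans (exp✶bi _ n) (trans (bi-cong ∑-noFull n) (sym (bi-cong (λ a b → ∑-noFullCol b a) n)))

NonIso-noFullRow-power : ∀ n → NonIso-noFullRow n ≡ bi (λ a b → properCount a ℤ.^ b) n
NonIso-noFullRow-power = bi-cong (λ a b → trans (∑-cong (mats b a) (λ M → cong ⟦_⟧ (every-∧ M)))
    (trans (∑-every (rows a) proper b) (cong (ℤ._^ b) (∑-proper a))))
  where
  every-∧ : ∀ {b a} (M : Mat b a) → nonIso M ∧ noFullRow M ≡ every proper M
  every-∧ [] = refl
  every-∧ (r ∷ M) rewrite sym (every-∧ M) with some id r | every id r | nonIso M
  ... | true  | true  | t = Boolₚ.∧-zeroʳ t
  ... | true  | false | t = refl
  ... | false | true  | t = refl
  ... | false | false | t = refl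

-- Two factors e^x raise the base 2^a - 2 to 2^a. For a = 0 the base is 0 and becomes 2 instead of
-- 1; the surplus 2^b - 1 has generating function e^2x - e^x.
exp✶exp✶NonIso-noFullRow : ∀ n → (exp ✶ (exp ✶ NonIso-noFullRow)) n ≡ (ψ ⊞ (exp ✶ exp ⊞ ⊟ exp)) n
exp✶exp✶NonIso-noFullRow n = begin
  (exp ✶ (exp ✶ NonIso-noFullRow)) n
    ≡⟨ exp✶-cong (λ m → trans (exp✶-cong NonIso-noFullRow-power m) (exp✶power properCount m)) n ⟩
  (exp ✶ bi (λ a b → (properCount a ℤ.+ 1ℤ) ℤ.^ b)) n
    ≡⟨ exp✶power (λ a → properCount a ℤ.+ 1ℤ) n ⟩
  bi (λ a b → (properCount a ℤ.+ 1ℤ ℤ.+ 1ℤ) ℤ.^ b) n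
    ≡⟨ bi-cong correct n ⟩
  bi (λ a b → pow2 a ℤ.^ b ℤ.+ cst 1ℤ a ℤ.* (exp ✶ exp ⊞ ⊟ exp) b) n
    ≡⟨ bi-+ (λ a b → pow2 a ℤ.^ b) (λ a b → cst 1ℤ a ℤ.* (exp ✶ exp ⊞ ⊟ exp) b) n ⟩
  ψ n ℤ.+ (cst 1ℤ ✶ (exp ✶ exp ⊞ ⊟ exp)) n
    ≡⟨ +-congˡ (ψ n) (✶-identityˡ (exp ✶ exp ⊞ ⊟ exp) n) ⟩
  (ψ ⊞ (exp ✶ exp ⊞ ⊟ exp)) n ∎
  where
  open ≡-Reasoning
  cancel₁ : ∀ x → x ≡ 1ℤ ℤ.+ 1ℤ ℤ.* (x ℤ.+ -1ℤ)
  cancel₁ = solve-∀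
  cancel₂ : ∀ x → x ℤ.- + 2 ℤ.+ 1ℤ ℤ.+ 1ℤ ≡ x
  cancel₂ = solve-∀
  correct : ∀ a b → (properCount a ℤ.+ 1ℤ ℤ.+ 1ℤ) ℤ.^ b ≡ pow2 a ℤ.^ b ℤ.+ cst 1ℤ a ℤ.* (exp ✶ exp ⊞ ⊟ exp) b
  correct zero b = begin
    pow2 b                                          ≡⟨ cancel₁ (pow2 b) ⟩
    1ℤ ℤ.+ 1ℤ ℤ.* (pow2 b ℤ.+ -1ℤ)                  ≡⟨ cong₂ (λ x y → x ℤ.+ 1ℤ ℤ.* (y ℤ.+ -1ℤ)) (sym (ℤₚ.^-zeroˡ b)) (sym (exp✶exp b)) ⟩
    1ℤ ℤ.^ b ℤ.+ 1ℤ ℤ.* ((exp ✶ exp) b ℤ.+ -1ℤ)         ∎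
  correct (suc a) b = trans (cong (ℤ._^ b) (cancel₂ (pow2 (suc a)))) (sym (ℤₚ.+-identityʳ _))

total : (∀ {b a} → Mat b a → ℤ) → Seq
total F = bi (λ a b → ∑ (mats b a) F)

total-cong : ∀ {F G : ∀ {b a} → Mat b a → ℤ} → (∀ {b a} (M : Mat b a) → F M ≡ G M) →
  ∀ n → total F n ≡ total G n
total-cong e = bi-cong (λ a b → ∑-cong (mats b a) e)

total-+ : ∀ (F G : ∀ {b a} → Mat b a → ℤ) n →
  total (λ M → F M ℤ.+ G M) n ≡ total F n ℤ.+ total G n
total-+ F G n = trans (bi-cong (λ a b → ∑-+ (mats b a) F G) n)
  (bi-+ (λ a b → ∑ (mats b a) F) (λ a b → ∑ (mats b a) G) n)

total-neg : ∀ (F : ∀ {b a} → Mat b a → ℤ) n → total (λ M → ℤ.- F M) n ≡ ℤ.- total F n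
total-neg F n = trans (bi-cong (λ a b → ∑-neg (mats b a) F) n) (bi-neg (λ a b → ∑ (mats b a) F) n)

total-1 : ∀ n → total (λ _ → 1ℤ) n ≡ ψ n
total-1 = bi-cong (λ a b → trans (∑-cong (mats b a) (λ M → cong ⟦_⟧ (sym (every-true M))))
    (trans (∑-every (rows a) (λ _ → true) b) (cong (ℤ._^ b) (∑-rows-1 a))))
  where
  every-true : ∀ {b a} (M : Mat b a) → every (λ _ → true) M ≡ true
  every-true []      = refl
  every-true (r ∷ M) = every-true M

total-δ₀₀ : ∀ n → total (λ {b} {a} _ → δ₀₀ a b) n ≡ cst 1ℤ n
total-δ₀₀ n = trans (bi-cong point n) (✶-identityˡ (cst 1ℤ) n)
  where
  point : ∀ a b → ∑ (mats b a) (λ _ → δ₀₀ a b) ≡ δ₀₀ a b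
  point zero    zero    = refl
  point (suc a) b       = ∑-0 (mats b (suc a))
  point zero    (suc b) = ∑-0 (mats (suc b) zero)

NonIso-col-formula : ∀ n → NonIso-col n ≡ (ψ ⊞ ⊟ NoFullCol ⊞ cst 1ℤ) n
NonIso-col-formula n = begin
  NonIso-col n
    ≡⟨ total-cong indicator-p n ⟩
  total (λ {b} {a} M → 1ℤ ℤ.- ⟦ noFullCol M ⟧ ℤ.+ δ₀₀ a b) n
    ≡⟨ total-+ (λ M → 1ℤ ℤ.- ⟦ noFullCol M ⟧) (λ {b} {a} _ → δ₀₀ a b) n ⟩
  total (λ M → 1ℤ ℤ.- ⟦ noFullCol M ⟧) n ℤ.+ total (λ {b} {a} _ → δ₀₀ a b) n
    ≡⟨ cong₂ ℤ._+_ (trans (total-+ (λ _ → 1ℤ) (λ M → ℤ.- ⟦ noFullCol M ⟧) n)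
         (cong₂ ℤ._+_ (total-1 n) (total-neg (λ M → ⟦ noFullCol M ⟧) n))) (total-δ₀₀ n) ⟩
  (ψ ⊞ ⊟ NoFullCol ⊞ cst 1ℤ) n ∎
  where open ≡-Reasoning

NonIso-row-formula : ∀ n → NonIso-row n ≡ (NonIso ⊞ ⊟ NonIso-noFullRow ⊞ cst 1ℤ) n
NonIso-row-formula n = begin
  NonIso-row n
    ≡⟨ total-cong indicator-u n ⟩
  total (λ {b} {a} M → ⟦ nonIso M ⟧ ℤ.- ⟦ nonIso M ∧ noFullRow M ⟧ ℤ.+ δ₀₀ a b) n
    ≡⟨ total-+ (λ M → ⟦ nonIso M ⟧ ℤ.- ⟦ nonIso M ∧ noFullRow M ⟧) (λ {b} {a} _ → δ₀₀ a b) n ⟩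
  total (λ M → ⟦ nonIso M ⟧ ℤ.- ⟦ nonIso M ∧ noFullRow M ⟧) n ℤ.+ total (λ {b} {a} _ → δ₀₀ a b) n
    ≡⟨ cong₂ ℤ._+_ (trans (total-+ (λ M → ⟦ nonIso M ⟧) (λ M → ℤ.- ⟦ nonIso M ∧ noFullRow M ⟧) n)
         (+-congˡ (NonIso n) (total-neg (λ M → ⟦ nonIso M ∧ noFullRow M ⟧) n))) (total-δ₀₀ n) ⟩
  (NonIso ⊞ ⊟ NonIso-noFullRow ⊞ cst 1ℤ) n ∎
  where open ≡-Reasoning

NonIso-both-formula : ∀ n → NonIso-both n ≡ (ψ ⊞ ⊟ NoFullCol ⊞ ⊟ NoFullRow ⊞ NoFull ⊞ cst 1ℤ) n
NonIso-both-formula n = begin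
  NonIso-both n
    ≡⟨ total-cong indicator-pu n ⟩
  total (λ {b} {a} M → f M ℤ.- g M ℤ.- h M ℤ.+ i M ℤ.+ δ₀₀ a b) n
    ≡⟨ total-+ (λ M → f M ℤ.- g M ℤ.- h M ℤ.+ i M) (λ {b} {a} _ → δ₀₀ a b) n ⟩
  total (λ M → f M ℤ.- g M ℤ.- h M ℤ.+ i M) n ℤ.+ total (λ {b} {a} _ → δ₀₀ a b) n
    ≡⟨ cong₂ ℤ._+_ (trans (total-+ (λ M → f M ℤ.- g M ℤ.- h M) i n)
        (cong (ℤ._+ NoFull n) (trans (total-+ (λ M → f M ℤ.- g M) (λ M → ℤ.- h M) n)
          (cong₂ ℤ._+_ (trans (total-+ f (λ M → ℤ.- g M) n) (cong₂ ℤ._+_ (total-1 n) (total-neg g n)))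
            (total-neg h n))))) (total-δ₀₀ n) ⟩
  (ψ ⊞ ⊟ NoFullCol ⊞ ⊟ NoFullRow ⊞ NoFull ⊞ cst 1ℤ) n ∎
  where
  open ≡-Reasoning
  f g h i : ∀ {b a} → Mat b a → ℤ
  f _ = 1ℤ
  g M = ⟦ noFullCol M ⟧
  h M = ⟦ noFullRow M ⟧
  i M = ⟦ noFullRow M ∧ noFullCol M ⟧

-- Solving the transfer equations

module _ (k : ℕ) where
  open AlmostCommutativeRing (truncatedRing k)
    using (_≈_; _+_; _*_; -_; 0#; *-cong; +-cong; *-identityˡ; +-identityʳ; zeroʳ)
    renaming (refl to ≈-refl; trans to ≈-trans; setoid to ≈-setoid)
  open RingSolver ℤ.+-*-rawRing (truncatedRing k) (cst-hom k) (cst-≟ k)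
    using (solve; _:=_; _:+_; _:*_; :-_; con)
  open import Relation.Binary.Reasoning.Setoid ≈-setoid

  denominator numerator : Seq → Seq → Seq
  denominator E Y = E * (cst (+ 2) * E + cst 1ℤ) + (E * E + - (cst (+ 2) * E) + - cst 1ℤ) * Y
  numerator E Y = E * E * (cst (+ 2) * E + - cst (+ 3)) + E * (E + - cst (+ 2)) * (E + - cst (+ 2)) * Y

  scale : ∀ x {y z} → y ≈ z → x * y ≈ x * z
  scale x = *-cong {x = x} (≈-refl {x = x})

  shift : ∀ x {y z} → y ≈ z → x + y ≈ x + z
  shift x = +-cong {x = x} (≈-refl {x = x})

  -- Cramer's rule for the unknowns V₀ and V₀ - V₁.
  eliminate : ∀ E E⁻¹ Y V₀ V₁ → E * E⁻¹ ≈ cst 1ℤ →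
    E * V₀ + (E + (E + - cst 1ℤ) * Y) * (V₀ + - V₁) + - (E * E + Y * V₀) ≈ 0# →
    E * E * (V₀ + - V₁) + (E * E + (E + - cst 1ℤ) * (E + - cst 1ℤ) * Y) * (V₀ + - V₁)
      + - (E * E + (E + (E + - cst 1ℤ) * Y) * V₀) ≈ 0# →
    V₁ * denominator E Y ≈ numerator E Y
  eliminate E F Y V₀ V₁ inv e₁ e₂ = begin
    V₁ * denominator E Y
      ≈⟨ lem (V₁ * denominator E Y) ⟩
    F * (E * (V₁ * denominator E Y))
      ≈⟨ scale F combo ⟩
    F * (E * numerator E Y)
      ≈⟨ lem (numerator E Y) ⟨
    numerator E Y ∎
    where
    lem : ∀ x → x ≈ F * (E * x)
    lem x = begin
      x             ≈⟨ *-identityˡ x ⟨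
      cst 1ℤ * x    ≈⟨ *-cong {x = E * F} {u = x} inv ≈-refl ⟨
      E * F * x     ≈⟨ solve 3 (λ e f y → e :* f :* y := f :* (e :* y)) ≈-refl E F x ⟩
      F * (E * x)   ∎
    B₀ C₀ P₁ P₂ : Seq
    B₀ = E + (E + - cst 1ℤ) * Y
    C₀ = cst (+ 2) * (E * E) + (E + - cst 1ℤ) * (E + - cst 1ℤ) * Y
    P₁ = E * V₀ + (E + (E + - cst 1ℤ) * Y) * (V₀ + - V₁) + - (E * E + Y * V₀)
    P₂ = E * E * (V₀ + - V₁) + (E * E + (E + - cst 1ℤ) * (E + - cst 1ℤ) * Y) * (V₀ + - V₁)
      + - (E * E + (E + (E + - cst 1ℤ) * Y) * V₀)
    combo : E * (V₁ * denominator E Y) ≈ E * numerator E Y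
    combo = begin
      E * (V₁ * denominator E Y)
        -- With W = V₀ - V₁ the hypotheses are (E - Y) V₀ + B₀ W = E² and C₀ W - B₀ V₀ = E². The
        -- multipliers of `p₁` and `p₂` come from subtracting Cramer's formula for W from that for
        -- V₀. The determinant (E - Y) C₀ + B₀² is E times the denominator, hence the extra factor
        -- `e`, which `lem` removes.
        ≈⟨ solve 4 (λ e y v w →
             let one = con 1ℤ ; two = con (+ 2)
                 b = e :+ (e :+ :- one) :* y
                 c = two :* (e :* e) :+ (e :+ :- one) :* (e :+ :- one) :* y
                 den = e :* (two :* e :+ one) :+ (e :* e :+ :- (two :* e) :+ :- one) :* y
                 num = e :* e :* (two :* e :+ :- con (+ 3)) :+ e :* (e :+ :- two) :* (e :+ :- two) :* y
                 p₁ = e :* v :+ b :* (v :+ :- w) :+ :- (e :* e :+ y :* v)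
                 p₂ = e :* e :* (v :+ :- w) :+ (e :* e :+ (e :+ :- one) :* (e :+ :- one) :* y) :* (v :+ :- w)
                        :+ :- (e :* e :+ b :* v)
             in e :* (w :* den) := e :* num :+ (c :+ :- b) :* p₁ :+ :- (e :+ :- y :+ b) :* p₂)
             ≈-refl E Y V₀ V₁ ⟩
      E * numerator E Y + (C₀ + - B₀) * P₁ + - (E + - Y + B₀) * P₂
        ≈⟨ +-cong (shift (E * numerator E Y) (scale (C₀ + - B₀) e₁)) (scale (- (E + - Y + B₀)) e₂) ⟩
      E * numerator E Y + (C₀ + - B₀) * 0# + - (E + - Y + B₀) * 0#
        ≈⟨ +-cong (shift (E * numerator E Y) (zeroʳ (C₀ + - B₀))) (zeroʳ (- (E + - Y + B₀))) ⟩
      E * numerator E Y + 0# + 0#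
        ≈⟨ ≈-trans (+-identityʳ (E * numerator E Y + 0#)) (+-identityʳ (E * numerator E Y)) ⟩
      E * numerator E Y ∎

  difference : ∀ {x y} → x ≈ y → x + - y ≈ 0#
  difference {x} {y} e n p = trans (cong (ℤ._+ (ℤ.- y n)) (e n p)) (ℤₚ.+-inverseʳ (y n))

  private
    infixl 6 _⊹_
    infixl 7 _·_

    _·_ : ∀ c {z} → z ≈ 0# → c * z ≈ 0#
    _·_ c {z} e = ≈-trans {i = c * z} {j = c * 0#} {k = 0#} (scale c {z} {0#} e) (zeroʳ c)

    _⊹_ : ∀ {x y} → x ≈ 0# → y ≈ 0# → x + y ≈ 0#
    _⊹_ {x} {y} e e′ n p = cong₂ ℤ._+_ (e n p) (e′ n p)

  module _ (V₀ V₁ : Seq) where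
    transfer₀ transfer₁ : Seq
    transfer₀ = exp + ((NonIso + - NonIso-col) * V₀ + NonIso-col * V₁)
    transfer₁ = exp + - cst 1ℤ + ((NonIso + - NonIso-col + - (NonIso-row + - NonIso-both)) * V₀ + (NonIso-col + - NonIso-both) * V₁)

    -- With W = V₀ - V₁ the differences of block series in the transfer weights recombine: V₀ = e^x
    -- + NonIso V₀ - NonIso-col W and W = 1 + NonIso-row V₀ - NonIso-both W. Each coefficient is
    -- then a single block series, expressible by e^x, e^-x and ψ.
    closedForm : V₀ ≈ transfer₀ → V₁ ≈ transfer₁ → V₁ * denominator exp ψ ≈ numerator exp ψ
    closedForm h₀ h₁ = eliminate exp exp⁻¹ ψ V₀ V₁ (λ n _ → exp-inverse n) e₁ e₂
      where
      W B′ : Seq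
      W = V₀ + - V₁
      B′ = exp + (exp + - cst 1ℤ) * ψ
      z₀ = difference {V₀} {transfer₀} h₀
      z₁ = difference {V₁} {transfer₁} h₁
      zX = difference {exp * NonIso} {ψ} (λ n _ → exp✶NonIso n)
      zQ = difference {exp * NoFullCol} {ψ} (λ n _ → exp✶NoFullCol n)
      zQ′ = difference {exp * NoFullRow} {ψ} (λ n _ → exp✶NoFullRow n)
      zN = difference {exp * NoFull} {NoFullCol} (λ n _ → exp✶NoFull n)
      zP = difference {exp * (exp * NonIso-noFullRow)} {ψ + (exp * exp + - exp)} (λ n _ → exp✶exp✶NonIso-noFullRow n)
      zXₚ = difference {NonIso-col} {ψ + - NoFullCol + cst 1ℤ} (λ n _ → NonIso-col-formula n)
      zU = difference {NonIso-row} {NonIso + - NonIso-noFullRow + cst 1ℤ} (λ n _ → NonIso-row-formula n)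
      zUₚ = difference {NonIso-both} {ψ + - NoFullCol + - NoFullRow + NoFull + cst 1ℤ} (λ n _ → NonIso-both-formula n)
      -- The first transfer equation times e^x; the multipliers eliminate `NonIso`, `NonIso-col` and
      -- `NoFullCol` in turn.
      e₁ : exp * V₀ + B′ * W + - (exp * exp + ψ * V₀) ≈ 0#
      e₁ = begin
        exp * V₀ + B′ * W + - (exp * exp + ψ * V₀)
          ≈⟨ solve 7 (λ e y x xp q v w →
               let one = con 1ℤ ; b = e :+ (e :+ :- one) :* y ; d = v :+ :- w in
               e :* v :+ b :* d :+ :- (e :* e :+ y :* v) :=
               e :* (v :+ :- (e :+ ((x :+ :- xp) :* v :+ xp :* w)))
                 :+ v :* (e :* x :+ :- y)
                 :+ (:- (d :* e)) :* (xp :+ :- (y :+ :- q :+ one))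
                 :+ d :* (e :* q :+ :- y))
               ≈-refl exp ψ NonIso NonIso-col NoFullCol V₀ V₁ ⟩
        exp * (V₀ + - transfer₀) + V₀ * (exp * NonIso + - ψ) + - (W * exp) * (NonIso-col + - (ψ + - NoFullCol + cst 1ℤ))
          + W * (exp * NoFullCol + - ψ)
          ≈⟨ exp · z₀ ⊹ V₀ · zX ⊹ (- (W * exp)) · zXₚ ⊹ W · zQ ⟩
        0# ∎
      -- The difference of the two transfer equations times e^2x. Two factors are needed because
      -- `NoFull` and `NonIso-noFullRow` involve e^-2x.
      e₂ : exp * exp * W + (exp * exp + (exp + - cst 1ℤ) * (exp + - cst 1ℤ) * ψ) * W + - (exp * exp + B′ * V₀) ≈ 0#
      e₂ = begin
        exp * exp * W + (exp * exp + (exp + - cst 1ℤ) * (exp + - cst 1ℤ) * ψ) * W + - (exp * exp + B′ * V₀)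
          ≈⟨ solve 12 (λ e y x xp u up n p q q′ v w →
               let one = con 1ℤ ; b = e :+ (e :+ :- one) :* y ; d = v :+ :- w in
               e :* e :* d :+ (e :* e :+ (e :+ :- one) :* (e :+ :- one) :* y) :* d :+ :- (e :* e :+ b :* v) :=
               e :* e :* (v :+ :- (e :+ ((x :+ :- xp) :* v :+ xp :* w)))
                 :+ (:- (e :* e)) :* (w :+ :- (e :+ :- one :+ ((x :+ :- xp :+ :- (u :+ :- up)) :* v :+ (xp :+ :- up) :* w)))
                 :+ (v :* e :* e) :* (u :+ :- (x :+ :- p :+ one))
                 :+ (v :* e) :* (e :* x :+ :- y)
                 :+ (:- v) :* (e :* (e :* p) :+ :- (y :+ (e :* e :+ :- e)))
                 :+ (:- (d :* e :* e)) :* (up :+ :- (y :+ :- q :+ :- q′ :+ n :+ one))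
                 :+ (d :* e :+ :- d) :* (e :* q :+ :- y)
                 :+ (d :* e) :* (e :* q′ :+ :- y)
                 :+ (:- (d :* e)) :* (e :* n :+ :- q))
               ≈-refl exp ψ NonIso NonIso-col NonIso-row NonIso-both NoFull NonIso-noFullRow NoFullCol NoFullRow V₀ V₁ ⟩
        exp * exp * (V₀ + - transfer₀) + - (exp * exp) * (V₁ + - transfer₁)
          + V₀ * exp * exp * (NonIso-row + - (NonIso + - NonIso-noFullRow + cst 1ℤ)) + V₀ * exp * (exp * NonIso + - ψ)
          + - V₀ * (exp * (exp * NonIso-noFullRow) + - (ψ + (exp * exp + - exp)))
          + - (W * exp * exp) * (NonIso-both + - (ψ + - NoFullCol + - NoFullRow + NoFull + cst 1ℤ))
          + (W * exp + - W) * (exp * NoFullCol + - ψ) + W * exp * (exp * NoFullRow + - ψ) + - (W * exp) * (exp * NoFull + - NoFullCol)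
          ≈⟨ (exp * exp) · z₀ ⊹ (- (exp * exp)) · z₁ ⊹ (V₀ * exp * exp) · zU ⊹ (V₀ * exp) · zX ⊹ (- V₀) · zP
              ⊹ (- (W * exp * exp)) · zUₚ ⊹ (W * exp + - W) · zQ ⊹ (W * exp) · zQ′ ⊹ (- (W * exp)) · zN ⟩
        0# ∎

-- Sequences of blocks

count : Vec Bool n → ℕ
count []          = 0
count (true ∷ μ)  = suc (count μ)
count (false ∷ μ) = count μ

keep : (μ : Vec Bool n) → Vec A n → Vec A (count μ)
keep []          []      = []
keep (true ∷ μ)  (x ∷ v) = x ∷ keep μ v
keep (false ∷ μ) (x ∷ v) = keep μ v

sub : (μ : Vec Bool m) (ν : Vec Bool n) → Mat m n → Mat (count μ) (count ν)
sub []          ν []      = []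
sub (true ∷ μ)  ν (r ∷ M) = keep ν r ∷ sub μ ν M
sub (false ∷ μ) ν (r ∷ M) = sub μ ν M

off : Vec Bool n → Vec Bool n → Bool
off []          []      = true
off (true ∷ ν)  (x ∷ r) = off ν r
off (false ∷ ν) (x ∷ r) = not x ∧ off ν r

∑-off : ∀ (ν : Vec Bool n) (f : Vec Bool (count ν) → ℤ) →
  ∑ (rows n) (λ r → ⟦ off ν r ⟧ ℤ.* f (keep ν r)) ≡ ∑ (rows (count ν)) f
∑-off []          f = cong (ℤ._+ 0ℤ) (ℤₚ.*-identityˡ (f []))
∑-off {suc n} (true ∷ ν)  f = begin
  ∑ (rows (suc n)) (λ r → ⟦ off (true ∷ ν) r ⟧ ℤ.* f (keep (true ∷ ν) r))
    ≡⟨ ∑-vecs bits n _ ⟩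
  ∑ bits (λ x → ∑ (rows n) (λ r → ⟦ off ν r ⟧ ℤ.* f (x ∷ keep ν r)))
    ≡⟨ ∑-cong bits (λ x → ∑-off ν (λ r → f (x ∷ r))) ⟩
  ∑ bits (λ x → ∑ (rows (count ν)) (λ r → f (x ∷ r)))
    ≡⟨ ∑-vecs bits (count ν) f ⟨
  ∑ (rows (count (true ∷ ν))) f ∎
  where open ≡-Reasoning
∑-off {suc n} (false ∷ ν) f = begin
  ∑ (rows (suc n)) (λ r → ⟦ off (false ∷ ν) r ⟧ ℤ.* f (keep (false ∷ ν) r))
    ≡⟨ trans (∑-vecs bits n _)
         (∑-bits (λ x → ∑ (rows n) (λ r → ⟦ not x ∧ off ν r ⟧ ℤ.* f (keep ν r)))) ⟩
  ∑ (rows n) (λ r → ⟦ off ν r ⟧ ℤ.* f (keep ν r)) ℤ.+ ∑ (rows n) (λ r → 0ℤ)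
    ≡⟨ cong₂ ℤ._+_ (∑-off ν f) (∑-0 (rows n)) ⟩
  ∑ (rows (count ν)) f ℤ.+ 0ℤ
    ≡⟨ ℤₚ.+-identityʳ _ ⟩
  ∑ (rows (count ν)) f ∎
  where open ≡-Reasoning

isLower isUpper isTail : Bool ⊎ C → Bool
isLower (inj₁ b) = not b
isLower (inj₂ _) = false
isUpper (inj₁ b) = b
isUpper (inj₂ _) = false
isTail (inj₁ _) = false
isTail (inj₂ _) = true

lowers uppers tails : Vec (Bool ⊎ C) n → Vec Bool n
lowers = Vec.map isLower
uppers = Vec.map isUpper
tails  = Vec.map isTail

tailCols : (c : Vec (Bool ⊎ C) n) → Vec C (count (tails c))
tailCols []           = []
tailCols (inj₁ _ ∷ c) = tailCols c
tailCols (inj₂ y ∷ c) = y ∷ tailCols c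

rowOff : Bool ⊎ C → Vec (Bool ⊎ C) n → Vec Bool n → Bool
rowOff (inj₁ false) c = every not
rowOff (inj₁ true)  c = off (lowers c)
rowOff (inj₂ _)     c = off (tails c)

supported : Vec (Bool ⊎ C) m → Vec (Bool ⊎ C) n → Mat m n → Bool
supported []      c []      = true
supported (k ∷ r) c (v ∷ M) = rowOff k c v ∧ supported r c M

-- A supported matrix is zero outside two submatrices, uppers by lowers and tails by tails, and
-- these two can be chosen independently.
∑-supported : ∀ (r : Vec (Bool ⊎ C) m) (c : Vec (Bool ⊎ C) n)
  (F : Mat (count (uppers r)) (count (lowers c)) → Mat (count (tails r)) (count (tails c)) → ℤ) →
  ∑ (mats m n) (λ M → ⟦ supported r c M ⟧ ℤ.* F (sub (uppers r) (lowers c) M) (sub (tails r) (tails c) M))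
  ≡ ∑ (mats (count (uppers r)) (count (lowers c))) (λ H → ∑ (mats (count (tails r)) (count (tails c))) (F H))
∑-supported [] c F = cong (ℤ._+ 0ℤ) (trans (ℤₚ.*-identityˡ (F [] [])) (sym (ℤₚ.+-identityʳ (F [] []))))
∑-supported {C} {suc m} {n} (k ∷ r) c F = trans (trans (∑-vecs (rows n) m _) (∑-cong (rows n) (λ v →
    trans (∑-cong (mats m n) (λ M → trans (cong (ℤ._* Fk v M) (⟦∧⟧ (rowOff k c v) (supported r c M)))
        (ℤₚ.*-assoc ⟦ rowOff k c v ⟧ ⟦ supported r c M ⟧ (Fk v M))))
      (∑-*ˡ (mats m n) ⟦ rowOff k c v ⟧ _)))) (by k F)
  where
  open ≡-Reasoning
  Fk : Vec Bool n → Mat m n → ℤ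
  Fk v M = F (sub (uppers (k ∷ r)) (lowers c) (v ∷ M)) (sub (tails (k ∷ r)) (tails c) (v ∷ M))
  b t a s : ℕ
  b = count (uppers r)
  t = count (tails r)
  a = count (lowers c)
  s = count (tails c)
  by : ∀ k (F : Mat (count (uppers (k ∷ r))) a → Mat (count (tails (k ∷ r))) s → ℤ) → ∑ (rows n) (λ v → ⟦ rowOff k c v ⟧ ℤ.* ∑ (mats m n) (λ M → ⟦ supported r c M ⟧ ℤ.*
         F (sub (uppers (k ∷ r)) (lowers c) (v ∷ M)) (sub (tails (k ∷ r)) (tails c) (v ∷ M))))
       ≡ ∑ (mats (count (uppers (k ∷ r))) a) (λ H → ∑ (mats (count (tails (k ∷ r))) s) (F H))
  by (inj₁ false) F = begin
    _ ≡⟨ ∑-*ʳ (rows n) (λ v → ⟦ every not v ⟧) _ ⟩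
    _ ≡⟨ cong₂ ℤ._*_ (∑-empty n) (∑-supported r c F) ⟩
    _ ≡⟨ ℤₚ.*-identityˡ _ ⟩
    ∑ (mats b a) (λ H → ∑ (mats t s) (F H)) ∎
  by (inj₁ true) F = begin
    _ ≡⟨ ∑-cong (rows n) (λ v → cong (⟦ off (lowers c) v ⟧ ℤ.*_) (∑-supported r c (λ H → F (keep (lowers c) v ∷ H)))) ⟩
    _ ≡⟨ ∑-off (lowers c) (λ w → ∑ (mats b a) (λ H → ∑ (mats t s) (F (w ∷ H)))) ⟩
    _ ≡⟨ ∑-vecs (rows a) b (λ H → ∑ (mats t s) (F H)) ⟨
    ∑ (mats (suc b) a) (λ H → ∑ (mats t s) (F H)) ∎
  by (inj₂ _) F = begin
    _ ≡⟨ ∑-cong (rows n) (λ v → cong (⟦ off (tails c) v ⟧ ℤ.*_) (∑-supported r c (λ H M → F H (keep (tails c) v ∷ M)))) ⟩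
    _ ≡⟨ ∑-off (tails c) (λ w → ∑ (mats b a) (λ H → ∑ (mats t s) (λ M → F H (w ∷ M)))) ⟩
    _ ≡⟨ ∑-swap (rows s) (mats b a) (λ w H → ∑ (mats t s) (λ M → F H (w ∷ M))) ⟩
    _ ≡⟨ ∑-cong (mats b a) (λ H → ∑-vecs (rows s) t (F H)) ⟨
    ∑ (mats b a) (λ H → ∑ (mats (suc t) s) (F H)) ∎

sumCols : List C → List (Bool ⊎ C)
sumCols ys = inj₁ false ∷ inj₁ true ∷ List.map inj₂ ys

-- Colouring the labels distributes them over the lowers, the uppers and the tail, which is the
-- labelled product of species. The three groups of colours for the first label give the three terms
-- of the Leibniz rule.
∑-words : ∀ (ys : List C) (f : ℕ → ℕ → ℤ) (g : ∀ {t} → Vec C t → ℤ) n →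
  ∑ (vecs (sumCols ys) n) (λ c → f (count (lowers c)) (count (uppers c)) ℤ.* g (tailCols c))
  ≡ (bi f ✶ (λ t → ∑ (vecs ys t) g)) n
∑-words ys f g zero    = trans (ℤₚ.+-identityʳ _) (cong (f 0 0 ℤ.*_) (sym (ℤₚ.+-identityʳ (g []))))
∑-words ys f g (suc n) = begin
  _ ≡⟨ ∑-vecs (sumCols ys) n _ ⟩
  _ ≡⟨ cong₂ ℤ._+_ (∑-words ys (λ a b → f (suc a) b) g n)
        (cong₂ ℤ._+_ (∑-words ys (λ a b → f a (suc b)) g n)
          (trans (∑-map inj₂ ys _) (∑-cong ys (λ y → ∑-words ys f (λ v → g (y ∷ v)) n)))) ⟩
  S₁ ℤ.+ (S₂ ℤ.+ ∑ ys (λ y → (bi f ✶ (λ t → ∑ (vecs ys t) (λ v → g (y ∷ v)))) n))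
    ≡⟨ ℤₚ.+-assoc S₁ S₂ _ ⟨
  (S₁ ℤ.+ S₂) ℤ.+ ∑ ys (λ y → (bi f ✶ (λ t → ∑ (vecs ys t) (λ v → g (y ∷ v)))) n)
    ≡⟨ cong₂ ℤ._+_ (sym (✶-distribʳ G (bi (λ a b → f (suc a) b)) (bi (λ a b → f a (suc b))) n))
        (trans (sym (bi-∑ ys (λ y i j → bi f i ℤ.* ∑ (vecs ys j) (λ v → g (y ∷ v))) n))
          (bi-cong (λ i j → trans (∑-*ˡ ys (bi f i) _) (cong (bi f i ℤ.*_) (sym (∑-vecs ys j g)))) n)) ⟩
  (bi f ✶ G) (suc n) ∎
  where
  open ≡-Reasoning
  G : Seq
  G t = ∑ (vecs ys t) g
  S₁ S₂ : ℤ
  S₁ = (bi (λ a b → f (suc a) b) ✶ G) n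
  S₂ = (bi (λ a b → f a (suc b)) ✶ G) n

-- A vertex coloured inj₁ false (inj₁ true) in the block k from the bottom lies on
-- level k (level k + 1); the unique colour of Col 0 is the top level.
Col : ℕ → Set
Col zero    = ⊤
Col (suc R) = Bool ⊎ Col R

cols : ∀ R → List (Col R)
cols zero    = tt ∷ []
cols (suc R) = sumCols (cols R)

-- The bit p is colCond of the block below; with p = false the bottom level is exempt from the
-- condition of not being bad.
valid : ∀ R → Bool → Vec (Col R) n → Rel n → Bool
valid {n} zero p c M = every (every not) M ∧ not (p ∧ (n ≡ᵇ 0))
valid (suc R) p c M = supported c c M ∧
  (nonIso H ∧ not (p ∧ rowCond H)) ∧ valid R (colCond H) (tailCols c) (sub (tails c) (tails c) M)
  where H = sub (uppers c) (lowers c) M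

structures : ℕ → Bool → Seq
structures R p n = ∑ (vecs (cols R) n) (λ c → ∑ (mats n n) (λ M → ⟦ valid R p c M ⟧))

-- The entry of the transfer matrix from bit `p` to bit `s`; `s` is handed to the next block as its
-- `p`.
blockWeight : Bool → Bool → ℕ → ℕ → ℤ
blockWeight p s a b = ∑ (mats b a) (λ H → ⟦ (nonIso H ∧ not (p ∧ rowCond H)) ∧ (if s then colCond H else not (colCond H)) ⟧)

-- The tail depends on the bottom block only through the bit `colCond H`, so the sum splits by the
-- two values of that bit.
structures-suc : ∀ R p n → structures (suc R) p n ≡
  (bi (blockWeight p false) ✶ structures R false ⊞ bi (blockWeight p true) ✶ structures R true) n
structures-suc R p n = begin
  structures (suc R) p n
    ≡⟨ ∑-cong (vecs (cols (suc R)) n) perWord ⟩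
  ∑ (vecs (cols (suc R)) n) (λ c → w false c ℤ.+ w true c)
    ≡⟨ ∑-+ (vecs (cols (suc R)) n) (w false) (w true) ⟩
  ∑ (vecs (cols (suc R)) n) (w false) ℤ.+ ∑ (vecs (cols (suc R)) n) (w true)
    ≡⟨ cong₂ ℤ._+_ (∑-words (cols R) (blockWeight p false) (tailSum false) n)
         (∑-words (cols R) (blockWeight p true) (tailSum true) n) ⟩
  (bi (blockWeight p false) ✶ structures R false ⊞ bi (blockWeight p true) ✶ structures R true) n ∎
  where
  open ≡-Reasoning
  tailSum : Bool → ∀ {t} → Vec (Col R) t → ℤ
  tailSum s {t} c = ∑ (mats t t) (λ M → ⟦ valid R s c M ⟧)
  w : Bool → Vec (Col (suc R)) n → ℤ
  w s c = blockWeight p s (count (lowers c)) (count (uppers c)) ℤ.* tailSum s (tailCols c)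
  φ : ∀ {b a} → Mat b a → Bool
  φ H = nonIso H ∧ not (p ∧ rowCond H)
  cases : ∀ b s (F : Bool → ℤ) → ⟦ b ⟧ ℤ.* F s ≡
    ⟦ b ∧ not s ⟧ ℤ.* F false ℤ.+ ⟦ b ∧ s ⟧ ℤ.* F true
  cases true  true  F = sym (ℤₚ.+-identityˡ _)
  cases true  false F = sym (ℤₚ.+-identityʳ _)
  cases false s     F = refl
  perWord : ∀ c → ∑ (mats n n) (λ M → ⟦ valid (suc R) p c M ⟧) ≡ w false c ℤ.+ w true c
  perWord c = begin
    ∑ (mats n n) (λ M → ⟦ valid (suc R) p c M ⟧)
      ≡⟨ ∑-cong (mats n n) (λ M → trans (⟦∧⟧ (supported c c M) _)
           (cong (⟦ supported c c M ⟧ ℤ.*_) (⟦∧⟧ (φ (sub (uppers c) (lowers c) M)) _))) ⟩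
    ∑ (mats n n) (λ M → ⟦ supported c c M ⟧ ℤ.* F (sub (uppers c) (lowers c) M) (sub (tails c) (tails c) M))
      ≡⟨ ∑-supported c c F ⟩
    ∑ Hs (λ H → ∑ Ms (F H))
      ≡⟨ ∑-cong Hs (λ H → trans (∑-*ˡ Ms ⟦ φ H ⟧ _)
           (cases (φ H) (colCond H) (λ s → tailSum s (tailCols c)))) ⟩
    ∑ Hs (λ H → ⟦ φ H ∧ not (colCond H) ⟧ ℤ.* tailSum false (tailCols c) ℤ.+ ⟦ φ H ∧ colCond H ⟧ ℤ.* tailSum true (tailCols c))
      ≡⟨ ∑-+ Hs _ _ ⟩
    ∑ Hs (λ H → ⟦ φ H ∧ not (colCond H) ⟧ ℤ.* tailSum false (tailCols c)) ℤ.+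
    ∑ Hs (λ H → ⟦ φ H ∧ colCond H ⟧ ℤ.* tailSum true (tailCols c))
      ≡⟨ cong₂ ℤ._+_ (∑-*ʳ Hs _ _) (∑-*ʳ Hs _ _) ⟩
    w false c ℤ.+ w true c ∎
    where
    Hs = mats (count (uppers c)) (count (lowers c))
    Ms = mats (count (tails c)) (count (tails c))
    F : Mat (count (uppers c)) (count (lowers c)) → Mat (count (tails c)) (count (tails c)) → ℤ
    F H M = ⟦ φ H ⟧ ℤ.* ⟦ valid R (colCond H) (tailCols c) M ⟧

∑-words-⊤ : ∀ n (f : Vec ⊤ n → ℤ) → ∑ (vecs (tt ∷ []) n) f ≡ f (Vec.replicate n tt)
∑-words-⊤ zero    f = ℤₚ.+-identityʳ (f [])
∑-words-⊤ (suc n) f = trans (∑-vecs (tt ∷ []) n f) (trans (ℤₚ.+-identityʳ _) (∑-words-⊤ n (λ v → f (tt ∷ v))))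

structures-zero : ∀ p n → structures 0 p n ≡ ⟦ not (p ∧ (n ≡ᵇ 0)) ⟧
structures-zero p n = begin
  structures 0 p n
    ≡⟨ ∑-words-⊤ n _ ⟩
  ∑ (mats n n) (λ M → ⟦ every (every not) M ∧ not (p ∧ (n ≡ᵇ 0)) ⟧)
    ≡⟨ ∑-cong (mats n n) (λ M → ⟦∧⟧ (every (every not) M) _) ⟩
  ∑ (mats n n) (λ M → ⟦ every (every not) M ⟧ ℤ.* ⟦ not (p ∧ (n ≡ᵇ 0)) ⟧)
    ≡⟨ ∑-*ʳ (mats n n) _ _ ⟩
  ∑ (mats n n) (λ M → ⟦ every (every not) M ⟧) ℤ.* ⟦ not (p ∧ (n ≡ᵇ 0)) ⟧
    ≡⟨ cong (ℤ._* ⟦ not (p ∧ (n ≡ᵇ 0)) ⟧) (trans (∑-every (rows n) (every not) n)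
         (trans (cong (ℤ._^ n) (∑-empty n)) (ℤₚ.^-zeroˡ n))) ⟩
  1ℤ ℤ.* ⟦ not (p ∧ (n ≡ᵇ 0)) ⟧
    ≡⟨ ℤₚ.*-identityˡ _ ⟩
  ⟦ not (p ∧ (n ≡ᵇ 0)) ⟧ ∎
  where open ≡-Reasoning

weight : Bool → Bool → Seq
weight p s = bi (blockWeight p s)

weight-ff : ∀ n → weight false false n ≡ (NonIso ⊞ ⊟ NonIso-col) n
weight-ff n = begin
  weight false false n
    ≡⟨ total-cong (λ M → lemma (nonIso M) (colCond M)) n ⟩
  total (λ M → ⟦ nonIso M ⟧ ℤ.- ⟦ nonIso M ∧ colCond M ⟧) n
    ≡⟨ total-+ (λ M → ⟦ nonIso M ⟧) (λ M → ℤ.- ⟦ nonIso M ∧ colCond M ⟧) n ⟩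
  NonIso n ℤ.+ total (λ M → ℤ.- ⟦ nonIso M ∧ colCond M ⟧) n
    ≡⟨ +-congˡ (NonIso n) (total-neg (λ M → ⟦ nonIso M ∧ colCond M ⟧) n) ⟩
  (NonIso ⊞ ⊟ NonIso-col) n ∎
  where
  open ≡-Reasoning
  lemma : ∀ a c → ⟦ (a ∧ true) ∧ not c ⟧ ≡ ⟦ a ⟧ ℤ.- ⟦ a ∧ c ⟧
  lemma true  true  = refl
  lemma true  false = refl
  lemma false c     = refl

weight-ft : ∀ n → weight false true n ≡ NonIso-col n
weight-ft = total-cong (λ M → cong (λ b → ⟦ b ∧ colCond M ⟧) (Boolₚ.∧-identityʳ (nonIso M)))

weight-tt : ∀ n → weight true true n ≡ (NonIso-col ⊞ ⊟ NonIso-both) n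
weight-tt n = begin
  weight true true n
    ≡⟨ total-cong (λ M → lemma (nonIso M) (rowCond M) (colCond M)) n ⟩
  total (λ M → ⟦ nonIso M ∧ colCond M ⟧ ℤ.- ⟦ (nonIso M ∧ rowCond M) ∧ colCond M ⟧) n
    ≡⟨ total-+ (λ M → ⟦ nonIso M ∧ colCond M ⟧) (λ M → ℤ.- ⟦ (nonIso M ∧ rowCond M) ∧ colCond M ⟧) n ⟩
  NonIso-col n ℤ.+ total (λ M → ℤ.- ⟦ (nonIso M ∧ rowCond M) ∧ colCond M ⟧) n
    ≡⟨ +-congˡ (NonIso-col n) (total-neg (λ M → ⟦ (nonIso M ∧ rowCond M) ∧ colCond M ⟧) n) ⟩
  (NonIso-col ⊞ ⊟ NonIso-both) n ∎
  where
  open ≡-Reasoning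
  lemma : ∀ a r c → ⟦ (a ∧ not r) ∧ c ⟧ ≡ ⟦ a ∧ c ⟧ ℤ.- ⟦ (a ∧ r) ∧ c ⟧
  lemma true  true  true  = refl
  lemma true  true  false = refl
  lemma true  false true  = refl
  lemma true  false false = refl
  lemma false r     c     = refl

weight-tf : ∀ n → weight true false n ≡ (NonIso ⊞ ⊟ NonIso-col ⊞ ⊟ (NonIso-row ⊞ ⊟ NonIso-both)) n
weight-tf n = begin
  weight true false n
    ≡⟨ total-cong (λ M → lemma (nonIso M) (rowCond M) (colCond M)) n ⟩
  total (λ M → f M ℤ.- g M ℤ.- (h M ℤ.- i M)) n
    ≡⟨ total-+ (λ M → f M ℤ.- g M) (λ M → ℤ.- (h M ℤ.- i M)) n ⟩
  total (λ M → f M ℤ.- g M) n ℤ.+ total (λ M → ℤ.- (h M ℤ.- i M)) n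
    ≡⟨ cong₂ ℤ._+_
         (trans (total-+ f (λ M → ℤ.- g M) n) (+-congˡ (NonIso n) (total-neg g n)))
         (trans (total-neg (λ M → h M ℤ.- i M) n) (cong ℤ.-_
           (trans (total-+ h (λ M → ℤ.- i M) n) (+-congˡ (NonIso-row n) (total-neg i n))))) ⟩
  (NonIso ⊞ ⊟ NonIso-col ⊞ ⊟ (NonIso-row ⊞ ⊟ NonIso-both)) n ∎
  where
  open ≡-Reasoning
  f g h i : ∀ {b a} → Mat b a → ℤ
  f M = ⟦ nonIso M ⟧
  g M = ⟦ nonIso M ∧ colCond M ⟧
  h M = ⟦ nonIso M ∧ rowCond M ⟧
  i M = ⟦ (nonIso M ∧ rowCond M) ∧ colCond M ⟧
  lemma : ∀ a r c → ⟦ (a ∧ not r) ∧ not c ⟧ ≡ ⟦ a ⟧ ℤ.- ⟦ a ∧ c ⟧ ℤ.- (⟦ a ∧ r ⟧ ℤ.- ⟦ (a ∧ r) ∧ c ⟧)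
  lemma true  true  true  = refl
  lemma true  true  false = refl
  lemma true  false true  = refl
  lemma true  false false = refl
  lemma false r     c     = refl

-- Convergence of the sum over the number of levels

VanishesBelow : ℕ → Seq → Set
VanishesBelow i f = ∀ n → n ℕ.< i → f n ≡ 0ℤ

vanishes-✶ : ∀ {i j f g} → VanishesBelow i f → VanishesBelow j g → VanishesBelow (i ℕ.+ j) (f ✶ g)
vanishes-✶ {i} {j} {f} {g} of og n n< = trans (bi-cong-≡ n vanish) (bi-0 n)
  where
  vanish : ∀ a b → a ℕ.+ b ≡ n → f a ℤ.* g b ≡ 0ℤ
  vanish a b e with a ℕ.<? i
  ... | yes a<i = cong (ℤ._* g b) (of a a<i)
  ... | no  a≮i = trans (cong (f a ℤ.*_) (og b (ℕₚ.+-cancelˡ-< i b j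
      (ℕₚ.≤-<-trans (ℕₚ.+-monoˡ-≤ b (ℕₚ.≮⇒≥ a≮i)) (subst (ℕ._< i ℕ.+ j) (sym e) n<)))))
    (ℤₚ.*-zeroʳ (f a))

vanishes-⊞ : ∀ {i f g} → VanishesBelow i f → VanishesBelow i g → VanishesBelow i (f ⊞ g)
vanishes-⊞ of og n n< = cong₂ ℤ._+_ (of n n<) (og n n<)

-- The orders of the weights false-false, false-true, true-false, true-true are at least 1, 0, 2, 1.
-- Passing from bit `false` to bit `true` may be free, since the empty block sets the bit; the
-- vertex saved is owed later, so the bound for bit `true` is larger by one.
structures-vanish : ∀ R → VanishesBelow R (structures R false)
structures-vanish⁺ : ∀ R → VanishesBelow (suc R) (structures R true)

structures-vanish zero    n ()
structures-vanish (suc R) n n< = trans (structures-suc R false n)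
  (vanishes-⊞ (vanishes-✶ {1} {R} o₁ (structures-vanish R)) (vanishes-✶ {0} {suc R} {weight false true} (λ _ ()) (structures-vanish⁺ R)) n n<)
  where
  o₁ : VanishesBelow 1 (weight false false)
  o₁ zero _ = refl
  o₁ (suc _) (s≤s ())

structures-vanish⁺ zero    zero    _ = refl
structures-vanish⁺ zero    (suc n) (s≤s ())
structures-vanish⁺ (suc R) n n< = trans (structures-suc R true n)
  (vanishes-⊞ (vanishes-✶ {2} {R} o₂ (structures-vanish R)) (vanishes-✶ {1} {suc R} o₁ (structures-vanish⁺ R)) n n<)
  where
  o₁ : VanishesBelow 1 (weight true true)
  o₁ zero _ = refl
  o₁ (suc _) (s≤s ())
  -- One vertex is not enough: a lone lower vertex sets the outgoing bit, and a lone upper vertex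
  -- violates `nonIso`.
  o₂ : VanishesBelow 2 (weight true false)
  o₂ zero          _ = refl
  o₂ (suc zero)    _ = refl
  o₂ (suc (suc _)) (s≤s (s≤s ()))

sumBelow : ℕ → (ℕ → ℤ) → ℤ
sumBelow zero    f = 0ℤ
sumBelow (suc N) f = sumBelow N f ℤ.+ f N

partialSum : ℕ → Bool → Seq
partialSum N p n = sumBelow N (λ R → structures R p n)

✶-zeroʳ : ∀ f n → (f ✶ 𝟎) n ≡ 0ℤ
✶-zeroʳ f n = trans (✶-comm f 𝟎 n) (bi-0 n)

✶-distribˡ : ∀ f g h n → (f ✶ (g ⊞ h)) n ≡ (f ✶ g ⊞ f ✶ h) n
✶-distribˡ f g h n = trans (✶-comm f (g ⊞ h) n)
  (trans (✶-distribʳ f g h n) (cong₂ ℤ._+_ (✶-comm g f n) (✶-comm h f n)))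

private
  regroup : ∀ v a b c d → v ℤ.+ (a ℤ.+ b) ℤ.+ (c ℤ.+ d) ≡ v ℤ.+ ((a ℤ.+ c) ℤ.+ (b ℤ.+ d))
  regroup = solve-∀

-- The definition adds the longest structures last; here the bottom block of every structure is
-- removed instead, which yields the transfer recursion.
partialSum-suc : ∀ N p n → partialSum (suc N) p n ≡
  (structures 0 p ⊞ (weight p false ✶ partialSum N false ⊞ weight p true ✶ partialSum N true)) n
partialSum-suc zero p n = trans (ℤₚ.+-comm 0ℤ (structures 0 p n)) (+-congˡ (structures 0 p n)
  (sym (cong₂ ℤ._+_ (✶-zeroʳ (weight p false) n) (✶-zeroʳ (weight p true) n))))
partialSum-suc (suc N) p n = begin
  partialSum (suc N) p n ℤ.+ structures (suc N) p n
    ≡⟨ cong₂ ℤ._+_ (partialSum-suc N p n) (structures-suc N p n) ⟩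
  (structures 0 p ⊞ (weight p false ✶ partialSum N false ⊞ weight p true ✶ partialSum N true)) n
    ℤ.+ (weight p false ✶ structures N false ⊞ weight p true ✶ structures N true) n
    ≡⟨ regroup (structures 0 p n) ((weight p false ✶ partialSum N false) n) ((weight p true ✶ partialSum N true) n) _ _ ⟩
  structures 0 p n ℤ.+ (((weight p false ✶ partialSum N false) n ℤ.+ (weight p false ✶ structures N false) n)
    ℤ.+ ((weight p true ✶ partialSum N true) n ℤ.+ (weight p true ✶ structures N true) n))
    ≡⟨ +-congˡ (structures 0 p n) (cong₂ ℤ._+_
         (✶-distribˡ (weight p false) (partialSum N false) (structures N false) n)
         (✶-distribˡ (weight p true) (partialSum N true) (structures N true) n)) ⟨
  (structures 0 p ⊞ (weight p false ✶ partialSum (suc N) false ⊞ weight p true ✶ partialSum (suc N) true)) n ∎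
  where open ≡-Reasoning

-- This turns the recursion from `N` to `suc N` into a fixed-point equation up to degree `k`.
stable : ∀ k N p → k ℕ.< N → partialSum (suc N) p ≈[ k ] partialSum N p
stable k N p k<N n n≤k = trans (+-congˡ (partialSum N p n) (vanish p)) (ℤₚ.+-identityʳ _)
  where
  vanish : ∀ p → structures N p n ≡ 0ℤ
  vanish false = structures-vanish N n (ℕₚ.≤-<-trans n≤k k<N)
  vanish true  = structures-vanish⁺ N n (ℕₚ.<-trans (ℕₚ.≤-<-trans n≤k k<N) (ℕₚ.n<1+n N))

structures-zero-true : ∀ n → structures 0 true n ≡ (exp ⊞ ⊟ cst 1ℤ) n
structures-zero-true zero    = refl
structures-zero-true (suc n) = structures-zero true (suc n)

partialSum-closed : ∀ k N → k ℕ.< N →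
  partialSum N true ✶ denominator k exp ψ ≈[ k ] numerator k exp ψ
partialSum-closed k N k<N = closedForm k (partialSum N false) (partialSum N true) h₀ h₁
  where
  h₀ : partialSum N false ≈[ k ] transfer₀ k (partialSum N false) (partialSum N true)
  h₀ n n≤k = trans (sym (stable k N false k<N n n≤k)) (trans (partialSum-suc N false n)
    (cong₂ ℤ._+_ (structures-zero false n) (cong₂ ℤ._+_
      (✶-cong {g = partialSum N false} n (λ m _ → weight-ff m) (λ _ _ → refl))
      (✶-cong {g = partialSum N true} n (λ m _ → weight-ft m) (λ _ _ → refl)))))
  h₁ : partialSum N true ≈[ k ] transfer₁ k (partialSum N false) (partialSum N true)
  h₁ n n≤k = trans (sym (stable k N true k<N n n≤k)) (trans (partialSum-suc N true n)
    (cong₂ ℤ._+_ (structures-zero-true n) (cong₂ ℤ._+_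
      (✶-cong {g = partialSum N false} n (λ m _ → weight-tf m) (λ _ _ → refl))
      (✶-cong {g = partialSum N true} n (λ m _ → weight-tt m) (λ _ _ → refl)))))

-- Transfer to rational power series

toℚᵘ-/ : ∀ i d → toℚᵘ (i / suc d) ≃ mkℚᵘ i d
toℚᵘ-/ i d = ℚₚ.toℚᵘ-fromℚᵘ (mkℚᵘ i d)

/-+ : ∀ i j d .{{_ : ℕ.NonZero d}} → (i ℤ.+ j) / d ≡ i / d ℚ.+ j / d
/-+ i j (suc d) = ℚₚ.toℚᵘ-injective (begin
  toℚᵘ ((i ℤ.+ j) / suc d)                    ≈⟨ toℚᵘ-/ (i ℤ.+ j) d ⟩
  mkℚᵘ (i ℤ.+ j) d                            ≈⟨ *≡* (cross i j (+ suc d)) ⟩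
  mkℚᵘ i d ℚᵘ.+ mkℚᵘ j d                      ≈⟨ ℚᵘₚ.+-cong (toℚᵘ-/ i d) (toℚᵘ-/ j d) ⟨
  toℚᵘ (i / suc d) ℚᵘ.+ toℚᵘ (j / suc d)      ≈⟨ ℚₚ.toℚᵘ-homo-+ (i / suc d) (j / suc d) ⟨
  toℚᵘ (i / suc d ℚ.+ j / suc d)              ∎)
  where
  open ℚᵘₚ.≃-Reasoning
  cross : ∀ i j d → (i ℤ.+ j) ℤ.* (d ℤ.* d) ≡ (i ℤ.* d ℤ.+ j ℤ.* d) ℤ.* d
  cross = solve-∀

/-neg : ∀ i d .{{_ : ℕ.NonZero d}} → (ℤ.- i) / d ≡ ℚ.- (i / d)
/-neg i (suc d) = ℚₚ.toℚᵘ-injective (begin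
  toℚᵘ ((ℤ.- i) / suc d)         ≈⟨ toℚᵘ-/ (ℤ.- i) d ⟩
  ℚᵘ.- mkℚᵘ i d                  ≈⟨ ℚᵘₚ.-‿cong (toℚᵘ-/ i d) ⟨
  ℚᵘ.- toℚᵘ (i / suc d)          ≈⟨ ℚₚ.toℚᵘ-homo‿- (i / suc d) ⟨
  toℚᵘ (ℚ.- (i / suc d))         ∎)
  where open ℚᵘₚ.≃-Reasoning

/-* : ∀ i j d e .{{_ : ℕ.NonZero d}} .{{_ : ℕ.NonZero e}} .{{_ : ℕ.NonZero (d ℕ.* e)}} →
  (i / d) ℚ.* (j / e) ≡ (i ℤ.* j) / (d ℕ.* e)
/-* i j (suc d) (suc e) = ℚₚ.toℚᵘ-injective (begin
  toℚᵘ ((i / suc d) ℚ.* (j / suc e))          ≈⟨ ℚₚ.toℚᵘ-homo-* (i / suc d) (j / suc e) ⟩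
  toℚᵘ (i / suc d) ℚᵘ.* toℚᵘ (j / suc e)      ≈⟨ ℚᵘₚ.*-cong (toℚᵘ-/ i d) (toℚᵘ-/ j e) ⟩
  mkℚᵘ i d ℚᵘ.* mkℚᵘ j e                      ≈⟨ toℚᵘ-/ (i ℤ.* j) (e ℕ.+ d ℕ.* suc e) ⟨
  toℚᵘ ((i ℤ.* j) / (suc d ℕ.* suc e))        ∎)
  where open ℚᵘₚ.≃-Reasoning

/-cross : ∀ i j d e .{{_ : ℕ.NonZero d}} .{{_ : ℕ.NonZero e}} → i ℤ.* + e ≡ j ℤ.* + d → i / d ≡ j / e
/-cross i j (suc d) (suc e) eq = ℚₚ.toℚᵘ-injective (begin
  toℚᵘ (i / suc d)      ≈⟨ toℚᵘ-/ i d ⟩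
  mkℚᵘ i d              ≈⟨ *≡* eq ⟩
  mkℚᵘ j e              ≈⟨ toℚᵘ-/ j e ⟨
  toℚᵘ (j / suc e)      ∎)
  where open ℚᵘₚ.≃-Reasoning

/-cancel : ∀ c i d e .{{_ : ℕ.NonZero d}} .{{_ : ℕ.NonZero e}} → suc c ℕ.* d ≡ e →
  ((+ suc c) / 1) ℚ.* (i / e) ≡ i / d
/-cancel c i d@(suc _) _ refl = trans (/-* (+ suc c) i 1 (suc c ℕ.* d))
  (/-cross (+ suc c ℤ.* i) i (1 ℕ.* (suc c ℕ.* d)) d (begin
    + suc c ℤ.* i ℤ.* + d                ≡⟨ swap (+ suc c) i (+ d) ⟩
    i ℤ.* (+ suc c ℤ.* + d)              ≡⟨ cong (i ℤ.*_) (sym (ℤₚ.pos-* (suc c) d)) ⟩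
    i ℤ.* + (suc c ℕ.* d)                ≡⟨ cong (λ t → i ℤ.* + t) (sym (ℕₚ.*-identityˡ (suc c ℕ.* d))) ⟩
    i ℤ.* + (1 ℕ.* (suc c ℕ.* d))        ∎))
  where
  open ≡-Reasoning
  swap : ∀ c i d → c ℤ.* i ℤ.* d ≡ i ℤ.* (c ℤ.* d)
  swap = solve-∀

scale-injective : ∀ c {x y} → ((+ suc c) / 1) ℚ.* x ≡ ((+ suc c) / 1) ℚ.* y → x ≡ y
scale-injective c {x} {y} e = trans (sym (undo x)) (trans (cong (((+ 1) / suc c) ℚ.*_) e) (undo y))
  where
  one : ((+ 1) / suc c) ℚ.* ((+ suc c) / 1) ≡ 1ℚ
  one = trans (/-* (+ 1) (+ suc c) (suc c) 1) (/-cross (+ 1 ℤ.* + suc c) (+ 1) (suc c ℕ.* 1) 1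
    (trans (ℤₚ.*-identityʳ _) (cong (λ t → + 1 ℤ.* + t) (sym (ℕₚ.*-identityʳ (suc c))))))
  undo : ∀ x → ((+ 1) / suc c) ℚ.* (((+ suc c) / 1) ℚ.* x) ≡ x
  undo x = trans (sym (ℚₚ.*-assoc ((+ 1) / suc c) ((+ suc c) / 1) x)) (trans (cong (ℚ._* x) one) (ℚₚ.*-identityˡ x))

sumTo-cong : ∀ n {f g} → (∀ m → m ℕ.≤ n → f m ≡ g m) → sumTo n f ≡ sumTo n g
sumTo-cong zero    e = e 0 z≤n
sumTo-cong (suc n) e = cong₂ ℚ._+_ (sumTo-cong n (λ m p → e m (ℕₚ.m≤n⇒m≤1+n p))) (e (suc n) ℕₚ.≤-refl)

sumTo-shift : ∀ n f → sumTo (suc n) f ≡ f 0 ℚ.+ sumTo n (f ∘ suc)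
sumTo-shift zero    f = refl
sumTo-shift (suc n) f = trans (cong (ℚ._+ f (suc (suc n))) (sumTo-shift n f)) (ℚₚ.+-assoc (f 0) _ _)

sumTo-+ : ∀ n f g → sumTo n (λ m → f m ℚ.+ g m) ≡ sumTo n f ℚ.+ sumTo n g
sumTo-+ zero    f g = refl
sumTo-+ (suc n) f g = trans (cong (ℚ._+ (f (suc n) ℚ.+ g (suc n))) (sumTo-+ n f g))
  (interchange (record { isCommutativeSemigroup = record { isSemigroup = ℚₚ.+-isSemigroup ; comm = ℚₚ.+-comm } })
    (sumTo n f) (sumTo n g) (f (suc n)) (g (suc n)))

sumTo-*ˡ : ∀ n c f → sumTo n (λ m → c ℚ.* f m) ≡ c ℚ.* sumTo n f
sumTo-*ˡ zero    c f = refl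
sumTo-*ˡ (suc n) c f = trans (cong (ℚ._+ (c ℚ.* f (suc n))) (sumTo-*ˡ n c f)) (sym (ℚₚ.*-distribˡ-+ c _ _))

term : (ℕ → ℕ → ℤ) → ℕ → ℕ → ℚ
term φ a b = φ a b / (a ! ℕ.* b !)
  where instance _ = a !* b !≢0

ι : Seq → Series
ι f n = f n / (n !)
  where instance _ = n !≢0

term-left : ∀ φ a b → ((+ suc a) / 1) ℚ.* term φ (suc a) b ≡ term (λ a b → φ (suc a) b) a b
term-left φ a b = /-cancel a (φ (suc a) b) (a ! ℕ.* b !) (suc a ! ℕ.* b !)
  {{a !* b !≢0}} {{suc a !* b !≢0}} (sym (ℕₚ.*-assoc (suc a) (a !) (b !)))

term-right : ∀ φ a b → ((+ suc b) / 1) ℚ.* term φ a (suc b) ≡ term (λ a b → φ a (suc b)) a b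
term-right φ a b = /-cancel b (φ a (suc b)) (a ! ℕ.* b !) (a ! ℕ.* suc b !)
  {{a !* b !≢0}} {{a !* suc b !≢0}} (begin
    suc b ℕ.* (a ! ℕ.* b !)      ≡⟨ sym (ℕₚ.*-assoc (suc b) (a !) (b !)) ⟩
    suc b ℕ.* a ! ℕ.* b !        ≡⟨ cong (ℕ._* b !) (ℕₚ.*-comm (suc b) (a !)) ⟩
    a ! ℕ.* suc b ℕ.* b !        ≡⟨ ℕₚ.*-assoc (a !) (suc b) (b !) ⟩
    a ! ℕ.* suc b !              ∎)
  where open ≡-Reasoning

-- Scaling by n + 1 imitates differentiation. Writing n + 1 as m + (n + 1 - m), the first part
-- cancels a factor of one factorial and the second part a factor of the other; the two sums
-- obtained are the two summands in the recursion of `bi`.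
sumTo-term : ∀ φ n → sumTo n (λ m → term φ m (n ∸ m)) ≡ ι (bi φ) n
sumTo-term φ zero    = refl
sumTo-term φ (suc n) = scale-injective n (begin
  ((+ suc n) / 1) ℚ.* sumTo (suc n) h
    ≡⟨ sym (sumTo-*ˡ (suc n) ((+ suc n) / 1) h) ⟩
  sumTo (suc n) (λ m → ((+ suc n) / 1) ℚ.* h m)
    ≡⟨ sumTo-cong (suc n) splitScale ⟩
  sumTo (suc n) (λ m → ((+ m) / 1) ℚ.* h m ℚ.+ ((+ (suc n ∸ m)) / 1) ℚ.* h m)
    ≡⟨ sumTo-+ (suc n) _ _ ⟩
  sumTo (suc n) (λ m → ((+ m) / 1) ℚ.* h m) ℚ.+ sumTo (suc n) (λ m → ((+ (suc n ∸ m)) / 1) ℚ.* h m)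
    ≡⟨ cong₂ ℚ._+_ left right ⟩
  ι (bi (λ a b → φ (suc a) b)) n ℚ.+ ι (bi (λ a b → φ a (suc b))) n
    ≡⟨ sym (/-+ (bi (λ a b → φ (suc a) b) n) (bi (λ a b → φ a (suc b)) n) (n !) {{n !≢0}}) ⟩
  ι (λ _ → bi φ (suc n)) n
    ≡⟨ sym (/-cancel n (bi φ (suc n)) (n !) (suc n !) {{n !≢0}} {{suc n !≢0}} refl) ⟩
  ((+ suc n) / 1) ℚ.* ι (bi φ) (suc n) ∎)
  where
  open ≡-Reasoning
  h : ℕ → ℚ
  h m = term φ m (suc n ∸ m)
  splitScale : ∀ m → m ℕ.≤ suc n → ((+ suc n) / 1) ℚ.* h m ≡
    ((+ m) / 1) ℚ.* h m ℚ.+ ((+ (suc n ∸ m)) / 1) ℚ.* h m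
  splitScale m m≤ = trans (cong (λ t → (+ t / 1) ℚ.* h m) (sym (ℕₚ.m+[n∸m]≡n m≤)))
    (trans (cong (ℚ._* h m) (/-+ (+ m) (+ (suc n ∸ m)) 1)) (ℚₚ.*-distribʳ-+ (h m) ((+ m) / 1) ((+ (suc n ∸ m)) / 1)))
  left : sumTo (suc n) (λ m → ((+ m) / 1) ℚ.* h m) ≡ ι (bi (λ a b → φ (suc a) b)) n
  left = begin
    sumTo (suc n) (λ m → ((+ m) / 1) ℚ.* h m)
      ≡⟨ sumTo-shift n _ ⟩
    0ℚ ℚ.* h 0 ℚ.+ sumTo n (λ m → ((+ suc m) / 1) ℚ.* term φ (suc m) (n ∸ m))
      ≡⟨ cong₂ ℚ._+_ (ℚₚ.*-zeroˡ (h 0)) (sumTo-cong n (λ m _ → term-left φ m (n ∸ m))) ⟩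
    0ℚ ℚ.+ sumTo n (λ m → term (λ a b → φ (suc a) b) m (n ∸ m))
      ≡⟨ ℚₚ.+-identityˡ _ ⟩
    sumTo n (λ m → term (λ a b → φ (suc a) b) m (n ∸ m))
      ≡⟨ sumTo-term (λ a b → φ (suc a) b) n ⟩
    ι (bi (λ a b → φ (suc a) b)) n ∎
  right : sumTo (suc n) (λ m → ((+ (suc n ∸ m)) / 1) ℚ.* h m) ≡ ι (bi (λ a b → φ a (suc b))) n
  right = begin
    sumTo n (λ m → ((+ (suc n ∸ m)) / 1) ℚ.* h m) ℚ.+ ((+ (n ∸ n)) / 1) ℚ.* h (suc n)
      ≡⟨ cong₂ ℚ._+_ (sumTo-cong n step) (trans (cong (λ t → ((+ t) / 1) ℚ.* h (suc n)) (ℕₚ.n∸n≡0 n)) (ℚₚ.*-zeroˡ (h (suc n)))) ⟩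
    sumTo n (λ m → term (λ a b → φ a (suc b)) m (n ∸ m)) ℚ.+ 0ℚ
      ≡⟨ ℚₚ.+-identityʳ _ ⟩
    sumTo n (λ m → term (λ a b → φ a (suc b)) m (n ∸ m))
      ≡⟨ sumTo-term (λ a b → φ a (suc b)) n ⟩
    ι (bi (λ a b → φ a (suc b))) n ∎
    where
    step : ∀ m → m ℕ.≤ n → ((+ (suc n ∸ m)) / 1) ℚ.* h m ≡ term (λ a b → φ a (suc b)) m (n ∸ m)
    step m m≤n rewrite ℕₚ.+-∸-assoc 1 m≤n = term-right φ m (n ∸ m)

ι-⊗ : ∀ f g n → (ι f ⊗ ι g) n ≡ ι (f ✶ g) n
ι-⊗ f g n = trans (sumTo-cong n (λ m _ → /-* (f m) (g (n ∸ m)) (m !) ((n ∸ m) !)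
  {{m !≢0}} {{(n ∸ m) !≢0}} {{m !* (n ∸ m) !≢0}})) (sumTo-term (λ a b → f a ℤ.* g b) n)

ι-⊕ : ∀ f g n → (ι f ⊕ ι g) n ≡ ι (f ⊞ g) n
ι-⊕ f g n = sym (/-+ (f n) (g n) (n !) {{n !≢0}})

ι-⊖ : ∀ f g n → (ι f ⊖ ι g) n ≡ ι (f ⊞ ⊟ g) n
ι-⊖ f g n = trans (cong (ι f n ℚ.+_) (sym (/-neg (g n) (n !) {{n !≢0}}))) (ι-⊕ f (⊟ g) n)

infix 4 _≈ι_
record _≈ι_ (F : Series) (f : Seq) : Set where
  constructor pointwise
  field at : ∀ n → F n ≡ ι f n

open _≈ι_

⊗-ι : ∀ {F f G g} → F ≈ι f → G ≈ι g → F ⊗ G ≈ι f ✶ g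
⊗-ι {f = f} {g = g} p q .at n =
  trans (sumTo-cong n (λ m _ → cong₂ ℚ._*_ (p .at m) (q .at (n ∸ m)))) (ι-⊗ f g n)

⊕-ι : ∀ {F f G g} → F ≈ι f → G ≈ι g → F ⊕ G ≈ι f ⊞ g
⊕-ι {f = f} {g = g} p q .at n = trans (cong₂ ℚ._+_ (p .at n) (q .at n)) (ι-⊕ f g n)

⊖-ι : ∀ {F f G g} → F ≈ι f → G ≈ι g → F ⊖ G ≈ι f ⊞ ⊟ g
⊖-ι {f = f} {g = g} p q .at n = trans (cong₂ ℚ._-_ (p .at n) (q .at n)) (ι-⊖ f g n)

const-ι : ∀ c → const (c / 1) ≈ι cst c
const-ι c .at zero    = refl
const-ι c .at (suc n) = sym (ℚₚ.0/n≡0 (suc n !) {{suc n !≢0}})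

ι-cong : ∀ {f g : Seq} n → f n ≡ g n → ι f n ≡ ι g n
ι-cong n e = cong (λ t → (t / (n !)) {{n !≢0}}) e

pos-^ : ∀ a b → + (a ℕ.^ b) ≡ (+ a) ℤ.^ b
pos-^ a zero    = refl
pos-^ a (suc b) = trans (ℤₚ.pos-* a (a ℕ.^ b)) (cong (+ a ℤ.*_) (pos-^ a b))

exp₁-ι : expS 1 ≈ι exp
exp₁-ι .at n = ι-cong {λ m → + (1 ℕ.^ m)} {exp} n (cong +_ (ℕₚ.^-zeroˡ n))

exp₂-ι : expS 2 ≈ι exp ✶ exp
exp₂-ι .at n = ι-cong {λ m → + (2 ℕ.^ m)} {exp ✶ exp} n (trans (pos-^ 2 n) (sym (exp✶exp n)))

Ψ-ι : Ψ ≈ι ψ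
Ψ-ι .at N = trans (sumTo-cong N (λ m _ → cong (λ t → (t / (m ! ℕ.* (N ∸ m) !)) {{m !* (N ∸ m) !≢0}})
    (trans (pos-^ 2 (m ℕ.* (N ∸ m))) (sym (ℤₚ.^-*-assoc (+ 2) m (N ∸ m))))))
  (sumTo-term (λ a b → pow2 a ℤ.^ b) N)

egf-ι : ∀ g → egf g ≈ι (λ n → + g n)
egf-ι g .at n = refl

-- Layered structures and posets

entry : Mat m n → Fin m → Fin n → Bool
entry M i j = lookup (lookup M i) j

true≢false : ∀ {b} → b ≡ true → b ≡ false → ⊥
true≢false refl ()

∧-elimˡ : ∀ {a b} → a ∧ b ≡ true → a ≡ true
∧-elimˡ {true} _ = refl

∧-elimʳ : ∀ {a b} → a ∧ b ≡ true → b ≡ true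
∧-elimʳ {true} e = e

∧-intro : ∀ {a b} → a ≡ true → b ≡ true → a ∧ b ≡ true
∧-intro refl refl = refl

∨-elim : ∀ {a b} → a ∨ b ≡ true → a ≡ true ⊎ b ≡ true
∨-elim {true}  _ = inj₁ refl
∨-elim {false} e = inj₂ e

∨-introˡ : ∀ {a b} → a ≡ true → a ∨ b ≡ true
∨-introˡ refl = refl

∨-introʳ : ∀ a {b} → b ≡ true → a ∨ b ≡ true
∨-introʳ a refl = Boolₚ.∨-zeroʳ a

not-elim : ∀ {a} → not a ≡ true → a ≡ true → ⊥
not-elim {true} ()
not-elim {false} _ ()

not-intro : ∀ {a} → (a ≡ true → ⊥) → not a ≡ true
not-intro {true}  f = ⊥-elim (f refl)
not-intro {false} f = refl

every⁻ : ∀ (φ : A → Bool) (v : Vec A n) → every φ v ≡ true → ∀ i → φ (lookup v i) ≡ true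
every⁻ φ (x ∷ v) e zero    = ∧-elimˡ e
every⁻ φ (x ∷ v) e (suc i) = every⁻ φ v (∧-elimʳ {φ x} e) i

every⁺ : ∀ (φ : A → Bool) (v : Vec A n) → (∀ i → φ (lookup v i) ≡ true) → every φ v ≡ true
every⁺ φ []      h = refl
every⁺ φ (x ∷ v) h = ∧-intro (h zero) (every⁺ φ v (h ∘ suc))

some⁻ : ∀ (φ : A → Bool) (v : Vec A n) → some φ v ≡ true → ∃ λ i → φ (lookup v i) ≡ true
some⁻ φ (x ∷ v) e with ∨-elim {φ x} e
... | inj₁ h = zero , h
... | inj₂ h = let i , p = some⁻ φ v h in suc i , p

some⁺ : ∀ (φ : A → Bool) (v : Vec A n) i → φ (lookup v i) ≡ true → some φ v ≡ true
some⁺ φ (x ∷ v) zero    e = ∨-introˡ e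
some⁺ φ (x ∷ v) (suc i) e = ∨-introʳ (φ x) (some⁺ φ v i e)

off⁻ : ∀ (ν r : Vec Bool n) → off ν r ≡ true → ∀ j → lookup r j ≡ true → lookup ν j ≡ true
off⁻ (true ∷ ν)  (x ∷ r)     e zero    p = refl
off⁻ (false ∷ ν) (false ∷ r) e zero    ()
off⁻ (true ∷ ν)  (x ∷ r)     e (suc j) p = off⁻ ν r e j p
off⁻ (false ∷ ν) (false ∷ r) e (suc j) p = off⁻ ν r e j p

off⁺ : ∀ (ν r : Vec Bool n) → (∀ j → lookup r j ≡ true → lookup ν j ≡ true) → off ν r ≡ true
off⁺ []          []          h = refl
off⁺ (true ∷ ν)  (x ∷ r)     h = off⁺ ν r (h ∘ suc)
off⁺ (false ∷ ν) (true ∷ r)  h with h zero refl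
... | ()
off⁺ (false ∷ ν) (false ∷ r) h = off⁺ ν r (h ∘ suc)

fullCols⁻ : ∀ (M : Mat m n) j → lookup (fullCols M) j ≡ true → ∀ i → entry M i j ≡ true
fullCols⁻ (r ∷ M) j e i with trans (sym (lookup-zipWith _∧_ j r (fullCols M))) e
fullCols⁻ (r ∷ M) j e zero    | h = ∧-elimˡ h
fullCols⁻ (r ∷ M) j e (suc i) | h = fullCols⁻ M j (∧-elimʳ {lookup r j} h) i

fullCols⁺ : ∀ (M : Mat m n) j → (∀ i → entry M i j ≡ true) → lookup (fullCols M) j ≡ true
fullCols⁺ []      j h = lookup-replicate j true
fullCols⁺ (r ∷ M) j h = trans (lookup-zipWith _∧_ j r (fullCols M)) (∧-intro (h zero) (fullCols⁺ M j (h ∘ suc)))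

emb : (μ : Vec Bool n) → Fin (count μ) → Fin n
emb (true ∷ μ)  zero    = zero
emb (true ∷ μ)  (suc i) = suc (emb μ i)
emb (false ∷ μ) i       = suc (emb μ i)

lookup-keep : ∀ (μ : Vec Bool n) (v : Vec A n) i → lookup (keep μ v) i ≡ lookup v (emb μ i)
lookup-keep (true ∷ μ)  (x ∷ v) zero    = refl
lookup-keep (true ∷ μ)  (x ∷ v) (suc i) = lookup-keep μ v i
lookup-keep (false ∷ μ) (x ∷ v) i       = lookup-keep μ v i

entry-sub : ∀ (μ : Vec Bool m) (ν : Vec Bool n) M i j → entry (sub μ ν M) i j ≡ entry M (emb μ i) (emb ν j)
entry-sub (true ∷ μ)  ν (r ∷ M) zero    j = lookup-keep ν r j
entry-sub (true ∷ μ)  ν (r ∷ M) (suc i) j = entry-sub μ ν M i j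
entry-sub (false ∷ μ) ν (r ∷ M) i       j = entry-sub μ ν M i j

data Kind {C : Set} {n : ℕ} (c : Vec (Bool ⊎ C) n) : Fin n → Set where
  low : ∀ j → Kind c (emb (lowers c) j)
  upp : ∀ j → Kind c (emb (uppers c) j)
  rest : ∀ j → Kind c (emb (tails c) j)

kind : ∀ (c : Vec (Bool ⊎ C) n) i → Kind c i
kind (inj₁ false ∷ c) zero = low zero
kind (inj₁ true ∷ c)  zero = upp zero
kind (inj₂ y ∷ c)     zero = rest zero
kind (inj₁ false ∷ c) (suc i) with kind c i
... | low j  = low (suc j)
... | upp j  = upp j
... | rest j = rest j
kind (inj₁ true ∷ c) (suc i) with kind c i
... | low j  = low j
... | upp j  = upp (suc j)
... | rest j = rest j
kind (inj₂ y ∷ c) (suc i) with kind c i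
... | low j  = low j
... | upp j  = upp j
... | rest j = rest (suc j)

lookup-low : ∀ (c : Vec (Bool ⊎ C) n) j → lookup c (emb (lowers c) j) ≡ inj₁ false
lookup-low (inj₁ false ∷ c) zero    = refl
lookup-low (inj₁ false ∷ c) (suc j) = lookup-low c j
lookup-low (inj₁ true ∷ c)  j       = lookup-low c j
lookup-low (inj₂ y ∷ c)     j       = lookup-low c j

lookup-upp : ∀ (c : Vec (Bool ⊎ C) n) j → lookup c (emb (uppers c) j) ≡ inj₁ true
lookup-upp (inj₁ true ∷ c)  zero    = refl
lookup-upp (inj₁ true ∷ c)  (suc j) = lookup-upp c j
lookup-upp (inj₁ false ∷ c) j       = lookup-upp c j
lookup-upp (inj₂ y ∷ c)     j       = lookup-upp c j

lookup-rest : ∀ (c : Vec (Bool ⊎ C) n) j → lookup c (emb (tails c) j) ≡ inj₂ (lookup (tailCols c) j)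
lookup-rest (inj₂ y ∷ c)     zero    = refl
lookup-rest (inj₂ y ∷ c)     (suc j) = lookup-rest c j
lookup-rest (inj₁ false ∷ c) j       = lookup-rest c j
lookup-rest (inj₁ true ∷ c)  j       = lookup-rest c j

Allowed : Bool ⊎ C → Bool ⊎ C → Set
Allowed (inj₁ true) (inj₁ false) = ⊤
Allowed (inj₂ _)    (inj₂ _)     = ⊤
Allowed _           _            = ⊥

isLower⁻ : ∀ {k : Bool ⊎ C} → isLower k ≡ true → k ≡ inj₁ false
isLower⁻ {k = inj₁ false} _ = refl

isTail⁻ : ∀ {k : Bool ⊎ C} → isTail k ≡ true → ∃ λ y → k ≡ inj₂ y
isTail⁻ {k = inj₂ y} _ = y , refl

rowOff⁻ : ∀ k (c : Vec (Bool ⊎ C) n) v → rowOff k c v ≡ true → ∀ j → lookup v j ≡ true → Allowed k (lookup c j)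
rowOff⁻ (inj₁ false) c v e j p = not-elim (every⁻ not v e j) p
rowOff⁻ (inj₁ true)  c v e j p
  rewrite isLower⁻ {k = lookup c j} (trans (sym (lookup-map j isLower c)) (off⁻ (lowers c) v e j p)) = tt
rowOff⁻ (inj₂ _)     c v e j p
  rewrite proj₂ (isTail⁻ {k = lookup c j} (trans (sym (lookup-map j isTail c)) (off⁻ (tails c) v e j p))) = tt

rowOff⁺ : ∀ k (c : Vec (Bool ⊎ C) n) v → (∀ j → lookup v j ≡ true → Allowed k (lookup c j)) → rowOff k c v ≡ true
rowOff⁺ (inj₁ false) c v h = every⁺ not v (λ j → not-intro (contra j))
  where
  contra : ∀ j → lookup v j ≡ true → ⊥
  contra j p with lookup c j | h j p
  ... | inj₁ _ | ()
  ... | inj₂ _ | ()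
rowOff⁺ (inj₁ true) c v h = off⁺ (lowers c) v (λ j p → trans (lookup-map j isLower c) (lemma (lookup c j) (h j p)))
  where
  lemma : ∀ k → Allowed (inj₁ true) k → isLower k ≡ true
  lemma (inj₁ false) _ = refl
rowOff⁺ (inj₂ y) c v h = off⁺ (tails c) v (λ j p → trans (lookup-map j isTail c) (lemma (lookup c j) (h j p)))
  where
  lemma : ∀ k → Allowed (inj₂ y) k → isTail k ≡ true
  lemma (inj₂ _) _ = refl

supported⁻ : ∀ (r : Vec (Bool ⊎ C) m) (c : Vec (Bool ⊎ C) n) M → supported r c M ≡ true →
  ∀ i j → entry M i j ≡ true → Allowed (lookup r i) (lookup c j)
supported⁻ (k ∷ r) c (v ∷ M) e zero    j p = rowOff⁻ k c v (∧-elimˡ e) j p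
supported⁻ (k ∷ r) c (v ∷ M) e (suc i) j p = supported⁻ r c M (∧-elimʳ {rowOff k c v} e) i j p

supported⁺ : ∀ (r : Vec (Bool ⊎ C) m) (c : Vec (Bool ⊎ C) n) M →
  (∀ i j → entry M i j ≡ true → Allowed (lookup r i) (lookup c j)) → supported r c M ≡ true
supported⁺ []      c []      h = refl
supported⁺ (k ∷ r) c (v ∷ M) h = ∧-intro (rowOff⁺ k c v (h zero)) (supported⁺ r c M (h ∘ suc))

level : ∀ {R} → Col R → ℕ
level {zero}  _            = 0
level {suc R} (inj₁ false) = 0
level {suc R} (inj₁ true)  = 1
level {suc R} (inj₂ y)     = suc (level y)

upper : ∀ {R} → Col R → Bool
upper {zero}  _        = false
upper {suc R} (inj₁ b) = b
upper {suc R} (inj₂ y) = upper y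

-- No block lies below level 0 that could supply an upper vertex on it.
upper-level : ∀ {R} (k : Col R) → level k ≡ 0 → upper k ≡ false
upper-level {zero}  k            e = refl
upper-level {suc R} (inj₁ false) e = refl

level≤ : ∀ {R} (k : Col R) → level k ℕ.≤ R
level≤ {zero}  k            = z≤n
level≤ {suc R} (inj₁ false) = z≤n
level≤ {suc R} (inj₁ true)  = s≤s z≤n
level≤ {suc R} (inj₂ y)     = s≤s (level≤ y)

module _ {n : ℕ} (ℓ : Fin n → ℕ) (u : Fin n → Bool) (e : Fin n → Fin n → Bool) where

  -- e z x says that z lies one level above x but not above x in the order, and u z that z has such
  -- an x.  Level k is bad when it is missed from both sides: either it has no common neighbour of
  -- some x below and z above, or some x (z) has no neighbour on it at all, or it is empty.
  MissedBelow MissedAbove : ℕ → Set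
  MissedBelow k = (∀ z → ℓ z ≡ k → u z ≡ false) ⊎
    ∃ λ x → u x ≡ false × suc (ℓ x) ≡ k × (∀ z → ℓ z ≡ k → u z ≡ true → e z x ≡ true)
  MissedAbove k = (∀ x → ℓ x ≡ k → u x ≡ true) ⊎
    ∃ λ z → u z ≡ true × ℓ z ≡ suc k × (∀ x → ℓ x ≡ k → u x ≡ false → e z x ≡ true)

  record Layered (R : ℕ) (p : Bool) : Set where
    field
      edge    : ∀ z x → e z x ≡ true → u z ≡ true × u x ≡ false × ℓ z ≡ suc (ℓ x)
      covered : ∀ z → u z ≡ true → ∃ λ x → e z x ≡ true
      good    : ∀ k → (k ≡ 0 → p ≡ true) → k ℕ.≤ R → MissedBelow k → MissedAbove k → ⊥

LayeredBy : ∀ R → Bool → Vec (Col R) n → Rel n → Set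
LayeredBy R p c M = Layered (level ∘ lookup c) (upper ∘ lookup c) (entry M) R p

-- Removing the bottom block of a layered structure

module Step {R n : ℕ} (c : Vec (Col (suc R)) n) (M : Rel n) where
  H = sub (uppers c) (lowers c) M
  T = sub (tails c) (tails c) M
  t = tailCols c
  eL = emb (lowers c)
  eU = emb (uppers c)
  eT = emb (tails c)
  ℓ : Fin n → ℕ
  ℓ i = level (lookup c i)
  u : Fin n → Bool
  u i = upper (lookup c i)
  e = entry M
  ℓ′ : Fin (count (tails c)) → ℕ
  ℓ′ j = level (lookup t j)
  u′ : Fin (count (tails c)) → Bool
  u′ j = upper (lookup t j)

  ℓL : ∀ j → ℓ (eL j) ≡ 0
  ℓL j = cong level (lookup-low c j)
  ℓU : ∀ j → ℓ (eU j) ≡ 1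
  ℓU j = cong level (lookup-upp c j)
  ℓT : ∀ j → ℓ (eT j) ≡ suc (ℓ′ j)
  ℓT j = cong level (lookup-rest c j)
  uL : ∀ j → u (eL j) ≡ false
  uL j = cong upper (lookup-low c j)
  uU : ∀ j → u (eU j) ≡ true
  uU j = cong upper (lookup-upp c j)
  uT : ∀ j → u (eT j) ≡ u′ j
  uT j = cong upper (lookup-rest c j)

  H-entry : ∀ i j → entry H i j ≡ e (eU i) (eL j)
  H-entry = entry-sub (uppers c) (lowers c) M
  T-entry : ∀ i j → entry T i j ≡ e (eT i) (eT j)
  T-entry = entry-sub (tails c) (tails c) M

  empty : ∀ {k} → (k ≡ᵇ 0) ≡ true → Fin k → ⊥
  empty {zero} _ ()

  empty⁺ : ∀ {k} → (Fin k → ⊥) → (k ≡ᵇ 0) ≡ true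
  empty⁺ {zero}  f = refl
  empty⁺ {suc k} f = ⊥-elim (f zero)

  -- Level 0 consists of the lowers of `H`, and the vertices of level 1 with flag `u` are its
  -- uppers, so the definition of being missed from above involves no other vertex.
  rowCond⁻ : rowCond H ≡ true → MissedAbove ℓ u e 0
  rowCond⁻ h with ∨-elim {count (lowers c) ≡ᵇ 0} h
  ... | inj₁ none = inj₁ (λ x → go x (kind c x))
    where
    go : ∀ x → Kind c x → ℓ x ≡ 0 → u x ≡ true
    go _ (low j)  p = ⊥-elim (empty none j)
    go _ (upp j)  p = uU j
    go _ (rest j) p with trans (sym (ℓT j)) p
    ... | ()
  ... | inj₂ h′ with some⁻ fullRow H h′
  ...   | i , full = inj₂ (eU i , uU i , ℓU i , λ x → go x (kind c x))
    where
    go : ∀ x → Kind c x → ℓ x ≡ 0 → u x ≡ false → e (eU i) x ≡ true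
    go _ (low j)  p q = trans (sym (H-entry i j)) (every⁻ id (lookup H i) full j)
    go _ (upp j)  p q = ⊥-elim (true≢false (uU j) q)
    go _ (rest j) p q with trans (sym (ℓT j)) p
    ... | ()

  rowCond⁺ : MissedAbove ℓ u e 0 → rowCond H ≡ true
  rowCond⁺ (inj₁ none) = ∨-introˡ (empty⁺ (λ j → true≢false (none (eL j) (ℓL j)) (uL j)))
  rowCond⁺ (inj₂ (z , uz , ℓz , all)) = ∨-introʳ (count (lowers c) ≡ᵇ 0) (go z (kind c z) uz ℓz all)
    where
    go : ∀ z → Kind c z → u z ≡ true → ℓ z ≡ 1 → (∀ x → ℓ x ≡ 0 → u x ≡ false → e z x ≡ true) → some fullRow H ≡ true
    go _ (low j)  uz ℓz all = ⊥-elim (true≢false uz (uL j))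
    go _ (upp i)  uz ℓz all = some⁺ fullRow H i (every⁺ id (lookup H i) (λ j → trans (H-entry i j) (all (eL j) (ℓL j) (uL j))))
    go _ (rest j) uz ℓz all = ⊥-elim (true≢false (trans (sym (uT j)) uz)
      (upper-level (lookup t j) (ℕₚ.suc-injective (trans (sym (ℓT j)) ℓz))))

  -- The other vertices of level 1 form level 0 of the tail, where `u` is false; only the uppers of
  -- `H` are tested.
  colCond⁻ : colCond H ≡ true → MissedBelow ℓ u e 1
  colCond⁻ h with ∨-elim {count (uppers c) ≡ᵇ 0} h
  ... | inj₁ none = inj₁ (λ z → go z (kind c z))
    where
    go : ∀ z → Kind c z → ℓ z ≡ 1 → u z ≡ false
    go _ (low j)  p = uL j
    go _ (upp j)  p = ⊥-elim (empty none j)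
    go _ (rest j) p = trans (uT j) (upper-level (lookup t j) (ℕₚ.suc-injective (trans (sym (ℓT j)) p)))
  ... | inj₂ h′ with some⁻ id (fullCols H) h′
  ...   | j , full = inj₂ (eL j , uL j , cong suc (ℓL j) , λ z → go z (kind c z))
    where
    go : ∀ z → Kind c z → ℓ z ≡ 1 → u z ≡ true → e z (eL j) ≡ true
    go _ (low i)  p q = ⊥-elim (true≢false q (uL i))
    go _ (upp i)  p q = trans (sym (H-entry i j)) (fullCols⁻ H j full i)
    go _ (rest i) p q = ⊥-elim (true≢false (trans (sym (uT i)) q)
      (upper-level (lookup t i) (ℕₚ.suc-injective (trans (sym (ℓT i)) p))))

  colCond⁺ : MissedBelow ℓ u e 1 → colCond H ≡ true
  colCond⁺ (inj₁ none) = ∨-introˡ (empty⁺ (λ j → true≢false (uU j) (none (eU j) (ℓU j))))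
  colCond⁺ (inj₂ (x , ux , ℓx , all)) = ∨-introʳ (count (uppers c) ≡ᵇ 0) (go x (kind c x) ux (ℕₚ.suc-injective ℓx) all)
    where
    go : ∀ x → Kind c x → u x ≡ false → ℓ x ≡ 0 → (∀ z → ℓ z ≡ 1 → u z ≡ true → e z x ≡ true) → some id (fullCols H) ≡ true
    go _ (low j)  ux ℓx all = some⁺ id (fullCols H) j (fullCols⁺ H j (λ i → trans (H-entry i j) (all (eU i) (ℓU i) (uU i))))
    go _ (upp j)  ux ℓx all = ⊥-elim (true≢false (uU j) ux)
    go _ (rest j) ux ℓx all with trans (sym (ℓT j)) ℓx
    ... | ()

  missedAbove-tail⁻ : ∀ {k} → MissedAbove ℓ u e (suc k) → MissedAbove ℓ′ u′ (entry T) k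
  missedAbove-tail⁻ (inj₁ all) = inj₁ (λ x p → trans (sym (uT x)) (all (eT x) (trans (ℓT x) (cong suc p))))
  missedAbove-tail⁻ {k} (inj₂ (z , uz , ℓz , all)) = go z (kind c z) uz ℓz all
    where
    go : ∀ z → Kind c z → u z ≡ true → ℓ z ≡ suc (suc k) →
      (∀ x → ℓ x ≡ suc k → u x ≡ false → e z x ≡ true) → MissedAbove ℓ′ u′ (entry T) k
    go _ (low j)  uz ℓz all = ⊥-elim (true≢false uz (uL j))
    go _ (upp j)  uz ℓz all with trans (sym (ℓU j)) ℓz
    ... | ()
    go _ (rest j) uz ℓz all = inj₂ (j , trans (sym (uT j)) uz , ℕₚ.suc-injective (trans (sym (ℓT j)) ℓz) ,
      λ x p q → trans (T-entry j x) (all (eT x) (trans (ℓT x) (cong suc p)) (trans (uT x) q)))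

  missedAbove-tail⁺ : ∀ {k} → MissedAbove ℓ′ u′ (entry T) k → MissedAbove ℓ u e (suc k)
  missedAbove-tail⁺ {k} (inj₁ all) = inj₁ (λ x → go x (kind c x))
    where
    go : ∀ x → Kind c x → ℓ x ≡ suc k → u x ≡ true
    go _ (low j)  p with trans (sym (ℓL j)) p
    ... | ()
    go _ (upp j)  p = uU j
    go _ (rest j) p = trans (uT j) (all j (ℕₚ.suc-injective (trans (sym (ℓT j)) p)))
  missedAbove-tail⁺ {k} (inj₂ (z , uz , ℓz , all)) = inj₂ (eT z , trans (uT z) uz , trans (ℓT z) (cong suc ℓz) , λ x → go x (kind c x))
    where
    go : ∀ x → Kind c x → ℓ x ≡ suc k → u x ≡ false → e (eT z) x ≡ true
    go _ (low j)  p q with trans (sym (ℓL j)) p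
    ... | ()
    go _ (upp j)  p q = ⊥-elim (true≢false (uU j) q)
    go _ (rest j) p q = trans (sym (T-entry z j))
      (all j (ℕₚ.suc-injective (trans (sym (ℓT j)) p)) (trans (sym (uT j)) q))

  -- For k = 0 information is lost: the bottom level of the tail always counts as missed from below,
  -- nothing on it being upper. The bit `colCond H` keeps what is forgotten here, and this is why
  -- the converse starts one level higher.
  missedBelow-tail⁻ : ∀ {k} → MissedBelow ℓ u e (suc k) → MissedBelow ℓ′ u′ (entry T) k
  missedBelow-tail⁻ {zero} _ = inj₁ (λ z → upper-level (lookup t z))
  missedBelow-tail⁻ {suc k} (inj₁ none) = inj₁ (λ z p → trans (sym (uT z)) (none (eT z) (trans (ℓT z) (cong suc p))))
  missedBelow-tail⁻ {suc k} (inj₂ (x , ux , ℓx , all)) = go x (kind c x) ux (ℕₚ.suc-injective ℓx) all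
    where
    go : ∀ x → Kind c x → u x ≡ false → ℓ x ≡ suc k →
      (∀ z → ℓ z ≡ suc (suc k) → u z ≡ true → e z x ≡ true) → MissedBelow ℓ′ u′ (entry T) (suc k)
    go _ (low j)  ux ℓx all with trans (sym (ℓL j)) ℓx
    ... | ()
    go _ (upp j)  ux ℓx all = ⊥-elim (true≢false (uU j) ux)
    go _ (rest j) ux ℓx all = inj₂ (j , trans (sym (uT j)) ux , trans (sym (ℓT j)) ℓx ,
      λ z p q → trans (T-entry z j) (all (eT z) (trans (ℓT z) (cong suc p)) (trans (uT z) q)))

  missedBelow-tail⁺ : ∀ {k} → MissedBelow ℓ′ u′ (entry T) (suc k) → MissedBelow ℓ u e (suc (suc k))
  missedBelow-tail⁺ {k} (inj₁ none) = inj₁ (λ z → go z (kind c z))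
    where
    go : ∀ z → Kind c z → ℓ z ≡ suc (suc k) → u z ≡ false
    go _ (low j)  p = uL j
    go _ (upp j)  p with trans (sym (ℓU j)) p
    ... | ()
    go _ (rest j) p = trans (uT j) (none j (ℕₚ.suc-injective (trans (sym (ℓT j)) p)))
  missedBelow-tail⁺ {k} (inj₂ (x , ux , ℓx , all)) = inj₂ (eT x , trans (uT x) ux , cong suc (trans (ℓT x) ℓx) , λ z → go z (kind c z))
    where
    go : ∀ z → Kind c z → ℓ z ≡ suc (suc k) → u z ≡ true → e z (eT x) ≡ true
    go _ (low j)  p q = ⊥-elim (true≢false q (uL j))
    go _ (upp j)  p q with trans (sym (ℓU j)) p
    ... | ()
    go _ (rest j) p q = trans (sym (T-entry j x))
      (all j (ℕₚ.suc-injective (trans (sym (ℓT j)) p)) (trans (sym (uT j)) q))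

  layered-suc⁺ : ∀ {p} → supported c c M ≡ true → nonIso H ≡ true → not (p ∧ rowCond H) ≡ true →
    LayeredBy R (colCond H) t T → LayeredBy (suc R) p c M
  layered-suc⁺ {p} sup iso ok tail = record { edge = edge ; covered = covered ; good = good }
    where
    module L = Layered tail
    edge : ∀ z x → e z x ≡ true → u z ≡ true × u x ≡ false × ℓ z ≡ suc (ℓ x)
    edge z x = go z x (kind c z) (kind c x)
      where
      go : ∀ z x → Kind c z → Kind c x → e z x ≡ true → u z ≡ true × u x ≡ false × ℓ z ≡ suc (ℓ x)
      go _ _ (upp i)  (low j)  h = uU i , uL j , trans (ℓU i) (cong suc (sym (ℓL j)))
      go _ _ (rest i) (rest j) h =
        let uz , ux , q = L.edge i j (trans (T-entry i j) h)
        in trans (uT i) uz , trans (uT j) ux , trans (ℓT i) (cong suc (trans q (sym (ℓT j))))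
      go _ _ (low i) k h with subst (λ d → Allowed d _) (lookup-low c i) (supported⁻ c c M sup _ _ h)
      ... | ()
      go _ _ (upp i)  (upp j)  h with subst₂ Allowed (lookup-upp c i) (lookup-upp c j) (supported⁻ c c M sup _ _ h)
      ... | ()
      go _ _ (upp i)  (rest j) h with subst₂ Allowed (lookup-upp c i) (lookup-rest c j) (supported⁻ c c M sup _ _ h)
      ... | ()
      go _ _ (rest i) (low j)  h with subst₂ Allowed (lookup-rest c i) (lookup-low c j) (supported⁻ c c M sup _ _ h)
      ... | ()
      go _ _ (rest i) (upp j)  h with subst₂ Allowed (lookup-rest c i) (lookup-upp c j) (supported⁻ c c M sup _ _ h)
      ... | ()
    covered : ∀ z → u z ≡ true → ∃ λ x → e z x ≡ true
    covered z = go z (kind c z)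
      where
      go : ∀ z → Kind c z → u z ≡ true → ∃ λ x → e z x ≡ true
      go _ (low i)  q = ⊥-elim (true≢false q (uL i))
      go _ (upp i)  q = let j , h = some⁻ id (lookup H i) (every⁻ (some id) H iso i) in eL j , trans (sym (H-entry i j)) h
      go _ (rest i) q = let j , h = L.covered i (trans (sym (uT i)) q) in eT j , trans (sym (T-entry i j)) h
    good : ∀ k → (k ≡ 0 → p ≡ true) → k ℕ.≤ suc R → MissedBelow ℓ u e k → MissedAbove ℓ u e k → ⊥
    good zero    p⁺ k≤ b a = not-elim ok (∧-intro (p⁺ refl) (rowCond⁺ a))
    good (suc k) p⁺ (s≤s k≤) b a =
      L.good k (λ { refl → colCond⁺ b }) k≤ (missedBelow-tail⁻ b) (missedAbove-tail⁻ a)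

  layered-suc⁻ : ∀ {p} → LayeredBy (suc R) p c M →
    (supported c c M ≡ true × nonIso H ≡ true × not (p ∧ rowCond H) ≡ true) × LayeredBy R (colCond H) t T
  layered-suc⁻ {p} lay = (sup , iso , ok) , record { edge = edge ; covered = covered ; good = good }
    where
    module L = Layered lay
    allowed : ∀ {z x} → Kind c z → Kind c x → e z x ≡ true → Allowed (lookup c z) (lookup c x)
    allowed (low i)  _        h = ⊥-elim (true≢false (proj₁ (L.edge _ _ h)) (uL i))
    allowed _        (upp j)  h = ⊥-elim (true≢false (uU j) (proj₁ (proj₂ (L.edge _ _ h))))
    allowed (upp i)  (low j)  h rewrite lookup-upp c i | lookup-low c j = tt
    allowed (rest i) (rest j) h rewrite lookup-rest c i | lookup-rest c j = tt
    allowed (upp i)  (rest j) h with trans (sym (ℓU i)) (trans (proj₂ (proj₂ (L.edge _ _ h))) (cong suc (ℓT j)))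
    ... | ()
    allowed (rest i) (low j)  h = ⊥-elim (true≢false (trans (sym (uT i)) (proj₁ (L.edge _ _ h)))
      (upper-level (lookup t i) (ℕₚ.suc-injective (trans (sym (ℓT i)) (trans (proj₂ (proj₂ (L.edge _ _ h))) (cong suc (ℓL j)))))))
    sup : supported c c M ≡ true
    sup = supported⁺ c c M (λ z x → allowed (kind c z) (kind c x))
    iso : nonIso H ≡ true
    iso = every⁺ (some id) H (λ i → go i (L.covered (eU i) (uU i)))
      where
      go : ∀ i → ∃ (λ x → e (eU i) x ≡ true) → some id (lookup H i) ≡ true
      go i (x , h) with kind c x
      ... | low j  = some⁺ id (lookup H i) j (trans (H-entry i j) h)
      ... | upp j  = ⊥-elim (subst₂ Allowed (lookup-upp c i) (lookup-upp c j) (allowed (upp i) (upp j) h))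
      ... | rest j = ⊥-elim (subst₂ Allowed (lookup-upp c i) (lookup-rest c j) (allowed (upp i) (rest j) h))
    ok : not (p ∧ rowCond H) ≡ true
    -- Level 0 is always missed from below, so goodness there is a condition on `rowCond` alone.
    ok = not-intro (λ h → L.good 0 (λ _ → ∧-elimˡ h) z≤n
      (inj₁ (λ z → upper-level (lookup c z))) (rowCond⁻ (∧-elimʳ {p} h)))
    edge : ∀ z x → entry T z x ≡ true → u′ z ≡ true × u′ x ≡ false × ℓ′ z ≡ suc (ℓ′ x)
    edge z x h = let uz , ux , q = L.edge (eT z) (eT x) (trans (sym (T-entry z x)) h)
      in trans (sym (uT z)) uz , trans (sym (uT x)) ux , ℕₚ.suc-injective (trans (sym (ℓT z)) (trans q (cong suc (ℓT x))))
    covered : ∀ z → u′ z ≡ true → ∃ λ x → entry T z x ≡ true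
    covered z q = go (L.covered (eT z) (trans (uT z) q))
      where
      go : ∃ (λ x → e (eT z) x ≡ true) → ∃ λ x → entry T z x ≡ true
      go (x , h) with kind c x
      ... | rest j = j , trans (T-entry z j) h
      ... | low j  = ⊥-elim (subst₂ Allowed (lookup-rest c z) (lookup-low c j) (allowed (rest z) (low j) h))
      ... | upp j  = ⊥-elim (subst₂ Allowed (lookup-rest c z) (lookup-upp c j) (allowed (rest z) (upp j) h))
    good : ∀ k → (k ≡ 0 → colCond H ≡ true) → k ℕ.≤ R → MissedBelow ℓ′ u′ (entry T) k → MissedAbove ℓ′ u′ (entry T) k → ⊥
    -- Level 0 of the tail is level 1 of the whole. The argument `b` carries no information; the bit
    -- `colCond H` shows that this level is missed from below.
    good zero    p⁺ k≤ b a = L.good 1 (λ ()) (s≤s k≤) (colCond⁻ (p⁺ refl)) (missedAbove-tail⁺ a)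
    good (suc k) p⁺ k≤ b a = L.good (suc (suc k)) (λ ()) (s≤s k≤) (missedBelow-tail⁺ b) (missedAbove-tail⁺ a)

valid⇒layered : ∀ R p (c : Vec (Col R) n) M → valid R p c M ≡ true → LayeredBy R p c M
valid⇒layered {n} zero p c M v = record
  { edge = λ z x h → ⊥-elim (not-elim (every⁻ not (lookup M z) (every⁻ (every not) M (∧-elimˡ v) z) x) h)
  ; covered = λ z ()
  ; good = λ { zero p⁺ _ b a → not-elim (∧-elimʳ {every (every not) M} v) (∧-intro (p⁺ refl) (none n {c} {M} a)) } }
  where
  -- With a single level nothing is upper, so being missed from above means that there is no vertex.
  none : ∀ n {c : Vec (Col 0) n} {M : Rel n} → MissedAbove (level ∘ lookup c) (upper ∘ lookup c) (entry M) 0 → (n ≡ᵇ 0) ≡ true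
  none zero    a = refl
  none (suc n) (inj₁ all) with all zero refl
  ... | ()
  none (suc n) (inj₂ (z , () , _))
valid⇒layered (suc R) p c M v = Step.layered-suc⁺ c M
  (∧-elimˡ v) (∧-elimˡ v₁) (∧-elimʳ {nonIso (Step.H c M)} v₁)
  (valid⇒layered R (colCond (Step.H c M)) (tailCols c) (Step.T c M) (∧-elimʳ {nonIso (Step.H c M) ∧ not (p ∧ rowCond (Step.H c M))} v₂))
  where
  v₂ = ∧-elimʳ {supported c c M} v
  v₁ = ∧-elimˡ v₂

layered⇒valid : ∀ R p (c : Vec (Col R) n) M → LayeredBy R p c M → valid R p c M ≡ true
layered⇒valid {n} zero p c M lay = ∧-intro
  (every⁺ (every not) M (λ z → every⁺ not (lookup M z) (λ x → not-intro (λ h → true≢false (proj₁ (L.edge z x h)) refl))))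
  (not-intro (λ h → L.good 0 (λ _ → ∧-elimˡ h) z≤n (inj₁ (λ _ _ → refl))
    (inj₁ (λ x → ⊥-elim (empty n (∧-elimʳ {p} h) x)))))
  where
  module L = Layered lay
  empty : ∀ k → (k ≡ᵇ 0) ≡ true → Fin k → ⊥
  empty zero _ ()
layered⇒valid (suc R) p c M lay =
  let (sup , iso , ok) , tail = Step.layered-suc⁻ c M lay
  in ∧-intro sup (∧-intro (∧-intro iso ok) (layered⇒valid R (colCond (Step.H c M)) (tailCols c) (Step.T c M) tail))

matrix : (Fin n → Fin n → Bool) → Rel n
matrix f = tabulate (λ i → tabulate (f i))

entry-matrix : ∀ (f : Fin n → Fin n → Bool) i j → entry (matrix f) i j ≡ f i j
entry-matrix f i j = trans (cong (λ r → lookup r j) (lookup∘tabulate (λ i → tabulate (f i)) i)) (lookup∘tabulate (f i) j)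

does⁻ : ∀ {P : Set} (d : Dec P) → does d ≡ true → P
does⁻ (yes p) _ = p

-- From layered structures to posets

module Order {n : ℕ} (ℓ : Fin n → ℕ) (e : Fin n → Fin n → Bool) where

  data _⊑_ (i : Fin n) : Fin n → Set where
    same : i ⊑ i
    far  : ∀ {j} → suc (suc (ℓ i)) ≤ ℓ j → i ⊑ j
    near : ∀ {j} → ℓ j ≡ suc (ℓ i) → e j i ≡ false → i ⊑ j

  leq : Fin n → Fin n → Bool
  leq i j = does (i Fin.≟ j) ∨ (does (suc (suc (ℓ i)) ℕ.≤? ℓ j) ∨ (does (ℓ j ℕ.≟ suc (ℓ i)) ∧ not (e j i)))

  leq⁺ : ∀ {i j} → i ⊑ j → leq i j ≡ true
  leq⁺ {i} same = ∨-introˡ (dec-true (i Fin.≟ i) refl)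
  leq⁺ {i} {j} (far p) = ∨-introʳ (does (i Fin.≟ j)) (∨-introˡ (dec-true (suc (suc (ℓ i)) ℕ.≤? ℓ j) p))
  leq⁺ {i} {j} (near p q) = ∨-introʳ (does (i Fin.≟ j)) (∨-introʳ (does (suc (suc (ℓ i)) ℕ.≤? ℓ j))
    (∧-intro (dec-true (ℓ j ℕ.≟ suc (ℓ i)) p) (cong not q)))

  leq⁻ : ∀ {i j} → leq i j ≡ true → i ⊑ j
  leq⁻ {i} {j} h with ∨-elim {does (i Fin.≟ j)} h
  ... | inj₁ p = subst (i ⊑_) (does⁻ (i Fin.≟ j) p) same
  ... | inj₂ h′ with ∨-elim {does (suc (suc (ℓ i)) ℕ.≤? ℓ j)} h′
  ...   | inj₁ p = far (does⁻ (suc (suc (ℓ i)) ℕ.≤? ℓ j) p)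
  ...   | inj₂ p = near (does⁻ (ℓ j ℕ.≟ suc (ℓ i)) (∧-elimˡ p))
    (not-false (∧-elimʳ {does (ℓ j ℕ.≟ suc (ℓ i))} p))
    where
    not-false : ∀ {b} → not b ≡ true → b ≡ false
    not-false {false} _ = refl

  ⊑-level : ∀ {i j} → i ⊑ j → i ≢ j → ℓ i < ℓ j
  ⊑-level same i≢i = ⊥-elim (i≢i refl)
  ⊑-level (far p) _ = ℕₚ.<⇒≤ p
  ⊑-level (near p _) _ = ℕₚ.≤-reflexive (sym p)

  order : Rel n
  order = matrix leq

  order⁺ : ∀ {i j} → i ⊑ j → _≼_ order i j
  order⁺ {i} {j} p = trans (entry-matrix leq i j) (leq⁺ p)

  order⁻ : ∀ {i j} → _≼_ order i j → i ⊑ j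
  order⁻ {i} {j} p = leq⁻ (trans (sym (entry-matrix leq i j)) p)

module FromLayered {n R : ℕ} {ℓ : Fin n → ℕ} {u : Fin n → Bool} {e : Fin n → Fin n → Bool}
  (lay : Layered ℓ u e R true) (ℓ≤ : ∀ i → ℓ i ≤ R) where

  open Layered lay
  open Order ℓ e

  inhabited : ∀ k → k ≤ R → ∃ λ i → ℓ i ≡ k
  inhabited k k≤ with Finₚ.any? (λ i → ℓ i ℕ.≟ k)
  ... | yes h = h
  ... | no ¬h = ⊥-elim (good k (λ _ → refl) k≤ (inj₁ (λ z p → ⊥-elim (¬h (z , p)))) (inj₁ (λ z p → ⊥-elim (¬h (z , p)))))

  -- Otherwise `z` has an edge to all of level `k`. Then nothing on this level is upper, so it is
  -- missed from below, and `z` itself shows that it is missed from above (trivially if the level is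
  -- empty).
  down : ∀ z k → ℓ z ≡ suc k → ∃ λ y → ℓ y ≡ k × e z y ≡ false
  down z k ℓz with Finₚ.any? (λ y → (ℓ y ℕ.≟ k) ×-dec (e z y Boolₚ.≟ false))
  ... | yes h = h
  ... | no ¬h = ⊥-elim (good k (λ _ → refl) (ℕₚ.<⇒≤ (subst (_≤ R) ℓz (ℓ≤ z))) (inj₁ below) (above (u z) refl))
    where
    hit : ∀ w → ℓ w ≡ k → e z w ≡ true
    hit w p = Boolₚ.¬-not (λ q → ¬h (w , p , q))
    below : ∀ w → ℓ w ≡ k → u w ≡ false
    below w p = proj₁ (proj₂ (edge z w (hit w p)))
    above : ∀ b → u z ≡ b → MissedAbove ℓ u e k
    above true  uz = inj₂ (z , uz , ℓz , λ w p _ → hit w p)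
    above false uz = inj₁ (λ w p → ⊥-elim (true≢false (proj₁ (edge z w (hit w p))) uz))

  -- Dual to `down`: if `x` had an edge to the whole next level, every vertex there would be upper.
  up : ∀ x → ℓ x < R → ∃ λ y → ℓ y ≡ suc (ℓ x) × e y x ≡ false
  up x ℓx with Finₚ.any? (λ y → (ℓ y ℕ.≟ suc (ℓ x)) ×-dec (e y x Boolₚ.≟ false))
  ... | yes h = h
  ... | no ¬h = ⊥-elim (good (suc (ℓ x)) (λ ()) ℓx (below (u x) refl) (inj₁ (λ w p → proj₁ (edge w x (hit w p)))))
    where
    hit : ∀ w → ℓ w ≡ suc (ℓ x) → e w x ≡ true
    hit w p = Boolₚ.¬-not (λ q → ¬h (w , p , q))
    below : ∀ b → u x ≡ b → MissedBelow ℓ u e (suc (ℓ x))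
    below false ux = inj₂ (x , ux , refl , λ w p _ → hit w p)
    below true  ux = inj₁ (λ w p → ⊥-elim (true≢false ux (proj₁ (proj₂ (edge w x (hit w p))))))

  -- If each vertex between were hit by `x` or by `z`, the upper ones could only be hit by `x` and
  -- the others only by `z`, as an edge goes from an upper vertex to one that is not upper. So the
  -- level would be missed from both sides.
  middle : ∀ x z → ℓ z ≡ suc (suc (ℓ x)) → ∃ λ y → ℓ y ≡ suc (ℓ x) × e y x ≡ false × e z y ≡ false
  middle x z ℓz with Finₚ.any? (λ y → (ℓ y ℕ.≟ suc (ℓ x)) ×-dec ((e y x Boolₚ.≟ false) ×-dec (e z y Boolₚ.≟ false)))
  ... | yes h = h
  ... | no ¬h = ⊥-elim (good (suc (ℓ x)) (λ ()) (ℕₚ.<⇒≤ (subst (_≤ R) ℓz (ℓ≤ z))) (below (u x) refl) (above (u z) refl))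
    where
    hit : ∀ w → ℓ w ≡ suc (ℓ x) → e w x ≡ true ⊎ e z w ≡ true
    hit w p with e w x in q | e z w in r
    ... | true  | _     = inj₁ refl
    ... | false | true  = inj₂ refl
    ... | false | false = ⊥-elim (¬h (w , p , q , r))
    below : ∀ b → u x ≡ b → MissedBelow ℓ u e (suc (ℓ x))
    below false ux = inj₂ (x , ux , refl , λ w p uw → byHit w uw (hit w p))
      where
      byHit : ∀ w → u w ≡ true → e w x ≡ true ⊎ e z w ≡ true → e w x ≡ true
      byHit w uw (inj₁ h) = h
      byHit w uw (inj₂ h) = ⊥-elim (true≢false uw (proj₁ (proj₂ (edge z w h))))
    below true ux = inj₁ (λ w p → byHit w (hit w p))
      where
      byHit : ∀ w → e w x ≡ true ⊎ e z w ≡ true → u w ≡ false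
      byHit w (inj₁ h) = ⊥-elim (true≢false ux (proj₁ (proj₂ (edge w x h))))
      byHit w (inj₂ h) = proj₁ (proj₂ (edge z w h))
    above : ∀ b → u z ≡ b → MissedAbove ℓ u e (suc (ℓ x))
    above true uz = inj₂ (z , uz , ℓz , λ w p uw → byHit w uw (hit w p))
      where
      byHit : ∀ w → u w ≡ false → e w x ≡ true ⊎ e z w ≡ true → e z w ≡ true
      byHit w uw (inj₁ h) = ⊥-elim (true≢false (proj₁ (edge w x h)) uw)
      byHit w uw (inj₂ h) = h
    above false uz = inj₁ (λ w p → byHit w (hit w p))
      where
      byHit : ∀ w → e w x ≡ true ⊎ e z w ≡ true → u w ≡ true
      byHit w (inj₁ h) = proj₁ (edge w x h)
      byHit w (inj₂ h) = ⊥-elim (true≢false (proj₁ (edge z w h)) uz)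

  ⊑-antisym : ∀ {i j} → i ⊑ j → j ⊑ i → i ≡ j
  ⊑-antisym {i} {j} p q with i Fin.≟ j
  ... | yes i≡j = i≡j
  ... | no i≢j = ⊥-elim (ℕₚ.<-asym (⊑-level p i≢j) (⊑-level q (i≢j ∘ sym)))

  -- Two strict steps climb at least two levels, where `far` asks nothing of the edges.
  ⊑-trans : ∀ {i j k} → i ⊑ j → j ⊑ k → i ⊑ k
  ⊑-trans {i} {j} {k} p q with i Fin.≟ j | j Fin.≟ k
  ... | yes refl | _        = q
  ... | no _     | yes refl = p
  ... | no i≢j   | no j≢k   = far (ℕₚ.≤-trans (s≤s (⊑-level p i≢j)) (⊑-level q j≢k))

  ≢-level : ∀ {i j} → ℓ i < ℓ j → i ≢ j
  ≢-level p refl = ℕₚ.<-irrefl refl p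

  covers : ∀ a b → Covers order b a → ℓ b ≡ suc (ℓ a)
  covers a b ((a≼b , a≢b) , ¬mid) with order⁻ a≼b
  ... | same     = ⊥-elim (a≢b refl)
  ... | near p _ = p
  ... | far p with ℓ b ℕ.≟ suc (suc (ℓ a))
  ...   | yes q = let y , ℓy , ya , by = middle a b q in ⊥-elim (¬mid (y ,
            (order⁺ (near ℓy ya) , ≢-level (ℕₚ.≤-reflexive (sym ℓy))) ,
            (order⁺ (near (trans q (cong suc (sym ℓy))) by) , ≢-level (ℕₚ.≤-reflexive (trans (cong suc ℓy) (sym q))))))
  -- With a gap above two, one step up from `a` still ends at least two levels below `b`.
  ...   | no q = let y , ℓy , ya = up a (ℕₚ.≤-trans (ℕₚ.<⇒≤ p) (ℓ≤ b))
                     p′ = subst (λ t → suc (suc t) ≤ ℓ b) (sym ℓy) (ℕₚ.≤∧≢⇒< p (q ∘ sym))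
                 in ⊥-elim (¬mid (y , (order⁺ (near ℓy ya) , ≢-level (ℕₚ.≤-reflexive (sym ℓy))) ,
                     (order⁺ (far p′) , ≢-level (ℕₚ.<⇒≤ p′))))

  toBottom : ∀ k a → ℓ a ≡ k → ∃[ b ] (Connected order a b × ℓ b ≡ 0)
  toBottom zero    a p = a , ε , p
  toBottom (suc k) a p =
    let y , ℓy , ay = down a k p
        b , path , q = toBottom k y ℓy
    in b , inj₂ (order⁺ (near (trans p (cong suc (sym ℓy))) ay)) ◅ path , q

  minimal : ∀ a → Minimal order a → ℓ a ≡ 0
  minimal a min with ℓ a in p
  ... | zero  = refl
  ... | suc k = let y , ℓy , ay = down a k p in ⊥-elim (≢-level (ℕₚ.≤-reflexive (trans (cong suc ℓy) (sym p)))
                 (min y (order⁺ (near (trans p (cong suc (sym ℓy))) ay))))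

  maximal : ∀ a → Maximal order a → ℓ a ≡ R
  maximal a max with ℓ a ℕ.≟ R
  ... | yes p = p
  ... | no p = let y , ℓy , ya = up a (ℕₚ.≤∧≢⇒< (ℓ≤ a) p) in
                ⊥-elim (≢-level (ℕₚ.≤-reflexive (sym ℓy)) (sym (max y (order⁺ (near ℓy ya)))))

  -- A vertex incomparable to `x` and to `z` is at most one level from each, and `z` is at least two
  -- levels above `x`. So `w` lies exactly halfway, with an edge on either side, and would be both
  -- upper and not upper.
  avoids : Avoids3+1 order
  avoids (x , y , z , w , (x≼y , x≢y) , (y≼z , y≢z) , (¬wx , ¬xw) , _ , (¬wz , ¬zw)) =
    true≢false (proj₁ (edge w x wx)) (proj₁ (proj₂ (edge z w zw)))
    where
    gap : suc (suc (ℓ x)) ≤ ℓ z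
    gap = ℕₚ.≤-trans (s≤s (⊑-level (order⁻ x≼y) x≢y)) (⊑-level (order⁻ y≼z) y≢z)
    w≤ : ℓ w ≤ suc (ℓ x)
    w≤ = ℕₚ.≮⇒≥ (λ p → ¬xw (order⁺ (far p)))
    z≤ : ℓ z ≤ suc (ℓ w)
    z≤ = ℕₚ.≮⇒≥ (λ p → ¬wz (order⁺ (far p)))
    ℓw : ℓ w ≡ suc (ℓ x)
    ℓw = ℕₚ.≤-antisym w≤ (ℕₚ.≤-pred (ℕₚ.≤-trans gap z≤))
    ℓz : ℓ z ≡ suc (ℓ w)
    ℓz = ℕₚ.≤-antisym z≤ (ℕₚ.≤-trans (s≤s w≤) gap)
    wx : e w x ≡ true
    wx = Boolₚ.¬-not (λ q → ¬xw (order⁺ (near ℓw q)))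
    zw : e z w ≡ true
    zw = Boolₚ.¬-not (λ q → ¬wz (order⁺ (near ℓz q)))

  isSG31 : IsSG31Poset order
  isSG31 = ((λ i → order⁺ same) , (λ i j p q → ⊑-antisym (order⁻ p) (order⁻ q)) ,
      (λ i j k p q → order⁺ (⊑-trans (order⁻ p) (order⁻ q)))) ,
    (ℓ , (covers , λ a → toBottom (ℓ a) a refl) ,
      (λ a b p q → trans (minimal a p) (sym (minimal b q))) ,
      (λ a b p q → trans (maximal a p) (sym (maximal b q)))) ,
    avoids

-- Recovering a layered structure from its order

module _ {n R : ℕ} {ℓ ℓ′ : Fin n → ℕ} {u : Fin n → Bool} {e e′ : Fin n → Fin n → Bool}
  (lay : Layered ℓ u e R true) (ℓ≤ : ∀ i → ℓ i ≤ R)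
  (same-order : ∀ i j → Order.leq ℓ e i j ≡ true → Order.leq ℓ′ e′ i j ≡ true) where

  private
    module F = FromLayered lay ℓ≤
    module O = Order ℓ e
    module O′ = Order ℓ′ e′

  -- Iterating `down` gives a chain from level 0 up to `i`. It is a chain in the second order too,
  -- where each strict step raises the level.
  level-≤ : ∀ k i → ℓ i ≡ k → k ≤ ℓ′ i
  level-≤ zero    i p = z≤n
  level-≤ (suc k) i p =
    let y , ℓy , iy = F.down i k p
        y⊑i = O′.leq⁻ (same-order y i (O.leq⁺ (O.near (trans p (cong suc (sym ℓy))) iy)))
    in ℕₚ.≤-<-trans (level-≤ k y ℓy) (O′.⊑-level y⊑i (F.≢-level (ℕₚ.≤-reflexive (trans (cong suc ℓy) (sym p)))))

  top-≤ : ∀ {R′} → (∀ i → ℓ′ i ≤ R′) → R ≤ R′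
  top-≤ ℓ′≤ = let i , p = F.inhabited R ℕₚ.≤-refl in ℕₚ.≤-trans (level-≤ R i p) (ℓ′≤ i)

module _ {n R R′ : ℕ} {ℓ ℓ′ : Fin n → ℕ} {u u′ : Fin n → Bool} {e e′ : Fin n → Fin n → Bool}
  (lay : Layered ℓ u e R true) (lay′ : Layered ℓ′ u′ e′ R′ true)
  (ℓ≡ : ∀ i → ℓ i ≡ ℓ′ i) (same-order : ∀ i j → Order.leq ℓ′ e′ i j ≡ true → Order.leq ℓ e i j ≡ true) where

  private
    module O = Order ℓ e
    module O′ = Order ℓ′ e′

  -- Between adjacent levels an edge is precisely a failure of comparability, so once the levels
  -- agree the order determines the edges, and with `covered` also the flags.
  edge-⇒ : ∀ z x → e z x ≡ true → e′ z x ≡ true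
  edge-⇒ z x h = Boolₚ.¬-not (λ q → go (O.leq⁻ (same-order x z (O′.leq⁺ (O′.near (trans (sym (ℓ≡ z)) (trans ℓz (cong suc (ℓ≡ x)))) q)))))
    where
    ℓz = proj₂ (proj₂ (Layered.edge lay z x h))
    clash : ∀ {a b} → a ≡ suc b → b ≡ a → ⊥
    clash refl ()
    go : O._⊑_ x z → ⊥
    go O.same       = clash ℓz refl
    go (O.far p)    = ℕₚ.<-irrefl (sym ℓz) p
    go (O.near _ q) = true≢false h q

  upper-⇒ : ∀ z → u z ≡ true → u′ z ≡ true
  upper-⇒ z p = let x , h = Layered.covered lay z p in proj₁ (Layered.edge lay′ z x (edge-⇒ z x h))

-- From posets to layered structures

module FromPoset {n : ℕ} (M : Rel n) (i₀ : Fin n) (sg : IsSG31Poset M) where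

  private
    ≼-refl = proj₁ (proj₁ sg)
    ≼-antisym = proj₁ (proj₂ (proj₁ sg))
    ≼-trans = proj₂ (proj₂ (proj₁ sg))
    graded = proj₁ (proj₂ sg)
    avoids = proj₂ (proj₂ sg)

    infix 4 _⊏_ _⊑_
    _⊑_ _⊏_ : Fin n → Fin n → Set
    _⊑_ = _≼_ M
    _⊏_ = _≺_ M

  rk : Fin n → ℕ
  rk = proj₁ graded

  private
    rk-covers = proj₁ (proj₁ (proj₂ graded))
    rk-bottom = proj₂ (proj₁ (proj₂ graded))
    minimal-rk = proj₁ (proj₂ (proj₂ graded))
    maximal-rk = proj₂ (proj₂ (proj₂ graded))

    _⊏?_ : ∀ a b → Dec (a ⊏ b)
    a ⊏? b = (entry M a b Boolₚ.≟ true) ×-dec ¬? (a Fin.≟ b)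

    ⊏-trans : ∀ {a b c} → a ⊏ b → b ⊏ c → a ⊏ c
    ⊏-trans {a} {b} {c} (p , a≢b) (q , b≢c) = ≼-trans a b c p q ,
      λ { refl → a≢b (≼-antisym a b p q) }

    isStrict : IsStrictPartialOrder _≡_ _⊏_
    isStrict = record
      { isEquivalence = isEquivalence
      ; irrefl = λ { refl (_ , a≢a) → a≢a refl }
      ; trans = ⊏-trans
      ; <-resp-≈ = (λ { refl h → h }) , (λ { refl h → h }) }

    wf : WellFounded _⊏_
    wf = spo-wellFounded isStrict

    noeth : WellFounded (flip _⊏_)
    noeth = spo-noetherian isStrict

  upperCover : ∀ a b → Acc _⊏_ b → a ⊏ b → ∃ λ c → Covers M c a × c ⊑ b
  upperCover a b (acc rec) a⊏b with Finₚ.any? (λ c → (a ⊏? c) ×-dec (c ⊏? b))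
  ... | no ¬mid = b , (a⊏b , ¬mid) , ≼-refl b
  ... | yes (c , a⊏c , c⊏b) =
    let d , cov , d⊑c = upperCover a c (rec c⊏b) a⊏c in d , cov , ≼-trans d c b d⊑c (proj₁ c⊏b)

  lowerCover : ∀ a b → Acc (flip _⊏_) a → a ⊏ b → ∃ λ c → Covers M b c
  lowerCover a b (acc rec) a⊏b with Finₚ.any? (λ c → (a ⊏? c) ×-dec (c ⊏? b))
  ... | no ¬mid = a , (a⊏b , ¬mid)
  ... | yes (c , a⊏c , c⊏b) = lowerCover c b (rec a⊏c) c⊏b

  rk-mono : ∀ a b → Acc (flip _⊏_) a → a ⊏ b → rk a < rk b
  rk-mono a b (acc rec) a⊏b with upperCover a b (wf b) a⊏b
  ... | c , cov , c⊑b with c Fin.≟ b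
  ...   | yes refl = ℕₚ.≤-reflexive (sym (rk-covers a c cov))
  ...   | no c≢b = ℕₚ.<-trans (ℕₚ.≤-reflexive (sym (rk-covers a c cov))) (rk-mono c b (rec (proj₁ cov)) (c⊑b , c≢b))

  ⊏-rk : ∀ {a b} → a ⊏ b → rk a < rk b
  ⊏-rk {a} {b} = rk-mono a b (noeth a)

  rk-bottom-minimal : ∀ b → rk b ≡ 0 → Minimal M b
  rk-bottom-minimal b p c c⊑b with c Fin.≟ b
  ... | yes c≡b = c≡b
  ... | no c≢b with subst (rk c <_) p (⊏-rk (c⊑b , c≢b))
  ...   | ()

  -- Rank 0 occurs in the component of `a`, and only at minimal elements because the rank is
  -- strictly monotone; all minimal elements share one rank.
  minimal-bottom : ∀ a → Minimal M a → rk a ≡ 0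
  minimal-bottom a min =
    let b , _ , p = rk-bottom a in trans (minimal-rk a b min (rk-bottom-minimal b p)) p

  below : ∀ b k → rk b ≡ suc k → ∃ λ a → a ⊏ b × rk a ≡ k
  below b k p with Finₚ.any? (λ a → a ⊏? b)
  ... | yes (a , a⊏b) = let c , cov = lowerCover a b (noeth a) a⊏b in
        c , proj₁ cov , ℕₚ.suc-injective (trans (sym (rk-covers c b cov)) p)
  ... | no none with trans (sym p) (minimal-bottom b min)
    where
    min : Minimal M b
    min c c⊑b with c Fin.≟ b
    ... | yes q = q
    ... | no q = ⊥-elim (none (c , c⊑b , q))
  ...   | ()

  toMaximal : ∀ a → Acc (flip _⊏_) a → ∃ λ b → a ⊑ b × Maximal M b
  toMaximal a (acc rec) with Finₚ.any? (λ b → a ⊏? b)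
  ... | yes (b , a⊏b) = let c , b⊑c , max = toMaximal b (rec a⊏b) in c , ≼-trans a b c (proj₁ a⊏b) b⊑c , max
  ... | no none = a , ≼-refl a , max
    where
    max : Maximal M a
    max b a⊑b with a Fin.≟ b
    ... | yes q = sym q
    ... | no q = ⊥-elim (none (b , a⊑b , q))

  private
    top : ∃ λ b → i₀ ⊑ b × Maximal M b
    top = toMaximal i₀ (noeth i₀)

  R : ℕ
  R = rk (proj₁ top)

  ⊑-rk : ∀ {a b} → a ⊑ b → rk a ≤ rk b
  ⊑-rk {a} {b} p with a Fin.≟ b
  ... | yes refl = ℕₚ.≤-refl
  ... | no q = ℕₚ.<⇒≤ (⊏-rk (p , q))

  rk≤ : ∀ a → rk a ≤ R
  rk≤ a = let b , a⊑b , max = toMaximal a (noeth a) in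
    subst (rk a ≤_) (maximal-rk b (proj₁ top) max (proj₂ (proj₂ top))) (⊑-rk a⊑b)

  above : ∀ a → rk a < R → ∃ λ b → a ⊏ b × rk b ≡ suc (rk a)
  above a a<R =
    let b , a⊑b , max = toMaximal a (noeth a)
        c , cov , _ = upperCover a b (wf b) (a⊑b , λ q → ℕₚ.<-irrefl (trans (cong rk q) (maximal-rk b (proj₁ top) max (proj₂ (proj₂ top)))) a<R)
    in c , proj₁ cov , rk-covers a c cov

  -- Since rk a + 2 ≤ rk b ≤ R and all maximal elements have rank `R`, two covers can be climbed
  -- from `a`. By ranks `b` lies below none of the three elements, except possibly by being equal to
  -- the top one, and then a ⊑ b; if it lay above one, it would lie above `a`.
  far-comparable : ∀ a b → suc (suc (rk a)) ≤ rk b → a ⊑ b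
  far-comparable a b gap with entry M a b Boolₚ.≟ true
  ... | yes h = h
  ... | no a⋢b =
    let a₁ , a⊏a₁ , r₁ = above a (ℕₚ.≤-trans (ℕₚ.<⇒≤ gap) (rk≤ b))
        a₂ , a₁⊏a₂ , r₂ = above a₁ (subst (_< R) (sym r₁) (ℕₚ.≤-trans gap (rk≤ b)))
        rk-a₂ = trans r₂ (cong suc r₁)
    in ⊥-elim (avoids (a , a₁ , a₂ , b , a⊏a₁ , a₁⊏a₂ ,
      ((λ p → ℕₚ.<⇒≱ (ℕₚ.<⇒≤ gap) (⊑-rk p)) , a⋢b) ,
      ((λ p → ℕₚ.<⇒≱ gap (subst (rk b ≤_) r₁ (⊑-rk p))) , (λ p → a⋢b (≼-trans a a₁ b (proj₁ a⊏a₁) p))) ,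
      ((λ p → a⋢b (subst (a ⊑_) (sym (collapse a₂ rk-a₂ p)) (≼-trans a a₁ a₂ (proj₁ a⊏a₁) (proj₁ a₁⊏a₂)))) ,
       (λ p → a⋢b (≼-trans a a₁ b (proj₁ a⊏a₁) (≼-trans a₁ a₂ b (proj₁ a₁⊏a₂) p))))))
    where
    collapse : ∀ a₂ → rk a₂ ≡ suc (suc (rk a)) → b ⊑ a₂ → b ≡ a₂
    collapse a₂ r p with b Fin.≟ a₂
    ... | yes q = q
    ... | no q = ⊥-elim (ℕₚ.<⇒≱ (⊏-rk (p , q)) (subst (_≤ rk b) (sym r) gap))

  -- The two are comparable by `far-comparable`, but a cover would raise the rank by one only.
  between : ∀ a b → rk b ≡ suc (suc (rk a)) → ∃ λ c → rk c ≡ suc (rk a) × a ⊑ c × c ⊑ b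
  between a b p with Finₚ.any? (λ c → (a ⊏? c) ×-dec (c ⊏? b))
  ... | yes (c , a⊏c , c⊏b) = c , ℕₚ.≤-antisym (ℕₚ.≤-pred (subst (rk c <_) p (⊏-rk c⊏b))) (⊏-rk a⊏c) , proj₁ a⊏c , proj₁ c⊏b
  ... | no ¬mid = ⊥-elim (ℕₚ.1+n≢n (ℕₚ.suc-injective (trans (sym p) (rk-covers a b
        ((far-comparable a b (ℕₚ.≤-reflexive (sym p)) , λ { refl → m≢2+m p }) , ¬mid)))))
    where
    m≢2+m : ∀ {m} → m ≡ suc (suc m) → ⊥
    m≢2+m {m} q = ℕₚ.<-irrefl q (ℕₚ.m<n⇒m<1+n (ℕₚ.n<1+n m))

  inhabited : ∀ j k → j ℕ.+ k ≡ R → ∃ λ a → rk a ≡ k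
  inhabited zero    k p = proj₁ top , sym p
  inhabited (suc j) k p =
    let b , q = inhabited j (suc k) (trans (ℕₚ.+-suc j k) p)
        a , _ , r = below b k q
    in a , r

  missing : Fin n → Fin n → Bool
  missing z x = does (rk z ℕ.≟ suc (rk x)) ∧ not (entry M x z)

  missing⁺ : ∀ {z x} → rk z ≡ suc (rk x) → ¬ (x ⊑ z) → missing z x ≡ true
  missing⁺ {z} {x} p q = ∧-intro (dec-true (rk z ℕ.≟ suc (rk x)) p) (not-intro q)

  missing⁻ : ∀ {z x} → missing z x ≡ true → rk z ≡ suc (rk x) × ¬ (x ⊑ z)
  missing⁻ {z} {x} h = does⁻ (rk z ℕ.≟ suc (rk x)) (∧-elimˡ h) , not-elim (∧-elimʳ {does (rk z ℕ.≟ suc (rk x))} h)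

  missingBelow? : ∀ z → Dec (∃ λ x → missing z x ≡ true)
  missingBelow? z = Finₚ.any? (λ x → missing z x Boolₚ.≟ true)

  isMissing : Fin n → Bool
  isMissing z = does (missingBelow? z)

  isMissing⁺ : ∀ {z} x → missing z x ≡ true → isMissing z ≡ true
  isMissing⁺ {z} x h = dec-true (missingBelow? z) (x , h)

  isMissing⁻ : ∀ {z} → isMissing z ≡ true → ∃ λ x → missing z x ≡ true
  isMissing⁻ {z} = does⁻ (missingBelow? z)

  -- If y is missed by x and x by z (ranks k-1, k, k+1), then y lies below z, and a chain
  -- y < w < z together with x is a copy of 3+1.
  oneSided : ∀ {z x} → missing z x ≡ true → isMissing x ≡ false
  oneSided {z} {x} h with isMissing x in m
  ... | false = refl
  ... | true =
    let y , h′ = isMissing⁻ {x} m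
        rz , x⋢z = missing⁻ {z} {x} h
        rx , y⋢x = missing⁻ {x} {y} h′
        w , rw , y⊑w , w⊑z = between y z (trans rz (cong suc rx))
        strict : ∀ {a b} → rk b ≡ suc (rk a) → a ⊑ b → a ⊏ b
        strict p q = q , λ { refl → ℕₚ.1+n≢n (sym p) }
        x≢w : x ≢ w
        x≢w = λ q → x⋢z (subst (_⊑ z) (sym q) w⊑z)
        sameRank : rk x ≡ rk w
        sameRank = trans rx (sym rw)
    in ⊥-elim (avoids (y , w , z , x , strict rw y⊑w , strict (trans rz (cong suc sameRank)) w⊑z ,
      ((λ p → ℕₚ.<⇒≱ (ℕₚ.≤-reflexive (sym rx)) (⊑-rk p)) , y⋢x) ,
      ((λ p → ℕₚ.<-irrefl sameRank (⊏-rk (p , x≢w))) , (λ p → ℕₚ.<-irrefl (sym sameRank) (⊏-rk (p , x≢w ∘ sym)))) ,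
      (x⋢z , (λ p → ℕₚ.<⇒≱ (ℕₚ.≤-reflexive (sym rz)) (⊑-rk p)))))

  layered : Layered rk isMissing missing R true
  layered = record { edge = edge ; covered = λ z → isMissing⁻ {z} ; good = good }
    where
    edge : ∀ z x → missing z x ≡ true → isMissing z ≡ true × isMissing x ≡ false × rk z ≡ suc (rk x)
    edge z x h = isMissing⁺ {z} x h , oneSided {z} {x} h , proj₁ (missing⁻ {z} {x} h)
    -- The four cases are an empty level, an element `z` with nothing one level below it, an element
    -- `x` with nothing one level above it, and a pair two levels apart with nothing in between.
    good : ∀ k → (k ≡ 0 → true ≡ true) → k ≤ R → MissedBelow rk isMissing missing k → MissedAbove rk isMissing missing k → ⊥
    good k _ k≤R (inj₁ none) (inj₁ all) =
      let w , p = inhabited (R ℕ.∸ k) k (ℕₚ.m∸n+n≡m k≤R) in true≢false (all w p) (none w p)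
    good k _ k≤R (inj₁ none) (inj₂ (z , _ , rz , all)) =
      let w , w⊏z , p = below z k rz in proj₂ (missing⁻ {z} {w} (all w p (none w p))) (proj₁ w⊏z)
    good k _ k≤R (inj₂ (x , _ , rx , all)) (inj₁ all′) =
      let w , x⊏w , p = above x (subst (_≤ R) (sym rx) k≤R)
          q = trans p rx
      in proj₂ (missing⁻ {w} {x} (all w q (all′ w q))) (proj₁ x⊏w)
    good k _ k≤R (inj₂ (x , _ , rx , all)) (inj₂ (z , _ , rz , all′)) =
      let w , p , x⊑w , w⊑z = between x z (trans rz (cong suc (sym rx)))
          q = trans p rx
      in go w q x⊑w w⊑z (isMissing w) refl
      where
      go : ∀ w → rk w ≡ k → x ⊑ w → w ⊑ z → ∀ b → isMissing w ≡ b → ⊥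
      go w q x⊑w w⊑z true  m = proj₂ (missing⁻ {w} {x} (all w q m)) x⊑w
      go w q x⊑w w⊑z false m = proj₂ (missing⁻ {z} {w} (all′ w q m)) w⊑z

  private module O = Order rk missing

  leq-complete : ∀ {i j} → i ⊑ j → i O.⊑ j
  leq-complete {i} {j} p with i Fin.≟ j
  ... | yes refl = O.same
  ... | no i≢j with ℕₚ.m≤n⇒m<n∨m≡n (⊏-rk (p , i≢j))
  ...   | inj₁ gap = O.far gap
  ...   | inj₂ q = O.near (sym q) (notMissing (missing j i) refl)
    where
    notMissing : ∀ b → missing j i ≡ b → b ≡ false
    notMissing false _ = refl
    notMissing true  m = ⊥-elim (proj₂ (missing⁻ {j} {i} m) p)

  leq-sound : ∀ {i j} → i O.⊑ j → i ⊑ j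
  leq-sound {i} O.same = ≼-refl i
  leq-sound {i} {j} (O.far p) = far-comparable i j p
  leq-sound {i} {j} (O.near p m) with entry M i j Boolₚ.≟ true
  ... | yes h = h
  ... | no ¬h = ⊥-elim (true≢false (missing⁺ {j} {i} p ¬h) m)

  leq-correct : ∀ i j → O.leq i j ≡ entry M i j
  leq-correct i j = Boolₚ.⇔→≡ (mk⇔ (leq-sound ∘ O.leq⁻) (O.leq⁺ ∘ leq-complete))

-- The final count

-- A formulation by sums of the fact that `a` occurs exactly once in the list; it passes directly to
-- vectors and colours.
Picks : List A → A → Set
Picks xs a = ∀ f → (∀ x → x ≢ a → f x ≡ 0ℤ) → ∑ xs f ≡ f a

picks-bits : ∀ b → Picks bits b
picks-bits true  f z = trans (∑-bits f) (trans (cong (ℤ._+ f true) (z false λ ())) (ℤₚ.+-identityˡ _))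
picks-bits false f z = trans (∑-bits f) (trans (+-congˡ (f false) (z true λ ())) (ℤₚ.+-identityʳ _))

picks-vecs : ∀ {xs : List A} → (∀ a → Picks xs a) → (v : Vec A n) → Picks (vecs xs n) v
picks-vecs pk [] f z = ℤₚ.+-identityʳ (f [])
picks-vecs {A} {suc n} {xs} pk (a ∷ v) f z = begin
  ∑ (vecs xs (suc n)) f
    ≡⟨ ∑-vecs xs n f ⟩
  ∑ xs (λ x → ∑ (vecs xs n) (λ w → f (x ∷ w)))
    ≡⟨ pk a _ (λ x x≢a → trans (∑-cong (vecs xs n) (λ w → z (x ∷ w) (λ { refl → x≢a refl }))) (∑-0 (vecs xs n))) ⟩
  ∑ (vecs xs n) (λ w → f (a ∷ w))
    ≡⟨ picks-vecs pk v (λ w → f (a ∷ w)) (λ w w≢v → z (a ∷ w) (λ { refl → w≢v refl })) ⟩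
  f (a ∷ v) ∎
  where open ≡-Reasoning

picks-cols : ∀ R (k : Col R) → Picks (cols R) k
picks-cols zero    tt f z = ℤₚ.+-identityʳ (f tt)
picks-cols (suc R) k  f z = begin
  f (inj₁ false) ℤ.+ (f (inj₁ true) ℤ.+ ∑ (List.map inj₂ (cols R)) f)
    ≡⟨ cong (λ t → f (inj₁ false) ℤ.+ (f (inj₁ true) ℤ.+ t)) (∑-map inj₂ (cols R) f) ⟩
  f (inj₁ false) ℤ.+ (f (inj₁ true) ℤ.+ ∑ (cols R) (f ∘ inj₂))
    ≡⟨ cases k z ⟩
  f k ∎
  where
  open ≡-Reasoning
  tail0 : (∀ y → f (inj₂ y) ≡ 0ℤ) → ∑ (cols R) (f ∘ inj₂) ≡ 0ℤ
  tail0 h = trans (∑-cong (cols R) h) (∑-0 (cols R))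
  cases : ∀ k → (∀ x → x ≢ k → f x ≡ 0ℤ) →
    f (inj₁ false) ℤ.+ (f (inj₁ true) ℤ.+ ∑ (cols R) (f ∘ inj₂)) ≡ f k
  cases (inj₁ false) z = trans (cong₂ (λ s t → f (inj₁ false) ℤ.+ (s ℤ.+ t)) (z (inj₁ true) λ ()) (tail0 λ y → z (inj₂ y) λ ()))
    (ℤₚ.+-identityʳ _)
  cases (inj₁ true) z = trans (cong₂ (λ s t → s ℤ.+ (f (inj₁ true) ℤ.+ t)) (z (inj₁ false) λ ()) (tail0 λ y → z (inj₂ y) λ ()))
    (trans (ℤₚ.+-identityˡ _) (ℤₚ.+-identityʳ _))
  cases (inj₂ y) z = trans (cong₂ (λ s t → s ℤ.+ (t ℤ.+ ∑ (cols R) (f ∘ inj₂))) (z (inj₁ false) λ ()) (z (inj₁ true) λ ()))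
    (trans (ℤₚ.+-identityˡ _) (trans (ℤₚ.+-identityˡ _)
      (picks-cols R y (f ∘ inj₂) (λ x x≢y → z (inj₂ x) (λ { refl → x≢y refl })))))

sumBelow-cong : ∀ N {f g} → (∀ i → f i ≡ g i) → sumBelow N f ≡ sumBelow N g
sumBelow-cong zero    e = refl
sumBelow-cong (suc N) e = cong₂ ℤ._+_ (sumBelow-cong N e) (e N)

sumBelow-0 : ∀ N {f} → (∀ i → i ℕ.< N → f i ≡ 0ℤ) → sumBelow N f ≡ 0ℤ
sumBelow-0 zero    z = refl
sumBelow-0 (suc N) z = cong₂ ℤ._+_ (sumBelow-0 N (λ i p → z i (ℕₚ.m<n⇒m<1+n p))) (z N ℕₚ.≤-refl)

sumBelow-∑ : ∀ N (xs : List A) (f : ℕ → A → ℤ) →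
  sumBelow N (λ i → ∑ xs (f i)) ≡ ∑ xs (λ x → sumBelow N (λ i → f i x))
sumBelow-∑ zero    xs f = sym (∑-0 xs)
sumBelow-∑ (suc N) xs f = trans (cong (ℤ._+ ∑ xs (f N)) (sumBelow-∑ N xs f)) (sym (∑-+ xs _ (f N)))

sumBelow-picks : ∀ N R f → R ℕ.< N → (∀ i → i ≢ R → f i ≡ 0ℤ) → sumBelow N f ≡ f R
sumBelow-picks (suc N) R f R< z with R ℕ.≟ N
... | yes refl = trans (cong (ℤ._+ f N) (sumBelow-0 N (λ i i<N → z i (ℕₚ.<⇒≢ i<N)))) (ℤₚ.+-identityˡ _)
... | no R≢N = trans (cong₂ ℤ._+_ (sumBelow-picks N R f (ℕₚ.≤∧≢⇒< (ℕₚ.≤-pred R<) R≢N) z) (z N (R≢N ∘ sym)))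
  (ℤₚ.+-identityʳ _)

entry-ext : ∀ (M M′ : Mat m n) → (∀ i j → entry M i j ≡ entry M′ i j) → M ≡ M′
entry-ext M M′ h = trans (sym (tabulate∘lookup M)) (trans (tabulate-cong (λ i →
  trans (sym (tabulate∘lookup (lookup M i))) (trans (tabulate-cong (h i)) (tabulate∘lookup (lookup M′ i)))))
  (tabulate∘lookup M′))

lookup-ext : ∀ (v w : Vec A n) → (∀ i → lookup v i ≡ lookup w i) → v ≡ w
lookup-ext v w h = trans (sym (tabulate∘lookup v)) (trans (tabulate-cong h) (tabulate∘lookup w))

-- Decoding and encoding

colour : ∀ R l → l ℕ.≤ R → Bool → Col R
colour zero    _       _       b = tt
colour (suc R) zero    _       b = inj₁ false
colour (suc R) (suc zero) _ true = inj₁ true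
colour (suc R) (suc l) (s≤s p) b = inj₂ (colour R l p b)

level-colour : ∀ R l (p : l ℕ.≤ R) b → level (colour R l p b) ≡ l
level-colour zero    zero          p       b     = refl
level-colour (suc R) zero          p       b     = refl
level-colour (suc R) (suc zero)    p       true  = refl
level-colour (suc R) (suc zero)    (s≤s p) false = cong suc (level-colour R 0 p false)
level-colour (suc R) (suc (suc l)) (s≤s p) b     = cong suc (level-colour R (suc l) p b)

upper-colour : ∀ R l (p : l ℕ.≤ R) b → (l ≡ 0 → b ≡ false) → upper (colour R l p b) ≡ b
upper-colour zero    zero          p       b     h = sym (h refl)
upper-colour (suc R) zero          p       b     h = sym (h refl)
upper-colour (suc R) (suc zero)    p       true  h = refl
upper-colour (suc R) (suc zero)    (s≤s p) false h = upper-colour R 0 p false (λ _ → refl)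
upper-colour (suc R) (suc (suc l)) (s≤s p) b     h = upper-colour R (suc l) p b (λ ())

colour-injective : ∀ {R} (k k′ : Col R) → level k ≡ level k′ → upper k ≡ upper k′ → k ≡ k′
colour-injective {zero}  tt tt _ _ = refl
colour-injective {suc R} (inj₁ false) (inj₁ false) p q = refl
colour-injective {suc R} (inj₁ true)  (inj₁ true)  p q = refl
colour-injective {suc R} (inj₁ true)  (inj₂ y) p q = ⊥-elim (true≢false (sym q) (upper-level y (sym (ℕₚ.suc-injective p))))
colour-injective {suc R} (inj₂ y) (inj₁ true)  p q = ⊥-elim (true≢false q (upper-level y (ℕₚ.suc-injective p)))
colour-injective {suc R} (inj₂ y) (inj₂ y′) p q = cong inj₂ (colour-injective y y′ (ℕₚ.suc-injective p) q)

layered-cong : ∀ {R p} {ℓ ℓ′ : Fin n → ℕ} {u u′ : Fin n → Bool} {e e′ : Fin n → Fin n → Bool} →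
  (∀ i → ℓ i ≡ ℓ′ i) → (∀ i → u i ≡ u′ i) → (∀ i j → e i j ≡ e′ i j) →
  Layered ℓ u e R p → Layered ℓ′ u′ e′ R p
layered-cong {ℓ = ℓ} {ℓ′} {u} {u′} {e} {e′} ℓ≡ u≡ e≡ lay = record
  { edge = λ z x h → let a , b , c = L.edge z x (trans (e≡ z x) h) in
      trans (sym (u≡ z)) a , trans (sym (u≡ x)) b , trans (sym (ℓ≡ z)) (trans c (cong suc (ℓ≡ x)))
  ; covered = λ z h → let x , p = L.covered z (trans (u≡ z) h) in x , trans (sym (e≡ z x)) p
  ; good = λ k p k≤ b a → L.good k p k≤ (below b) (above a) }
  where
  module L = Layered lay
  below : ∀ {k} → MissedBelow ℓ′ u′ e′ k → MissedBelow ℓ u e k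
  below (inj₁ h) = inj₁ (λ z p → trans (u≡ z) (h z (trans (sym (ℓ≡ z)) p)))
  below (inj₂ (x , a , b , h)) = inj₂ (x , trans (u≡ x) a , trans (cong suc (ℓ≡ x)) b ,
    λ z p q → trans (e≡ z x) (h z (trans (sym (ℓ≡ z)) p) (trans (sym (u≡ z)) q)))
  above : ∀ {k} → MissedAbove ℓ′ u′ e′ k → MissedAbove ℓ u e k
  above (inj₁ h) = inj₁ (λ z p → trans (u≡ z) (h z (trans (sym (ℓ≡ z)) p)))
  above (inj₂ (x , a , b , h)) = inj₂ (x , trans (u≡ x) a , trans (ℓ≡ x) b ,
    λ z p q → trans (e≡ x z) (h z (trans (sym (ℓ≡ z)) p) (trans (sym (u≡ z)) q)))

decode : ∀ {R} → Vec (Col R) n → Rel n → Rel n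
decode c H = Order.order (level ∘ lookup c) (entry H)

valid⇒SG31 : ∀ R (c : Vec (Col R) n) H → valid R true c H ≡ true → IsSG31Poset (decode c H)
valid⇒SG31 R c H v = FromLayered.isSG31 (valid⇒layered R true c H v) (level≤ ∘ lookup c)

-- Each of the `suc R` levels is inhabited, and representatives of different levels are distinct. So
-- finitely many `R` suffice for given `n`.
valid⇒R<n : ∀ {n} R (c : Vec (Col R) n) H → valid R true c H ≡ true → R ℕ.< n
valid⇒R<n {n} R c H v = Finₚ.injective⇒≤ {f = vertex} (λ {i} {j} p →
    Finₚ.toℕ-injective (trans (sym (vertex-level i)) (trans (cong (level ∘ lookup c) p) (vertex-level j))))
  where
  module F = FromLayered (valid⇒layered R true c H v) (level≤ ∘ lookup c)
  vertex : Fin (suc R) → Fin n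
  vertex k = proj₁ (F.inhabited (toℕ k) (Finₚ.toℕ≤pred[n] k))
  vertex-level : ∀ k → level (lookup c (vertex k)) ≡ toℕ k
  vertex-level k = proj₂ (F.inhabited (toℕ k) (Finₚ.toℕ≤pred[n] k))

decode-leq : ∀ {R R′} (c : Vec (Col R) n) H (c′ : Vec (Col R′) n) H′ → decode c H ≡ decode c′ H′ →
  ∀ i j → Order.leq (level ∘ lookup c) (entry H) i j ≡ true → Order.leq (level ∘ lookup c′) (entry H′) i j ≡ true
decode-leq c H c′ H′ d i j h = trans (sym (entry-matrix _ i j))
  (trans (cong (λ M → entry M i j) (sym d)) (trans (entry-matrix _ i j) h))

decode-R : ∀ {R R′} (c : Vec (Col R) n) H (c′ : Vec (Col R′) n) H′ →
  valid R true c H ≡ true → valid R′ true c′ H′ ≡ true → decode c H ≡ decode c′ H′ → R ≡ R′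
decode-R {R = R} {R′} c H c′ H′ v v′ d = ℕₚ.≤-antisym
  (top-≤ {e′ = entry H′} (valid⇒layered R true c H v) (level≤ ∘ lookup c) (decode-leq c H c′ H′ d) (level≤ ∘ lookup c′))
  (top-≤ {e′ = entry H} (valid⇒layered R′ true c′ H′ v′) (level≤ ∘ lookup c′) (decode-leq c′ H′ c H (sym d)) (level≤ ∘ lookup c))

decode-injective : ∀ {R} (c : Vec (Col R) n) H (c′ : Vec (Col R) n) H′ →
  valid R true c H ≡ true → valid R true c′ H′ ≡ true → decode c H ≡ decode c′ H′ → c ≡ c′ × H ≡ H′
decode-injective {R = R} c H c′ H′ v v′ d =
  lookup-ext c c′ (λ i → colour-injective (lookup c i) (lookup c′ i) (ℓ≡ i)
    (Boolₚ.⇔→≡ (mk⇔ (upper-⇒ lay lay′ ℓ≡ le′ i) (upper-⇒ lay′ lay (sym ∘ ℓ≡) le i)))) ,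
  entry-ext H H′ (λ i j → Boolₚ.⇔→≡ (mk⇔ (edge-⇒ lay lay′ ℓ≡ le′ i j) (edge-⇒ lay′ lay (sym ∘ ℓ≡) le i j)))
  where
  lay = valid⇒layered R true c H v
  lay′ = valid⇒layered R true c′ H′ v′
  le = decode-leq c H c′ H′ d
  le′ = decode-leq c′ H′ c H (sym d)
  ℓ≡ : ∀ i → level (lookup c i) ≡ level (lookup c′ i)
  ℓ≡ i = ℕₚ.≤-antisym (level-≤ {ℓ′ = level ∘ lookup c′} {e′ = entry H′} lay (level≤ ∘ lookup c) le (level (lookup c i)) i refl)
    (level-≤ {ℓ′ = level ∘ lookup c} {e′ = entry H} lay′ (level≤ ∘ lookup c′) le′ (level (lookup c′ i)) i refl)

record Code (M : Rel n) : Set where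
  field
    R       : ℕ
    c       : Vec (Col R) n
    H       : Rel n
    isValid : valid R true c H ≡ true
    decodes : decode c H ≡ M

encode : (M : Rel n) → Fin n → IsSG31Poset M → Code M
encode {n} M i₀ sg = record { R = F.R ; c = c ; H = H ; isValid = layered⇒valid F.R true c H lay ; decodes = dec }
  where
  module F = FromPoset M i₀ sg
  rk-0 : ∀ i → F.rk i ≡ 0 → F.isMissing i ≡ false
  rk-0 i p with F.isMissing i in m
  ... | false = refl
  ... | true with trans (sym p) (proj₁ (F.missing⁻ {i} (proj₂ (F.isMissing⁻ {i} m))))
  ...   | ()
  colours : Fin n → Col F.R
  colours i = colour F.R (F.rk i) (F.rk≤ i) (F.isMissing i)
  c : Vec (Col F.R) n
  c = tabulate colours
  H : Rel n
  H = matrix F.missing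
  ℓ≡ : ∀ i → F.rk i ≡ level (lookup c i)
  ℓ≡ i = sym (trans (cong level (lookup∘tabulate colours i)) (level-colour F.R (F.rk i) (F.rk≤ i) (F.isMissing i)))
  u≡ : ∀ i → F.isMissing i ≡ upper (lookup c i)
  u≡ i = sym (trans (cong upper (lookup∘tabulate colours i)) (upper-colour F.R (F.rk i) (F.rk≤ i) (F.isMissing i) (rk-0 i)))
  e≡ : ∀ i j → F.missing i j ≡ entry H i j
  e≡ i j = sym (entry-matrix F.missing i j)
  lay : LayeredBy F.R true c H
  lay = layered-cong ℓ≡ u≡ e≡ F.layered
  leq≡ : ∀ i j → Order.leq (level ∘ lookup c) (entry H) i j ≡ Order.leq F.rk F.missing i j
  leq≡ i j rewrite sym (ℓ≡ i) | sym (ℓ≡ j) | sym (e≡ j i) = refl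
  dec : decode c H ≡ M
  dec = entry-ext (decode c H) M (λ i j → trans (entry-matrix _ i j) (trans (leq≡ i j) (F.leq-correct i j)))

_≟ᴹ_ : (M M′ : Rel n) → Dec (M ≡ M′)
_≟ᴹ_ = ≡-dec (≡-dec Boolₚ._≟_)

∑-indicator-∉ : ∀ {L : List (Rel n)} {M} → All (M ≢_) L → ∑ L (λ M′ → ⟦ does (M ≟ᴹ M′) ⟧) ≡ 0ℤ
∑-indicator-∉ [] = refl
∑-indicator-∉ {M = M} (_∷_ {x} M≢x all) = cong₂ (λ b t → ⟦ b ⟧ ℤ.+ t) (dec-false (M ≟ᴹ x) M≢x) (∑-indicator-∉ all)

∑-indicator : ∀ {L : List (Rel n)} {M} → Unique L → M ∈ L → ∑ L (λ M′ → ⟦ does (M ≟ᴹ M′) ⟧) ≡ 1ℤ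
∑-indicator {M = M} (all ∷ _) (here refl) = cong₂ (λ b t → ⟦ b ⟧ ℤ.+ t) (dec-true (M ≟ᴹ M) refl) (∑-indicator-∉ all)
∑-indicator {M = M} (_∷_ {x} all uniq) (there p) = trans
  (cong₂ (λ b t → ⟦ b ⟧ ℤ.+ t) (dec-false (M ≟ᴹ x) (λ { refl → All.lookup all p refl })) (∑-indicator uniq p))
  (ℤₚ.+-identityˡ _)

∑-length : ∀ (L : List A) → ∑ L (λ _ → 1ℤ) ≡ + length L
∑-length []      = refl
∑-length (x ∷ L) = trans (+-congˡ 1ℤ (∑-length L)) (sym (ℤₚ.pos-+ 1 (length L)))

∑-cong-∈ : ∀ (L : List A) {f g : A → ℤ} → (∀ x → x ∈ L → f x ≡ g x) → ∑ L f ≡ ∑ L g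
∑-cong-∈ []      h = refl
∑-cong-∈ (x ∷ L) h = cong₂ ℤ._+_ (h x (here refl)) (∑-cong-∈ L (λ y p → h y (there p)))

module _ {n k : ℕ} (i₀ : Fin n) (count : CountSG31 n k) where

  private
    L = proj₁ count
    unique = proj₁ (proj₂ (proj₂ count))
    member : ∀ M → M ∈ L → IsSG31Poset M
    member M = Equivalence.to (proj₂ (proj₂ (proj₂ count)) M)
    complete : ∀ M → IsSG31Poset M → M ∈ L
    complete M = Equivalence.from (proj₂ (proj₂ (proj₂ count)) M)

  -- The incidence matrix of a double count: summed over the posets of the list it gives 1 for each
  -- valid structure, summed over all structures it gives 1 for each poset.
  hits : ∀ R → Vec (Col R) n → Rel n → Rel n → ℤ
  hits R c H M = ⟦ valid R true c H ⟧ ℤ.* ⟦ does (decode c H ≟ᴹ M) ⟧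

  hits-zero : ∀ R c H M → ¬ (valid R true c H ≡ true × decode c H ≡ M) → hits R c H M ≡ 0ℤ
  hits-zero R c H M ¬h with valid R true c H in v | decode c H ≟ᴹ M
  ... | false | _     = refl
  ... | true  | no _  = refl
  ... | true  | yes d = ⊥-elim (¬h (refl , d))

  ∑-hits-structure : ∀ R c H → ∑ L (hits R c H) ≡ ⟦ valid R true c H ⟧
  ∑-hits-structure R c H = trans (∑-*ˡ L ⟦ valid R true c H ⟧ _) (go (valid R true c H) refl)
    where
    go : ∀ b → valid R true c H ≡ b → ⟦ b ⟧ ℤ.* ∑ L (λ M → ⟦ does (decode c H ≟ᴹ M) ⟧) ≡ ⟦ b ⟧
    go false v = refl
    go true  v = trans (ℤₚ.*-identityˡ _) (∑-indicator unique (complete (decode c H) (valid⇒SG31 R c H v)))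

  ∑-hits-poset : ∀ N M → n ℕ.≤ N → M ∈ L →
    sumBelow N (λ R → ∑ (vecs (cols R) n) (λ c → ∑ (mats n n) (λ H → hits R c H M))) ≡ 1ℤ
  ∑-hits-poset N M n≤N M∈L = begin
    sumBelow N (λ R → ∑ (vecs (cols R) n) (λ c → ∑ (mats n n) (λ H → hits R c H M)))
      ≡⟨ sumBelow-picks N C.R _ (ℕₚ.<-≤-trans (valid⇒R<n C.R C.c C.H C.isValid) n≤N)
           (λ R R≢ → trans (∑-cong (vecs (cols R) n) (λ c → trans (∑-cong (mats n n) (λ H →
             hits-zero R c H M (λ { (v , d) → R≢ (decode-R c H C.c C.H v C.isValid (trans d (sym C.decodes))) })))
             (∑-0 (mats n n)))) (∑-0 (vecs (cols R) n))) ⟩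
    ∑ (vecs (cols C.R) n) (λ c → ∑ (mats n n) (λ H → hits C.R c H M))
      ≡⟨ picks-vecs (picks-cols C.R) C.c _ (λ c c≢ → trans (∑-cong (mats n n) (λ H →
           hits-zero C.R c H M (λ { (v , d) → c≢ (proj₁ (decode-injective c H C.c C.H v C.isValid (trans d (sym C.decodes)))) })))
           (∑-0 (mats n n))) ⟩
    ∑ (mats n n) (λ H → hits C.R C.c H M)
      ≡⟨ picks-vecs (picks-vecs picks-bits) C.H _ (λ H H≢ → hits-zero C.R C.c H M
           (λ { (v , d) → H≢ (proj₂ (decode-injective C.c H C.c C.H v C.isValid (trans d (sym C.decodes)))) })) ⟩
    hits C.R C.c C.H M
      ≡⟨ cong₂ (λ a b → ⟦ a ⟧ ℤ.* ⟦ b ⟧) C.isValid (dec-true (decode C.c C.H ≟ᴹ M) C.decodes) ⟩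
    1ℤ ∎
    where
    open ≡-Reasoning
    module C = Code (encode M i₀ (member M M∈L))

  partialSum-count : ∀ N → n ℕ.≤ N → partialSum N true n ≡ + k
  partialSum-count N n≤N = begin
    partialSum N true n
      ≡⟨ sumBelow-cong N (λ R → trans (∑-cong (vecs (cols R) n) (λ c → trans
           (∑-cong (mats n n) (λ H → sym (∑-hits-structure R c H))) (∑-swap (mats n n) L (hits R c))))
           (∑-swap (vecs (cols R) n) L _)) ⟩
    sumBelow N (λ R → ∑ L (λ M → ∑ (vecs (cols R) n) (λ c → ∑ (mats n n) (λ H → hits R c H M))))
      ≡⟨ sumBelow-∑ N L _ ⟩
    ∑ L (λ M → sumBelow N (λ R → ∑ (vecs (cols R) n) (λ c → ∑ (mats n n) (λ H → hits R c H M))))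
      ≡⟨ ∑-cong-∈ L (λ M → ∑-hits-poset N M n≤N) ⟩
    ∑ L (λ _ → 1ℤ)
      ≡⟨ ∑-length L ⟩
    + length L
      ≡⟨ cong +_ (proj₁ (proj₂ count)) ⟩
    + k ∎
    where open ≡-Reasoning

-- The encoding needs an element `i₀` to find the top rank, so the empty poset is treated
-- separately.
count-0 : ∀ {k} → CountSG31 0 k → k ≡ 1
count-0 (L , len , uniq , mem) = trans (sym len) (go L uniq (Equivalence.from (mem []) sg))
  where
  sg : IsSG31Poset []
  sg = ((λ ()) , (λ ()) , (λ ())) , ((λ ()) , ((λ ()) , (λ ())) , (λ ()) , (λ ())) , (λ { (() , _) })
  go : ∀ L → Unique L → [] ∈ L → length L ≡ 1
  go ([] ∷ [])      _ _ = refl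
  go ([] ∷ [] ∷ L) ((p ∷ _) ∷ _) _ = ⊥-elim (p refl)

theorem6p7 : (g : ℕ → ℕ) → (∀ n → CountSG31 n (g n)) →
    ∀ k →
    ((egf g ⊖ const 1ℚ) ⊗
    (expS 1 ⊗ (const ℚ[ 2 ] ⊗ expS 1 ⊕ const 1ℚ)
    ⊕ (expS 2 ⊖ const ℚ[ 2 ] ⊗ expS 1 ⊖ const 1ℚ) ⊗ Ψ)) k
    ≡
    (expS 2 ⊗ (const ℚ[ 2 ] ⊗ expS 1 ⊖ const ℚ[ 3 ])
    ⊕ expS 1 ⊗ (expS 1 ⊖ const ℚ[ 2 ]) ⊗ (expS 1 ⊖ const ℚ[ 2 ]) ⊗ Ψ) k
theorem6p7 g counted k = trans (lhs .at k) (trans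
    (ι-cong {G ✶ denominator k exp ψ} {numerator k exp ψ} k (trans
      (✶-cong {g = denominator k exp ψ} k G-partial (λ _ _ → refl))
      (partialSum-closed k (suc k) ℕₚ.≤-refl k ℕₚ.≤-refl)))
    (sym (rhs .at k)))
  where
  G : Seq
  G = (λ n → + g n) ⊞ ⊟ cst 1ℤ
  G-partial : ∀ m → m ℕ.≤ k → G m ≡ partialSum (suc k) true m
  -- The 1 subtracted from g removes the empty poset, and no structure with initial bit `true` has
  -- zero vertices, so both sides are 0.
  G-partial zero    _  = trans (cong (λ t → + t ℤ.+ -1ℤ) (count-0 (counted 0)))
    (sym (sumBelow-0 (suc k) (λ R _ → structures-vanish⁺ R 0 (s≤s z≤n))))
  G-partial (suc m) m≤ = trans (ℤₚ.+-identityʳ _)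
    (sym (partialSum-count zero (counted (suc m)) (suc k) (ℕₚ.m≤n⇒m≤1+n m≤)))
  one = const-ι 1ℤ
  two⊗exp = ⊗-ι (const-ι (+ 2)) exp₁-ι
  exp⊖two = ⊖-ι exp₁-ι (const-ι (+ 2))
  lhs : (egf g ⊖ const 1ℚ) ⊗ (expS 1 ⊗ (const ℚ[ 2 ] ⊗ expS 1 ⊕ const 1ℚ)
    ⊕ (expS 2 ⊖ const ℚ[ 2 ] ⊗ expS 1 ⊖ const 1ℚ) ⊗ Ψ) ≈ι G ✶ denominator k exp ψ
  lhs = ⊗-ι (⊖-ι (egf-ι g) one)
    (⊕-ι (⊗-ι exp₁-ι (⊕-ι two⊗exp one)) (⊗-ι (⊖-ι (⊖-ι exp₂-ι two⊗exp) one) Ψ-ι))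
  rhs : expS 2 ⊗ (const ℚ[ 2 ] ⊗ expS 1 ⊖ const ℚ[ 3 ])
    ⊕ expS 1 ⊗ (expS 1 ⊖ const ℚ[ 2 ]) ⊗ (expS 1 ⊖ const ℚ[ 2 ]) ⊗ Ψ ≈ι numerator k exp ψ
  rhs = ⊕-ι (⊗-ι exp₂-ι (⊖-ι two⊗exp (const-ι (+ 3))))
    (⊗-ι (⊗-ι (⊗-ι exp₁-ι exp⊖two) exp⊖two) Ψ-ι)
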